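{- Let $n\geq1$ and $w\in S_n$, and let $P_w(x,t)$ be defined as below (using any reduced word for $w$). Then $$\mathcal{K}^{(n)}_w(x,t)=\frac{P_w(x,t)}{\prod_{l=1}^{n}\prod_{\alpha\in A_l(w)}(1-x^\alpha T_l)},\qquad \mathcal{K}_w(x,t)=\frac{P_w(x,t)}{\prod_{l=1}^{\infty}\prod_{\alpha\in A_l(w)}(1-x^\alpha T_l)}.$$ (In particular $P_w$ does not depend on the reduced word used.)
   Context: $S_n\subseteq S_{n+1}\subseteq\cdots$ (as stabilizers of the larger integers), permutations compose as functions, $s_i$ is the transposition of $i,i+1$, $\ell(w)$ is the length. For $l\geq1$, $w^l$ is the increasing ordering of $w(1),\dots,w(l)$; $A_l(w)$ is the set of strictly increasing sequences $\alpha=(\alpha_1<\dots<\alpha_l)$ of positive integers with $\alpha_j\leq w^l_j$ for all $j$. For such $\alpha$, $s_i\alpha$ is the increasing sequence with entry set $\{s_i(\alpha_j)\}$, and $A_{l,i}(w)=\{\alpha\in A_l(w):s_i\alpha\notin A_l(w)\}$. $x^\alpha=\prod_jx_{\alpha_j}$, $T_l=t_1\cdots t_l$. On polynomials in $x_1,x_2,\dots$ (coefficients may involve $t$), $s_i$ swaps $x_i,x_{i+1}$, $\partial_if=(f-s_if)/(x_i-x_{i+1})$, $\pi_if=\partial_i(x_if)$; $\pi_w$ is the composition of the $\pi_i$ along a reduced word of $w$. For a partition $\lambda$ (non-increasing, eventually zero; $\ell(\lambda)$ = number of non-zero parts), $K_{\lambda,w}=\pi_w(\prod_ix_i^{\lambda_i})$,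 $t^\lambda=\prod t_i^{\lambda_i}$, $\mathcal{K}^{(n)}_w=\sum_{\ell(\lambda)\leq n}K_{\lambda,w}t^\lambda$, $\mathcal{K}_w=\sum_\lambda K_{\lambda,w}t^\lambda$. For $w$ and $i$ with $\ell(s_iw)>\ell(w)$, $N_{w,i}(x,t)=\prod_{l\geq1}\prod_{\alpha\in A_{l,i}(w)}(1-x^{s_i\alpha}T_l)$ (a finite product). Given a reduced word, i.e. $w_0=\mathrm{Id}$, $w_j=s_{i_j}w_{j-1}$ with $\ell(w_j)=j$ for $1\leq j\leq m=\ell(w)$ and $w_m=w$, define $P_{w_0}=1$ and $P_{w_j}=\pi_{i_j}\big(P_{w_{j-1}}N_{w_{j-1},i_j}\big)$ ($\pi$ acting on the $x$-variables); $P_w:=P_{w_m}$. -}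

module Defs where

open import Data.Nat using (ℕ; zero; suc; _+_; _∸_; _⊔_; _⊓_; _≤_; _≡ᵇ_; _<ᵇ_; _≤ᵇ_)
open import Data.Bool using (Bool; true; false; _∧_; not; if_then_else_)
open import Data.List using (List; []; _∷_; _++_; map; foldr; foldl; length; concatMap; upTo; replicate; take)
open import Data.Integer using (ℤ; +_; -_) renaming (_*_ to _*ℤ_; _+_ to _+ℤ_)
open import Data.Product using (_×_; _,_; proj₂)
open import Relation.Binary.PropositionalEquality using (_≡_)
open import Data.List.Relation.Binary.Permutation.Propositional using (_↭_)
open import Data.List.Relation.Unary.All using (All)

boolFilter : {A : Set} → (A → Bool) → List A → List A
boolFilter p [] = []
boolFilter p (x ∷ xs) = if p x then x ∷ boolFilter p xs else boolFilter p xs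

anyB : {A : Set} → (A → Bool) → List A → Bool
anyB p [] = false
anyB p (x ∷ xs) = if p x then true else anyB p xs

range1 : ℕ → List ℕ
range1 zero = []
range1 (suc N) = range1 N ++ (suc N ∷ [])

look : List ℕ → ℕ → ℕ → ℕ
look [] k d = d
look (v ∷ w) zero d = v
look (v ∷ w) (suc k) d = look w k d

eqL : List ℕ → List ℕ → Bool
eqL [] [] = true
eqL [] (_ ∷ _) = false
eqL (_ ∷ _) [] = false
eqL (a ∷ as) (b ∷ bs) = (a ≡ᵇ b) ∧ eqL as bs

maxL : List ℕ → ℕ
maxL = foldr _⊔_ 0

insertN : ℕ → List ℕ → List ℕ
insertN x [] = x ∷ []
insertN x (y ∷ ys) = if x ≤ᵇ y then x ∷ y ∷ ys else y ∷ insertN x ys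

sortN : List ℕ → List ℕ
sortN = foldr insertN []

choose : ℕ → List ℕ → List (List ℕ)
choose zero xs = [] ∷ []
choose (suc k) [] = []
choose (suc k) (x ∷ xs) = map (x ∷_) (choose k xs) ++ choose (suc k) xs

leAll : List ℕ → List ℕ → Bool
leAll [] [] = true
leAll [] (_ ∷ _) = false
leAll (_ ∷ _) [] = false
leAll (a ∷ as) (b ∷ bs) = (a ≤ᵇ b) ∧ leAll as bs

-- Exponent vectors: entry k (0-based) is the exponent of variable k+1.
-- Trailing zeros are irrelevant.

Exps : Set
Exps = List ℕ

eqE : Exps → Exps → Bool
eqE [] [] = true
eqE [] (b ∷ bs) = (b ≡ᵇ 0) ∧ eqE [] bs
eqE (a ∷ as) [] = (a ≡ᵇ 0) ∧ eqE as []
eqE (a ∷ as) (b ∷ bs) = (a ≡ᵇ b) ∧ eqE as bs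

addE : Exps → Exps → Exps
addE [] bs = bs
addE (a ∷ as) [] = a ∷ as
addE (a ∷ as) (b ∷ bs) = a + b ∷ addE as bs

subE : Exps → Exps → Exps
subE [] bs = []
subE (a ∷ as) [] = a ∷ as
subE (a ∷ as) (b ∷ bs) = a ∸ b ∷ subE as bs

getE : Exps → ℕ → ℕ
getE e zero = 0
getE e (suc k) = look e k 0

mkE : ℕ → (ℕ → ℕ) → Exps
mkE N f = map f (range1 N)

setE : Exps → ℕ → ℕ → Exps
setE e j v = mkE (length e ⊔ j) (λ k → if k ≡ᵇ j then v else getE e k)

unitE : ℕ → Exps
unitE i = mkE i (λ k → if k ≡ᵇ i then 1 else 0)

swapIdx : ℕ → ℕ → ℕ
swapIdx i j = if j ≡ᵇ i then suc i else (if j ≡ᵇ suc i then i else j)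

-- Polynomials in x₁,x₂,… and t₁,t₂,… over ℤ, as lists of terms
-- (coefficient , x-exponents , t-exponents); equality is coefficientwise.

Term : Set
Term = ℤ × Exps × Exps

Poly : Set
Poly = List Term

coeff : Poly → Exps → Exps → ℤ
coeff [] e f = + 0
coeff ((c , xe , te) ∷ p) e f = (if eqE xe e ∧ eqE te f then c else + 0) +ℤ coeff p e f

_+P_ : Poly → Poly → Poly
p +P q = p ++ q

negP : Poly → Poly
negP = map (λ { (c , xe , te) → (- c , xe , te) })

_*P_ : Poly → Poly → Poly
p *P q = concatMap (λ { (c , xe , te) → map (λ { (d , ye , ue) → (c *ℤ d , addE xe ye , addE te ue) }) q }) p

oneP : Poly
oneP = (+ 1 , [] , []) ∷ []

prodP : List Poly → Poly
prodP = foldr _*P_ oneP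

-- Divided differences (acting on the x-variables only).
-- ∂ᵢ(x^e) = (x^e - sᵢ x^e)/(xᵢ - xᵢ₊₁), written out explicitly:
-- with a = eᵢ, b = eᵢ₊₁, m = min a b, d = |a - b|,
-- ∂ᵢ(x^e) = ± Σ_{k<d} (monomial with xᵢ-exp m+d-1-k, xᵢ₊₁-exp m+k, rest unchanged),
-- sign + if a > b, - if a < b, and 0 if a = b.

∂term : ℕ → Term → Poly
∂term i (c , xe , te) =
  let a = getE xe i
      b = getE xe (suc i)
      m = a ⊓ b
      d = (a ∸ b) + (b ∸ a)
      c′ = if b <ᵇ a then c else - c
  in if a ≡ᵇ b then []
     else map (λ k → (c′ , setE (setE xe i (m + (d ∸ suc k))) (suc i) (m + k) , te)) (upTo d)

∂ : ℕ → Poly → Poly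
∂ i p = concatMap (∂term i) p

xVar : ℕ → Poly
xVar i = (+ 1 , unitE i , []) ∷ []

π : ℕ → Poly → Poly
π i p = ∂ i (xVar i *P p)

-- Finitary permutations of {1,2,…} in one-line notation [w(1),…,w(L)],
-- with w(j) = j for j > L.

Perm : Set
Perm = List ℕ

app : Perm → ℕ → ℕ
app w zero = zero
app w (suc k) = look w k (suc k)

_≈P_ : Perm → Perm → Set
w ≈P v = ∀ j → app w j ≡ app v j

sMul : ℕ → Perm → Perm
sMul i w = map (swapIdx i) (map (app w) (range1 (length w ⊔ suc i)))

lengthP : Perm → ℕ
lengthP w = length (concatMap (λ a → boolFilter (λ b → (a <ᵇ b) ∧ (app w b <ᵇ app w a)) (range1 (length w))) (range1 (length w)))

InS : ℕ → Perm → Set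
InS n w = w ↭ range1 n

wordPerm : List ℕ → Perm
wordPerm is = foldl (λ w i → sMul i w) [] is

ReducedWordOf : Perm → List ℕ → Set
ReducedWordOf w is =
  All (λ i → 1 ≤ i) is ×
  ((k : ℕ) → k ≤ length is → lengthP (wordPerm (take k is)) ≡ k) ×
  (wordPerm is ≈P w)

πword : List ℕ → Poly → Poly
πword is f = foldl (λ g i → π i g) f is

wl : Perm → ℕ → List ℕ
wl w l = sortN (map (app w) (range1 l))

Aset : Perm → ℕ → List (List ℕ)
Aset w l = boolFilter (λ α → leAll α (wl w l)) (choose l (range1 (maxL (wl w l))))

sα : ℕ → List ℕ → List ℕ
sα i α = sortN (map (swapIdx i) α)

AsetI : Perm → ℕ → ℕ → List (List ℕ)
AsetI w l i = boolFilter (λ α → not (anyB (eqL (sα i α)) (Aset w l))) (Aset w l)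

monoOf : List ℕ → Exps
monoOf α = foldr (λ j e → addE (unitE j) e) [] α

Texp : ℕ → Exps
Texp l = replicate l 1

factor : List ℕ → ℕ → Poly
factor α l = oneP +P negP ((+ 1 , monoOf α , Texp l) ∷ [])

-- N_{w,i}: the factors with l ≥ max(|w|, i+1) are empty since then A_{l,i}(w) = ∅
Nwi : Perm → ℕ → Poly
Nwi w i = prodP (concatMap (λ l → map (λ α → factor (sα i α) l) (AsetI w l i)) (range1 (length w ⊔ suc i)))

Dfin : Perm → ℕ → Poly
Dfin w L = prodP (concatMap (λ l → map (λ α → factor α l) (Aset w l)) (range1 L))

Pstep : Perm × Poly → ℕ → Perm × Poly
Pstep (w , P) i = (sMul i w , π i (P *P Nwi w i))

Pword : List ℕ → Poly
Pword is = proj₂ (foldl Pstep ([] , oneP) is)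

-- Formal power series in t with coefficients polynomials in x:
-- a series maps a t-exponent μ to the coefficient of t^μ (a polynomial in x, no t).

Series : Set
Series = Exps → Poly

tcoeff : Poly → Exps → Poly
tcoeff p μ = concatMap (λ { (c , xe , te) → if eqE te μ then (c , xe , []) ∷ [] else [] }) p

polyS : Poly → Series
polyS p = tcoeff p

below : Exps → List Exps
below [] = [] ∷ []
below (m ∷ μ) = concatMap (λ a → map (a ∷_) (below μ)) (upTo (suc m))

_⋆_ : Series → Series → Series
(f ⋆ g) μ = concatMap (λ ν → f ν *P g (subE μ ν)) (below μ)

_≈S_ : Series → Series → Set
f ≈S g = ∀ μ e → coeff (f μ) e [] ≡ coeff (g μ) e []

isPartition : Exps → Bool
isPartition [] = true
isPartition (a ∷ []) = true
isPartition (a ∷ b ∷ r) = (b ≤ᵇ a) ∧ isPartition (b ∷ r)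

nonzeros : Exps → ℕ
nonzeros [] = 0
nonzeros (a ∷ r) = (if a ≡ᵇ 0 then 0 else 1) + nonzeros r

Kn : ℕ → List ℕ → Series
Kn n is μ = if isPartition μ ∧ (nonzeros μ ≤ᵇ n) then πword is ((+ 1 , μ , []) ∷ []) else []

Kall : List ℕ → Series
Kall is μ = if isPartition μ then πword is ((+ 1 , μ , []) ∷ []) else []

-- ∏_{l=1}^{∞} ∏_{α ∈ A_l(w)} (1 - x^α T_l) as a series: the coefficient of t^μ
-- only sees the factors with l ≤ length μ (all others are 1 + terms divisible by t_l).
Dinf : Perm → Series
Dinf w μ = tcoeff (Dfin w (length μ)) μ

module Submission where

open import Defs
open import Data.Nat using (ℕ; _≤_)
open import Data.List using (List)
open import Data.Product using (_×_)

-- If s_i w > w, then A_l(s_i w) is the disjoint union of A_l(w) and s_i A_{l,i}(w), and it is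
-- stable under s_i. Hence the denominator D_w satisfies D_w N_{w,i} = D_{s_i w} with D_{s_i w}
-- symmetric in x_i, x_{i+1}, so that 𝒦_w D_w = P_w implies
-- (π_i 𝒦_w) D_{s_i w} = π_i (𝒦_w D_w N_{w,i}) = π_i (P_w N_{w,i}) = P_{s_i w}.
-- For w = Id, adding a column of height n to a partition with at most n parts gives
-- 𝒦⁽ⁿ⁾ (1 - x_1⋯x_n T_n) = 𝒦⁽ⁿ⁻¹⁾. Independence of the reduced word is Matsumoto's theorem
-- together with the braid relations of the π_i.
--
-- The coefficient of t^μ only depends on the classes in ℤ[x,t] modulo the monomials whose
-- t-part does not divide t^μ, so all identities are proved in that ring, where 𝒦 is a polynomial.

-- For a finite set α let c_k(α) be the number of entries at most k. Membership of α in A_l(w) says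
-- c_k(α) ≥ c_k(w^l) for all k, and s_i alters c only at k = i, where c_i becomes c_{i-1} + c_{i+1}
-- - c_i. If s_i w > w, then the value of c_i for the first l values of s_i w is the smaller of the
-- two values exchanged by this reflection. It lies below the mean of its neighbours, and since c
-- grows by at most 1 per step for a set α, the conditions become stable under s_i. The relation
-- (x_i - x_{i+1}) π_i f = x_i f - x_{i+1} s_i f replaces the monomial formula for π_i. It
-- determines π_i once x_a - x_b can be cancelled in the truncated ring, which is proved on the dual
-- side. Reducedness is used as w⁻¹(i) < w⁻¹(i+1) at every letter, the form in which it enters both
-- the exchange argument and the counts; inversions are counted only to translate the hypotheses.

-- Words in simple transpositions and Matsumoto's theorem.

module Words where

  open import Data.Nat
  open import Data.Nat.Properties
  open import Data.Bool using (true; false)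
  open import Data.Unit using (⊤)
  open import Data.Empty using (⊥-elim)
  open import Data.List using (List; []; _∷_; length)
  open import Data.Product using (_×_; _,_; proj₁; proj₂; ∃)
  open import Function using (_∘_)
  open import Relation.Nullary using (¬_)
  open import Relation.Binary.PropositionalEquality

  suc≢ : ∀ {n} → ¬ n ≡ suc n
  suc≢ = 1+n≢n ∘ sym

  -- Recursion on both arguments in place of the Boolean tests of `swapIdx`: the relations of the
  -- symmetric group then follow by case analysis.
  sw : ℕ → ℕ → ℕ
  sw zero zero = 1
  sw zero (suc zero) = 0
  sw zero (suc (suc k)) = suc (suc k)
  sw (suc i) zero = 0
  sw (suc i) (suc k) = suc (sw i k)

  swapIdx-suc : ∀ i k → swapIdx (suc i) (suc k) ≡ suc (swapIdx i k)
  swapIdx-suc i k with k ≡ᵇ i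
  ... | true = refl
  ... | false with k ≡ᵇ suc i
  ... | true = refl
  ... | false = refl

  swapIdx≗sw : ∀ i k → swapIdx i k ≡ sw i k
  swapIdx≗sw zero zero = refl
  swapIdx≗sw zero (suc zero) = refl
  swapIdx≗sw zero (suc (suc k)) = refl
  swapIdx≗sw (suc i) zero = refl
  swapIdx≗sw (suc i) (suc k) = trans (swapIdx-suc i k) (cong suc (swapIdx≗sw i k))

  sw-involutive : ∀ i k → sw i (sw i k) ≡ k
  sw-involutive zero zero = refl
  sw-involutive zero (suc zero) = refl
  sw-involutive zero (suc (suc k)) = refl
  sw-involutive (suc i) zero = refl
  sw-involutive (suc i) (suc k) = cong suc (sw-involutive i k)

  sw-braid : ∀ i k → sw i (sw (suc i) (sw i k)) ≡ sw (suc i) (sw i (sw (suc i) k))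
  sw-braid zero zero = refl
  sw-braid zero (suc zero) = refl
  sw-braid zero (suc (suc zero)) = refl
  sw-braid zero (suc (suc (suc k))) = refl
  sw-braid (suc i) zero = refl
  sw-braid (suc i) (suc k) = cong suc (sw-braid i k)

  sw-far : ∀ i d k → sw i (sw (2 + i + d) k) ≡ sw (2 + i + d) (sw i k)
  sw-far zero d zero = refl
  sw-far zero d (suc zero) = refl
  sw-far zero d (suc (suc k)) = refl
  sw-far (suc i) d zero = refl
  sw-far (suc i) d (suc k) = cong suc (sw-far i d k)

  sw-left : ∀ i → sw i i ≡ suc i
  sw-left zero = refl
  sw-left (suc i) = cong suc (sw-left i)

  sw-right : ∀ i → sw i (suc i) ≡ i
  sw-right zero = refl
  sw-right (suc i) = cong suc (sw-right i)

  sw-above : ∀ i k → suc i < k → sw i k ≡ k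
  sw-above zero (suc zero) (s≤s ())
  sw-above zero (suc (suc k)) lt = refl
  sw-above (suc i) (suc k) (s≤s lt) = cong suc (sw-above i k lt)

  sw-below : ∀ i k → k < i → sw i k ≡ k
  sw-below (suc i) zero lt = refl
  sw-below (suc i) (suc k) (s≤s lt) = cong suc (sw-below i k lt)

  -- Words are stored with the outermost letter first, and the letter j stands for
  -- the transposition of j + 1 and j + 2, so that every letter is legal.

  fwd : List ℕ → ℕ → ℕ
  fwd [] k = k
  fwd (j ∷ r) k = sw (suc j) (fwd r k)

  inv : List ℕ → ℕ → ℕ
  inv [] k = k
  inv (j ∷ r) k = inv r (sw (suc j) k)

  inv-fwd : ∀ r k → inv r (fwd r k) ≡ k
  inv-fwd [] k = refl
  inv-fwd (j ∷ r) k = trans (cong (inv r) (sw-involutive (suc j) (fwd r k))) (inv-fwd r k)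

  fwd-inv : ∀ r k → fwd r (inv r k) ≡ k
  fwd-inv [] k = refl
  fwd-inv (j ∷ r) k = trans (cong (sw (suc j)) (fwd-inv r (sw (suc j) k))) (sw-involutive (suc j) k)

  fwd-zero : ∀ r → fwd r 0 ≡ 0
  fwd-zero [] = refl
  fwd-zero (j ∷ r) = cong (sw (suc j)) (fwd-zero r)

  fwd≗⇒inv≗ : ∀ r r′ → (∀ k → fwd r k ≡ fwd r′ k) → ∀ k → inv r k ≡ inv r′ k
  fwd≗⇒inv≗ r r′ eq k = begin
    inv r k                     ≡⟨ inv-fwd r′ (inv r k) ⟨
    inv r′ (fwd r′ (inv r k))   ≡⟨ cong (inv r′) (eq (inv r k)) ⟨
    inv r′ (fwd r (inv r k))    ≡⟨ cong (inv r′) (fwd-inv r k) ⟩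
    inv r′ k                    ∎
    where open ≡-Reasoning

  -- For i = j + 1 the condition w⁻¹(i) < w⁻¹(i+1) is equivalent to s_i w being longer than w, so
  -- this is reducedness of the word without any mention of length.
  Asc : List ℕ → Set
  Asc [] = ⊤
  Asc (j ∷ r) = inv r (suc j) < inv r (suc (suc j)) × Asc r

  infix 4 _~_
  -- The relation s_i² = 1 is left out on purpose: the π_i are idempotent, not involutive, and
  -- length has to be an invariant.
  data _~_ : List ℕ → List ℕ → Set where
    ~refl  : ∀ {r} → r ~ r
    ~sym   : ∀ {r s} → r ~ s → s ~ r
    ~trans : ∀ {r s t} → r ~ s → s ~ t → r ~ t
    ~cons  : ∀ j {r s} → r ~ s → (j ∷ r) ~ (j ∷ s)
    ~braid : ∀ j r → (j ∷ suc j ∷ j ∷ r) ~ (suc j ∷ j ∷ suc j ∷ r)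
    ~far   : ∀ j d r → (j ∷ 2 + j + d ∷ r) ~ (2 + j + d ∷ j ∷ r)

  ~-length : ∀ {r s} → r ~ s → length r ≡ length s
  ~-length ~refl = refl
  ~-length (~sym e) = sym (~-length e)
  ~-length (~trans e f) = trans (~-length e) (~-length f)
  ~-length (~cons j e) = cong suc (~-length e)
  ~-length (~braid j r) = refl
  ~-length (~far j d r) = refl

  ~-inv : ∀ {r s} → r ~ s → ∀ k → inv r k ≡ inv s k
  ~-inv ~refl k = refl
  ~-inv (~sym e) k = sym (~-inv e k)
  ~-inv (~trans e f) k = trans (~-inv e k) (~-inv f k)
  ~-inv (~cons j e) k = ~-inv e (sw (suc j) k)
  ~-inv (~braid j r) k = cong (inv r) (sw-braid (suc j) k)
  ~-inv (~far j d r) k = cong (inv r) (sym (sw-far (suc j) d k))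

  private
    ~-inv′ : ∀ {r j τ} → r ~ (j ∷ τ) → ∀ k {m} → sw (suc j) k ≡ m → inv τ k ≡ inv r m
    ~-inv′ {r} {j} {τ} e k refl = trans (cong (inv τ) (sym (sw-involutive (suc j) k))) (sym (~-inv e (sw (suc j) k)))

    data Position : ℕ → ℕ → Set where
      same  : ∀ i → Position i i
      up    : ∀ i → Position i (suc i)
      down  : ∀ i → Position (suc i) i
      above : ∀ i d → Position i (2 + i + d)
      below′ : ∀ i d → Position (2 + i + d) i

    position : ∀ i j → Position i j
    position zero zero = same 0
    position zero (suc zero) = up 0
    position zero (suc (suc j)) = above 0 j
    position (suc zero) zero = down 0
    position (suc (suc i)) zero = below′ 0 i
    position (suc i) (suc j) with position i j
    ... | same .i = same (suc i)
    ... | up .i = up (suc i)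
    ... | down .j = down (suc j)
    ... | above .i d = above (suc i) d
    ... | below′ .j d = below′ (suc j) d

    lt : ∀ {a b c d} → a ≡ b → c ≡ d → b < d → a < c
    lt refl refl p = p

    far₁ : ∀ j d → sw (suc j) (suc (2 + j + d)) ≡ suc (2 + j + d)
    far₁ j d = sw-above (suc j) _ (s≤s (s≤s (s≤s (m≤m+n j d))))

    far₂ : ∀ j d → sw (suc j) (suc (suc (2 + j + d))) ≡ suc (suc (2 + j + d))
    far₂ j d = sw-above (suc j) _ (m≤n⇒m≤1+n (s≤s (s≤s (s≤s (m≤m+n j d)))))

    far₃ : ∀ j d → sw (suc (2 + j + d)) (suc j) ≡ suc j
    far₃ j d = sw-below _ _ (s≤s (m≤n⇒m≤1+n (s≤s (m≤m+n j d))))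

    far₄ : ∀ j d → sw (suc (2 + j + d)) (suc (suc j)) ≡ suc (suc j)
    far₄ j d = sw-below _ _ (s≤s (s≤s (s≤s (m≤m+n j d))))

    fix₁ : ∀ i → sw (suc i) (3 + i) ≡ 3 + i
    fix₁ i = sw-above (suc i) _ ≤-refl

    fix₂ : ∀ i → sw (2 + i) (suc i) ≡ suc i
    fix₂ i = sw-below (2 + i) _ ≤-refl

  -- The three inverse values x < y < z are brought into decreasing order by three adjacent swaps.
  -- The two words are the two ways to do so, and each swap acts on a pair that is still increasing.
  Asc-braid : ∀ i υ → inv υ (suc i) < inv υ (2 + i) → inv υ (2 + i) < inv υ (3 + i) → Asc υ →
              Asc (i ∷ suc i ∷ i ∷ υ) × Asc (suc i ∷ i ∷ suc i ∷ υ)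
  Asc-braid i υ x<y y<z as
    = ( lt (trans (cong (inv υ ∘ sw (suc i)) (fix₂ i)) (cong (inv υ) (sw-left (suc i))))
           (trans (cong (inv υ ∘ sw (suc i)) (sw-left (2 + i))) (cong (inv υ) (fix₁ i))) y<z
      , lt (cong (inv υ) (sw-right (suc i))) (cong (inv υ) (fix₁ i)) (<-trans x<y y<z)
      , x<y , as)
    , ( lt (trans (cong (inv υ ∘ sw (2 + i)) (sw-right (suc i))) (cong (inv υ) (fix₂ i)))
           (trans (cong (inv υ ∘ sw (2 + i)) (fix₁ i)) (cong (inv υ) (sw-right (2 + i)))) x<y
      , lt (cong (inv υ) (fix₂ i)) (cong (inv υ) (sw-left (2 + i))) (<-trans x<y y<z)
      , y<z , as)

  -- A left descent of a reduced word can be brought to the front by braid moves alone. The argument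
  -- compares the first letter i with j: a distant i commutes past j, an adjacent one needs two
  -- exchanges inside the tail. The second of these acts on a word that is not a sublist of the
  -- given one, hence the bound `n` on the length.
  exchange : ∀ n r j → length r ≤ n → Asc r → inv r (2 + j) < inv r (suc j) →
             ∃ λ τ → Asc (j ∷ τ) × r ~ (j ∷ τ)
  exchange n [] j _ _ p = ⊥-elim (<-asym p (n<1+n _))
  exchange (suc n) (i ∷ r) j (s≤s len) (a , as) p with position i j
  ... | same .i = r , (a , as) , ~refl
  ... | above .i d
    with τ , (b , bs) , e ← exchange n r j len as (lt (cong (inv r) (sym (far₂ i d))) (cong (inv r) (sym (far₁ i d))) p)
    = i ∷ τ
    , (lt (cong (inv τ) (far₁ i d)) (cong (inv τ) (far₂ i d)) b
      , lt (~-inv′ e _ (far₃ i d)) (~-inv′ e _ (far₄ i d)) a , bs)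
    , ~trans (~cons i e) (~far i d τ)
  ... | below′ .j d
    with τ , (b , bs) , e ← exchange n r j len as (lt (cong (inv r) (sym (far₄ j d))) (cong (inv r) (sym (far₃ j d))) p)
    = i ∷ τ
    , (lt (cong (inv τ) (far₃ j d)) (cong (inv τ) (far₄ j d)) b
      , lt (~-inv′ e _ (far₁ j d)) (~-inv′ e _ (far₂ j d)) a , bs)
    , ~trans (~cons i e) (~sym (~far j d τ))
  -- Let A, B, C be the values of `inv r` at i+1, i+2, i+3. The hypotheses give C < A < B.
  -- Extracting the letter i+1 from `r` and then i from the rest sorts them to C, A, B on `υ`, so
  -- `i ∷ r` is equivalent to i, i+1, i, `υ` and the braid relation brings i+1 to the front.
  ... | up .i
    with C<A ← lt (cong (inv r) (sym (fix₁ i))) (cong (inv r) (sym (sw-right (suc i)))) p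
    with τ , (b , bs) , e ← exchange n r j len as (<-trans C<A a)
    with υ , (c , cs) , f ← exchange n τ i (≤-trans (n≤1+n _) (subst (_≤ n) (~-length e) len)) bs
           (lt (~-inv′ e (2 + i) (sw-left (2 + i))) (~-inv′ e (suc i) (fix₂ i)) C<A)
    = i ∷ suc i ∷ υ
    , proj₂ (Asc-braid i υ
        c
        (lt (trans (~-inv′ f (2 + i) (sw-right (suc i))) (~-inv′ e (suc i) (fix₂ i)))
            (trans (~-inv′ f (3 + i) (fix₁ i)) (~-inv′ e (3 + i) (sw-right (2 + i)))) a)
        cs)
    , ~trans (~cons i (~trans e (~cons j f))) (~braid i υ)
  -- The mirror image, with B < C < A for the values of `inv r` at j+1, j+2, j+3.
  ... | down .j
    with C<A ← lt (cong (inv r) (sym (sw-left (2 + j)))) (cong (inv r) (sym (fix₂ j))) p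
    with τ , (b , bs) , e ← exchange n r j len as (<-trans a C<A)
    with υ , (c , cs) , f ← exchange n τ i (≤-trans (n≤1+n _) (subst (_≤ n) (~-length e) len)) bs
           (lt (~-inv′ e (3 + j) (fix₁ j)) (~-inv′ e (2 + j) (sw-right (suc j))) C<A)
    = suc j ∷ j ∷ υ
    , proj₁ (Asc-braid j υ
        (lt (trans (~-inv′ f (suc j) (fix₂ j)) (~-inv′ e (suc j) (sw-left (suc j))))
            (trans (~-inv′ f (2 + j) (sw-left (2 + j))) (~-inv′ e (3 + j) (fix₁ j))) a)
        c
        cs)
    , ~trans (~cons (suc j) (~trans e (~cons j f))) (~sym (~braid j υ))

  -- The first letter of the second word is a left descent of the common permutation, so `exchange`
  -- brings it to the front of the first word and the tails are compared.
  matsumoto : ∀ r s → Asc r → Asc s → (∀ k → inv r k ≡ inv s k) → r ~ s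
  matsumoto [] [] _ _ _ = ~refl
  matsumoto (i ∷ r) [] (a , _) _ eq = ⊥-elim (<-asym (n<1+n (suc i))
    (lt (trans (sym (eq (2 + i))) (cong (inv r) (sw-right (suc i)))) (trans (sym (eq (suc i))) (cong (inv r) (sw-left (suc i)))) a))
  matsumoto r (j ∷ s) as (b , bs) eq
    with τ , (c , cs) , e ← exchange (length r) r j ≤-refl as
      (lt (trans (eq (2 + j)) (cong (inv s) (sw-right (suc j)))) (trans (eq (suc j)) (cong (inv s) (sw-left (suc j)))) b)
    = ~trans e (~cons j (matsumoto τ s cs bs λ k → trans (~-inv′ e k refl)
        (trans (eq (sw (suc j) k)) (cong (inv s) (sw-involutive (suc j) k)))))

open Words

-- Exponent vectors and linear functionals on lists of terms.

module Exponents where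

  open import Data.Nat using (ℕ; zero; suc; _≤_; _<_; z≤n; s≤s; _≡ᵇ_; _⊔_) renaming (_+_ to _+ℕ_)
  import Data.Nat.Properties as ℕₚ
  open import Data.Integer using (ℤ; +_; -_; _+_; _*_; _-_)
  import Data.Integer.Properties as ℤₚ
  open import Data.Integer.Solver using (module +-*-Solver)
  open import Data.Bool using (if_then_else_)
  open import Data.Empty using (⊥-elim)
  open import Data.List using (List; []; _∷_; _++_; map; length; applyUpTo; concatMap)
  open import Data.List.Properties using (concatMap-++; ++-identityʳ; applyUpTo-∷ʳ; map-applyUpTo; length-applyUpTo; length-map)
  open import Data.Product using (_,_)
  open import Function using (_∘_)
  open import Relation.Nullary using (¬_; yes; no)
  open import Relation.Binary.PropositionalEquality

  range1≡ : ∀ n → range1 n ≡ applyUpTo suc n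
  range1≡ zero = refl
  range1≡ (suc n) = trans (cong (_++ suc n ∷ []) (range1≡ n)) (applyUpTo-∷ʳ suc n)

  length-range1 : ∀ n → length (range1 n) ≡ n
  length-range1 n = trans (cong length (range1≡ n)) (length-applyUpTo suc n)

  look-applyUpTo : ∀ f n k d → k < n → look (applyUpTo f n) k d ≡ f k
  look-applyUpTo f (suc n) zero d _ = refl
  look-applyUpTo f (suc n) (suc k) d (s≤s p) = look-applyUpTo (f ∘ suc) n k d p

  look-beyond : ∀ w k d → length w ≤ k → look w k d ≡ d
  look-beyond [] k d _ = refl
  look-beyond (v ∷ w) (suc k) d (s≤s p) = look-beyond w k d p

  map-range1 : ∀ {A : Set} (f : ℕ → A) n → map f (range1 n) ≡ applyUpTo (f ∘ suc) n
  map-range1 f n = trans (cong (map f) (range1≡ n)) (map-applyUpTo suc f n)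

  concatMap-range1-suc : ∀ {A : Set} (f : ℕ → List A) n → concatMap f (range1 (suc n)) ≡ concatMap f (range1 n) ++ f (suc n)
  concatMap-range1-suc f n = trans (concatMap-++ f (range1 n) (suc n ∷ [])) (cong (concatMap f (range1 n) ++_) (++-identityʳ (f (suc n))))

  infix 4 _≐_
  record _≐_ (a b : Exps) : Set where
    constructor pointwise
    field at : ∀ k → getE a k ≡ getE b k
  open _≐_ public

  ≐-refl : ∀ {a} → a ≐ a
  ≐-refl = pointwise λ _ → refl

  ≐-sym : ∀ {a b} → a ≐ b → b ≐ a
  ≐-sym e = pointwise λ k → sym (at e k)

  ≐-trans : ∀ {a b c} → a ≐ b → b ≐ c → a ≐ c
  ≐-trans e f = pointwise λ k → trans (at e k) (at f k)

  getE-[] : ∀ k → getE [] k ≡ 0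
  getE-[] zero = refl
  getE-[] (suc k) = refl

  getE-add : ∀ a b k → getE (addE a b) k ≡ getE a k +ℕ getE b k
  getE-add [] b zero = refl
  getE-add [] b (suc k) = refl
  getE-add (x ∷ a) [] zero = refl
  getE-add (x ∷ a) [] (suc k) = sym (ℕₚ.+-identityʳ _)
  getE-add (x ∷ a) (y ∷ b) zero = refl
  getE-add (x ∷ a) (y ∷ b) (suc zero) = refl
  getE-add (x ∷ a) (y ∷ b) (suc (suc k)) = getE-add a b (suc k)

  addE-cong : ∀ {a a′ b b′} → a ≐ a′ → b ≐ b′ → addE a b ≐ addE a′ b′
  addE-cong {a} {a′} {b} {b′} e f = pointwise λ k →
    trans (getE-add a b k) (trans (cong₂ _+ℕ_ (at e k) (at f k)) (sym (getE-add a′ b′ k)))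

  addE-comm : ∀ a b → addE a b ≐ addE b a
  addE-comm a b = pointwise λ k →
    trans (getE-add a b k) (trans (ℕₚ.+-comm (getE a k) _) (sym (getE-add b a k)))

  addE-assoc : ∀ a b c → addE (addE a b) c ≐ addE a (addE b c)
  addE-assoc a b c = pointwise λ k →
    trans (getE-add (addE a b) c k) (trans (cong (_+ℕ getE c k) (getE-add a b k))
     (trans (ℕₚ.+-assoc (getE a k) _ _)
     (trans (cong (getE a k +ℕ_) (sym (getE-add b c k))) (sym (getE-add a (addE b c) k)))))

  addE-[] : ∀ a → addE a [] ≡ a
  addE-[] [] = refl
  addE-[] (x ∷ a) = refl

  getE-mk : ∀ N f k → 1 ≤ k → k ≤ N → getE (mkE N f) k ≡ f k
  getE-mk N f (suc k) _ p = trans (cong (λ z → look z k 0) (map-range1 f N)) (look-applyUpTo (f ∘ suc) N k 0 p)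

  length-mk : ∀ N (f : ℕ → ℕ) → length (mkE N f) ≡ N
  length-mk N f = trans (length-map f (range1 N)) (length-range1 N)

  getE-beyond : ∀ e k → length e < k → getE e k ≡ 0
  getE-beyond e (suc k) (s≤s p) = look-beyond e k 0 p

  getE-mk-beyond : ∀ N f k → N < k → getE (mkE N f) k ≡ 0
  getE-mk-beyond N f k p = getE-beyond (mkE N f) k (subst (_< k) (sym (length-mk N f)) p)

  getE-mk′ : ∀ N f → f 0 ≡ 0 → (∀ k → N < k → f k ≡ 0) → ∀ k → getE (mkE N f) k ≡ f k
  getE-mk′ N f f0 f> zero = sym f0
  getE-mk′ N f f0 f> (suc k) with suc k ℕₚ.≤? N
  ... | yes p = getE-mk N f (suc k) (s≤s z≤n) p
  ... | no ¬p = trans (getE-mk-beyond N f (suc k) (ℕₚ.≰⇒> ¬p)) (sym (f> (suc k) (ℕₚ.≰⇒> ¬p)))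

  if-≡ᵇ : ∀ {A : Set} k (x y : A) → (if k ≡ᵇ k then x else y) ≡ x
  if-≡ᵇ zero x y = refl
  if-≡ᵇ (suc k) x y = if-≡ᵇ k x y

  if-≢ᵇ : ∀ {A : Set} k j (x y : A) → ¬ k ≡ j → (if k ≡ᵇ j then x else y) ≡ y
  if-≢ᵇ zero zero x y p = ⊥-elim (p refl)
  if-≢ᵇ zero (suc j) x y p = refl
  if-≢ᵇ (suc k) zero x y p = refl
  if-≢ᵇ (suc k) (suc j) x y p = if-≢ᵇ k j x y (p ∘ cong suc)

  getE-set : ∀ e j v k → getE (setE e (suc j) v) k ≡ (if k ≡ᵇ suc j then v else getE e k)
  getE-set e j v = getE-mk′ _ _ refl λ k p →
    trans (if-≢ᵇ k (suc j) v _ λ { refl → ℕₚ.<-irrefl refl (ℕₚ.<-≤-trans p (ℕₚ.m≤n⊔m (length e) (suc j))) })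
          (getE-beyond e k (ℕₚ.≤-<-trans (ℕₚ.m≤m⊔n (length e) (suc j)) p))

  getE-set-same : ∀ e j v → getE (setE e (suc j) v) (suc j) ≡ v
  getE-set-same e j v = trans (getE-set e j v (suc j)) (if-≡ᵇ j _ _)

  getE-set-other : ∀ e j v k → ¬ k ≡ suc j → getE (setE e (suc j) v) k ≡ getE e k
  getE-set-other e j v k p = trans (getE-set e j v k) (if-≢ᵇ k (suc j) _ _ p)

  getE-unit : ∀ j k → getE (unitE (suc j)) k ≡ (if k ≡ᵇ suc j then 1 else 0)
  getE-unit j = getE-mk′ _ _ refl λ k p → if-≢ᵇ k (suc j) _ _ λ { refl → ℕₚ.<-irrefl refl p }

  getE-unit-same : ∀ j → getE (unitE (suc j)) (suc j) ≡ 1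
  getE-unit-same j = trans (getE-unit j (suc j)) (if-≡ᵇ j _ _)

  getE-unit-other : ∀ j k → ¬ k ≡ suc j → getE (unitE (suc j)) k ≡ 0
  getE-unit-other j k p = trans (getE-unit j k) (if-≢ᵇ k (suc j) _ _ p)

  -- The length is raised to j + 2 so that an entry moved to the right is not cut off.
  swapE : ℕ → Exps → Exps
  swapE j e = mkE (length e ⊔ suc (suc j)) (λ k → getE e (sw (suc j) k))

  getE-swap : ∀ j e k → getE (swapE j e) k ≡ getE e (sw (suc j) k)
  getE-swap j e = getE-mk′ _ _ refl λ k p →
    trans (cong (getE e) (sw-above (suc j) k (ℕₚ.≤-<-trans (ℕₚ.m≤n⊔m (length e) _) p)))
          (getE-beyond e k (ℕₚ.≤-<-trans (ℕₚ.m≤m⊔n (length e) _) p))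

  swapE-[] : ∀ j → swapE j [] ≐ []
  swapE-[] j = pointwise λ k → trans (getE-swap j [] k) (trans (getE-[] (sw (suc j) k)) (sym (getE-[] k)))

  swapE-cong : ∀ j {a b} → a ≐ b → swapE j a ≐ swapE j b
  swapE-cong j {a} {b} e = pointwise λ k → trans (getE-swap j a k) (trans (at e (sw (suc j) k)) (sym (getE-swap j b k)))

  swapE-add : ∀ j a b → swapE j (addE a b) ≐ addE (swapE j a) (swapE j b)
  swapE-add j a b = pointwise λ k → trans (getE-swap j (addE a b) k) (trans (getE-add a b (sw (suc j) k))
    (trans (sym (cong₂ _+ℕ_ (getE-swap j a k) (getE-swap j b k))) (sym (getE-add (swapE j a) (swapE j b) k))))

  swapE-involutive : ∀ j a → swapE j (swapE j a) ≐ a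
  swapE-involutive j a = pointwise λ k →
    trans (getE-swap j (swapE j a) k) (trans (getE-swap j a (sw (suc j) k)) (cong (getE a) (sw-involutive (suc j) k)))

  getE-swap² : ∀ i j a k → getE (swapE i (swapE j a)) k ≡ getE a (sw (suc j) (sw (suc i) k))
  getE-swap² i j a k = trans (getE-swap i (swapE j a) k) (getE-swap j a (sw (suc i) k))

  swapE-far : ∀ j d a → swapE j (swapE (2 +ℕ j +ℕ d) a) ≐ swapE (2 +ℕ j +ℕ d) (swapE j a)
  swapE-far j d a = pointwise λ k → trans (getE-swap² j (2 +ℕ j +ℕ d) a k)
    (trans (cong (getE a) (sym (sw-far (suc j) d k))) (sym (getE-swap² (2 +ℕ j +ℕ d) j a k)))

  swapE-braid : ∀ j a → swapE j (swapE (suc j) (swapE j a)) ≐ swapE (suc j) (swapE j (swapE (suc j) a))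
  swapE-braid j a = pointwise λ k → trans (getE-swap j (swapE (suc j) (swapE j a)) k) (trans (getE-swap² (suc j) j a (sw (suc j) k))
    (trans (cong (getE a) (sw-braid (suc j) k)) (sym (trans (getE-swap (suc j) (swapE j (swapE (suc j) a)) k) (getE-swap² j (suc j) a (sw (2 +ℕ j) k))))))

  sw-≡ : ∀ j k m → sw j k ≡ m → k ≡ sw j m
  sw-≡ j k m e = trans (sym (sw-involutive j k)) (cong (sw j) e)

  swapE-unit : ∀ j m → swapE j (unitE (suc m)) ≐ unitE (sw (suc j) (suc m))
  swapE-unit j m = pointwise λ k → trans (getE-swap j (unitE (suc m)) k) (go k)
    where
    go : ∀ k → getE (unitE (suc m)) (sw (suc j) k) ≡ getE (unitE (suc (sw j m))) k
    go k with k ℕₚ.≟ suc (sw j m)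
    ... | yes refl = trans (cong (getE (unitE (suc m))) (cong suc (sw-involutive j m)))
                           (trans (getE-unit-same m) (sym (getE-unit-same (sw j m))))
    ... | no ne = trans (getE-unit-other m _ (ne ∘ sw-≡ (suc j) k (suc m))) (sym (getE-unit-other (sw j m) k ne))

  infix 4 _⊑_
  _⊑_ : Exps → Exps → Set
  a ⊑ b = ∀ k → getE a k ≤ getE b k

  -- The linear extension of φ from monomials. Coefficients, equality in the truncated ring and
  -- transposes of operators are all expressed through it.
  ev : (Exps → Exps → ℤ) → Poly → ℤ
  ev φ [] = + 0
  ev φ ((c , xe , te) ∷ p) = c * φ xe te + ev φ p

  ev-++ : ∀ φ p q → ev φ (p ++ q) ≡ ev φ p + ev φ q
  ev-++ φ [] q = sym (ℤₚ.+-identityˡ _)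
  ev-++ φ ((c , xe , te) ∷ p) q = trans (cong (λ z → c * φ xe te + z) (ev-++ φ p q)) (sym (ℤₚ.+-assoc (c * φ xe te) _ _))

  ev-cong : ∀ {φ ψ} → (∀ xe te → φ xe te ≡ ψ xe te) → ∀ p → ev φ p ≡ ev ψ p
  ev-cong e [] = refl
  ev-cong e ((c , xe , te) ∷ p) = cong₂ (λ u v → c * u + v) (e xe te) (ev-cong e p)

  ev-zero : ∀ {φ} → (∀ xe te → φ xe te ≡ + 0) → ∀ p → ev φ p ≡ + 0
  ev-zero e [] = refl
  ev-zero e ((c , xe , te) ∷ p) = trans (cong₂ (λ u v → c * u + v) (e xe te) (ev-zero e p)) (trans (ℤₚ.+-identityʳ _) (ℤₚ.*-zeroʳ c))

  ev-+ : ∀ φ ψ p → ev (λ xe te → φ xe te + ψ xe te) p ≡ ev φ p + ev ψ p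
  ev-+ φ ψ [] = refl
  ev-+ φ ψ ((c , xe , te) ∷ p) = trans (cong (λ z → c * (φ xe te + ψ xe te) + z) (ev-+ φ ψ p))
    (solve 5 (λ c a b u v → c :* (a :+ b) :+ (u :+ v) := (c :* a :+ u) :+ (c :* b :+ v)) refl c (φ xe te) (ψ xe te) (ev φ p) (ev ψ p))
    where open +-*-Solver

  ev-* : ∀ c φ p → ev (λ xe te → c * φ xe te) p ≡ c * ev φ p
  ev-* c φ [] = sym (ℤₚ.*-zeroʳ c)
  ev-* c φ ((d , xe , te) ∷ p) = trans (cong (λ z → d * (c * φ xe te) + z) (ev-* c φ p))
    (solve 4 (λ c d a u → d :* (c :* a) :+ c :* u := c :* (d :* a :+ u)) refl c d (φ xe te) (ev φ p))
    where open +-*-Solver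

  ev-swap : ∀ (F : Exps → Exps → Exps → Exps → ℤ) p q →
    ev (λ xe te → ev (λ ye ue → F xe te ye ue) q) p ≡ ev (λ ye ue → ev (λ xe te → F xe te ye ue) p) q
  ev-swap F [] q = sym (ev-zero (λ _ _ → refl) q)
  ev-swap F ((c , xe , te) ∷ p) q = trans (cong₂ _+_ (sym (ev-* c _ q)) (ev-swap F p q)) (sym (ev-+ _ _ q))

  ev-map : ∀ φ ψ c (g : Term → Term) →
    (∀ d ye ue → ev φ (g (d , ye , ue) ∷ []) ≡ c * (d * ψ ye ue)) → ∀ q → ev φ (map g q) ≡ c * ev ψ q
  ev-map φ ψ c g e [] = sym (ℤₚ.*-zeroʳ c)
  ev-map φ ψ c g e ((d , ye , ue) ∷ q) = trans
    (trans (ev-++ φ (g (d , ye , ue) ∷ []) (map g q)) (cong₂ _+_ (e d ye ue) (ev-map φ ψ c g e q)))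
    (sym (ℤₚ.*-distribˡ-+ c (d * ψ ye ue) (ev ψ q)))

  ev-concatMap : ∀ φ ψ (g : Term → Poly) →
    (∀ d ye ue → ev φ (g (d , ye , ue)) ≡ d * ψ ye ue) → ∀ q → ev φ (concatMap g q) ≡ ev ψ q
  ev-concatMap φ ψ g e [] = refl
  ev-concatMap φ ψ g e ((d , ye , ue) ∷ q) =
    trans (ev-++ φ (g (d , ye , ue)) (concatMap g q)) (cong₂ _+_ (e d ye ue) (ev-concatMap φ ψ g e q))

  shift : Exps → Exps → (Exps → Exps → ℤ) → Exps → Exps → ℤ
  shift xe te φ ye ue = φ (addE xe ye) (addE te ue)

  ev-*P : ∀ φ p q → ev φ (p *P q) ≡ ev (λ xe te → ev (shift xe te φ) q) p
  ev-*P φ p q = ev-concatMap φ _ _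
    (λ c xe te → ev-map φ (shift xe te φ) c _
      (λ d ye ue → trans (ℤₚ.+-identityʳ _) (ℤₚ.*-assoc c d _)) q) p

  ev-neg : ∀ φ p → ev φ (negP p) ≡ - ev φ p
  ev-neg φ p = trans (ev-map φ φ (- + 1) _
    (λ d ye ue → solve 2 (λ d a → (:- d) :* a :+ con (+ 0) := con (- + 1) :* (d :* a)) refl d (φ ye ue)) p)
    (ℤₚ.-1*i≡-i (ev φ p))
    where open +-*-Solver

open Exponents

-- The ring ℤ[x,t] truncated at t^μ, with the action of the transpositions.

module TruncatedPolynomials where

  open import Algebra.Bundles using (CommutativeRing)
  open import Level using (0ℓ)
  open import Data.Nat using (ℕ; zero; suc; _≤_) renaming (_+_ to _+ℕ_)
  import Data.Nat.Properties as ℕₚ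
  open import Data.Integer using (ℤ; +_; -_; _+_; _*_; _-_)
  import Data.Integer.Properties as ℤₚ
  open import Data.Integer.Solver using (module +-*-Solver)
  open import Data.List using (List; []; _∷_; map)
  open import Data.List.Properties using (map-++)
  open import Data.Product using (_,_)
  open import Function using (_∘_)
  open import Relation.Nullary using (¬_; yes; no)
  open import Relation.Binary.PropositionalEquality

  -- The linear functionals on ℤ[x,t] that kill the monomials whose t-part does not divide t^μ,
  -- given by their values on monomials. Polynomials are identified when no such functional separates
  -- them; an operator defined on monomials then respects this equality as soon as its transpose
  -- preserves the functionals.
  record Test (μ : Exps) : Set where
    field
      fun    : Exps → Exps → ℤ
      fcong  : ∀ {a a′ b b′} → a ≐ a′ → b ≐ b′ → fun a b ≡ fun a′ b′
      vanish : ∀ a b → ¬ b ⊑ μ → fun a b ≡ + 0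
  open Test public

  ⊑-resp : ∀ {a b μ} → a ≐ b → a ⊑ μ → b ⊑ μ
  ⊑-resp {μ = μ} e l k = subst (_≤ getE μ k) (at e k) (l k)

  add-⊑ˡ : ∀ a b {μ} → addE a b ⊑ μ → a ⊑ μ
  add-⊑ˡ a b {μ} l k = ℕₚ.≤-trans (ℕₚ.m≤m+n _ (getE b k)) (subst (_≤ getE μ k) (getE-add a b k) (l k))

  add-⊑ʳ : ∀ a b {μ} → addE a b ⊑ μ → b ⊑ μ
  add-⊑ʳ a b l = add-⊑ˡ b a (⊑-resp (addE-comm a b) l)

  -- Multiplication by x_a - x_b is injective because its transpose is surjective:
  -- φ(x^e) is recovered from ψ as ψ(x_a x^e) - ψ(x_b x^e): the functional ψ sums φ over the
  -- monomials obtained by moving the x_a-exponent p to x_b one unit at a time.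

  put : ℕ → ℕ → Exps → ℕ → ℕ → Exps
  put a b e p q = setE (setE e (suc a) p) (suc b) q

  getE-put-b : ∀ a b e p q → getE (put a b e p q) (suc b) ≡ q
  getE-put-b a b e p q = getE-set-same (setE e (suc a) p) b q

  getE-put-a : ∀ a b e p q → ¬ a ≡ b → getE (put a b e p q) (suc a) ≡ p
  getE-put-a a b e p q ne =
    trans (getE-set-other (setE e (suc a) p) b q (suc a) (ne ∘ ℕₚ.suc-injective)) (getE-set-same e a p)

  getE-put-other : ∀ a b e p q k → ¬ k ≡ suc a → ¬ k ≡ suc b → getE (put a b e p q) k ≡ getE e k
  getE-put-other a b e p q k na nb =
    trans (getE-set-other (setE e (suc a) p) b q k nb) (getE-set-other e a p k na)

  put-≐ : ∀ a b e p q e′ → ¬ a ≡ b → getE e′ (suc a) ≡ p → getE e′ (suc b) ≡ q →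
          (∀ k → ¬ k ≡ suc a → ¬ k ≡ suc b → getE e k ≡ getE e′ k) → put a b e p q ≐ e′
  put-≐ a b e p q e′ ne ea eb rest = pointwise go
    where
    go : ∀ k → getE (put a b e p q) k ≡ getE e′ k
    go k with k ℕₚ.≟ suc a
    ... | yes refl = trans (getE-put-a a b e p q ne) (sym ea)
    ... | no na with k ℕₚ.≟ suc b
    ... | yes refl = trans (getE-put-b a b e p q) (sym eb)
    ... | no nb = trans (getE-put-other a b e p q k na nb) (rest k na nb)

  antidiff : ℕ → ℕ → (Exps → ℤ) → Exps → ℕ → ℕ → ℤ
  antidiff a b f e zero q = + 0
  antidiff a b f e (suc p) q = antidiff a b f e p (suc q) + f (put a b e p q)

  antidiff-cong : ∀ a b f g e e′ → (∀ p q → f (put a b e p q) ≡ g (put a b e′ p q)) →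
                  ∀ p q → antidiff a b f e p q ≡ antidiff a b g e′ p q
  antidiff-cong a b f g e e′ h zero q = refl
  antidiff-cong a b f g e e′ h (suc p) q = cong₂ _+_ (antidiff-cong a b f g e e′ h p (suc q)) (h p q)

  antidiff-zero : ∀ a b f e → (∀ x → f x ≡ + 0) → ∀ p q → antidiff a b f e p q ≡ + 0
  antidiff-zero a b f e h zero q = refl
  antidiff-zero a b f e h (suc p) q = cong₂ _+_ (antidiff-zero a b f e h p (suc q)) (h _)

  δ : ℕ → ℕ → Poly
  δ a b = xVar (suc a) +P negP (xVar (suc b))

  ev-δ : ∀ φ a b p → ev φ (δ a b *P p) ≡ ev (shift (unitE (suc a)) [] φ) p - ev (shift (unitE (suc b)) [] φ) p
  ev-δ φ a b p = trans (ev-*P φ (δ a b) p)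
    (solve 2 (λ u v → con (+ 1) :* u :+ (con (- + 1) :* v :+ con (+ 0)) := u :- v) refl
      (ev (shift (unitE (suc a)) [] φ) p) (ev (shift (unitE (suc b)) [] φ) p))
    where open +-*-Solver

  swapP : ℕ → Poly → Poly
  swapP j = map (λ { (c , xe , te) → (c , swapE j xe , te) })

  ev-swapP : ∀ φ j p → ev φ (swapP j p) ≡ ev (λ xe te → φ (swapE j xe) te) p
  ev-swapP φ j [] = refl
  ev-swapP φ j ((c , xe , te) ∷ p) = cong (λ z → c * φ (swapE j xe) te + z) (ev-swapP φ j p)

  ev-swapP² : ∀ φ i j p → ev φ (swapP i (swapP j p)) ≡ ev (λ xe te → φ (swapE i (swapE j xe)) te) p
  ev-swapP² φ i j p = trans (ev-swapP φ i (swapP j p)) (ev-swapP (λ xe te → φ (swapE i xe) te) j p)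

  ev-swapP³ : ∀ φ i j k p → ev φ (swapP i (swapP j (swapP k p))) ≡ ev (λ xe te → φ (swapE i (swapE j (swapE k xe))) te) p
  ev-swapP³ φ i j k p = trans (ev-swapP φ i (swapP j (swapP k p))) (ev-swapP² (λ xe te → φ (swapE i xe) te) j k p)

  module Modulo (μ : Exps) where

    infix 4 _≋_
    record _≋_ (p q : Poly) : Set where
      constructor tests
      field test : ∀ (t : Test μ) → ev (fun t) p ≡ ev (fun t) q
    open _≋_ public

    shiftT : Exps → Exps → Test μ → Test μ
    shiftT xe te t = record
      { fun    = shift xe te (fun t)
      ; fcong  = λ e f → fcong t (addE-cong {a = xe} ≐-refl e) (addE-cong {a = te} ≐-refl f)
      ; vanish = λ a b nl → vanish t _ _ (nl ∘ add-⊑ʳ te b)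
      }

    -- The transpose of multiplication by `q`. The monomials killed by tests span an ideal, so the
    -- result is again a test.
    convolve : Poly → Test μ → Test μ
    convolve q t = record
      { fun    = λ xe te → ev (shift xe te (fun t)) q
      ; fcong  = λ e f → ev-cong (λ ye ue → fcong t (addE-cong e ≐-refl) (addE-cong f ≐-refl)) q
      ; vanish = λ a b nl → ev-zero (λ ye ue → vanish t _ _ (nl ∘ add-⊑ˡ b ue)) q
      }

    swapT : ℕ → Test μ → Test μ
    swapT j t = record
      { fun    = λ xe te → fun t (swapE j xe) te
      ; fcong  = λ e f → fcong t (swapE-cong j e) f
      ; vanish = λ a b nl → vanish t _ _ nl
      }

    antidiffT : (a b : ℕ) → ¬ a ≡ b → Test μ → Test μ
    antidiffT a b ne t = record
      { fun    = λ xe te → antidiff a b (λ x → fun t x te) xe (getE xe (suc a)) (getE xe (suc b))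
      ; fcong  = λ {xe} {xe′} {te} {te′} e f → trans
          (antidiff-cong a b (λ x → fun t x te) (λ x → fun t x te′) xe xe′ (λ p q → fcong t
            (put-≐ a b xe p q (put a b xe′ p q) ne (getE-put-a a b xe′ p q ne) (getE-put-b a b xe′ p q)
              λ k na nb → trans (at e k) (sym (getE-put-other a b xe′ p q k na nb))) f) (getE xe (suc a)) (getE xe (suc b)))
          (cong₂ (antidiff a b (λ x → fun t x te′) xe′) (at e (suc a)) (at e (suc b)))
      ; vanish = λ xe te nl → antidiff-zero a b _ xe (λ x → vanish t x te nl) (getE xe (suc a)) (getE xe (suc b))
      }

    antidiffT-δ : ∀ a b ne t p → ev (fun (antidiffT a b ne t)) (δ a b *P p) ≡ ev (fun t) p
    antidiffT-δ a b ne t p = trans (ev-δ _ a b p) (trans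
      (solve 2 (λ u v → u :- v := u :+ con (- + 1) :* v) refl (ev (shift (unitE (suc a)) [] ψ) p) (ev (shift (unitE (suc b)) [] ψ) p))
      (trans (sym (trans (ev-+ (shift (unitE (suc a)) [] ψ) _ p) (cong (λ z → ev (shift (unitE (suc a)) [] ψ) p + z) (ev-* (- + 1) _ p))))
      (ev-cong go p)))
      where
      open +-*-Solver
      ψ = fun (antidiffT a b ne t)
      φ = fun t
      go : ∀ e ue → shift (unitE (suc a)) [] ψ e ue + - + 1 * shift (unitE (suc b)) [] ψ e ue ≡ φ e ue
      -- With (A, B) the exponents of x_a and x_b in `e`, the sum for x_a x^e starts at (A+1, B).
      -- Its first step splits off φ(x^e) and leaves the sum starting at (A, B+1), which is the sum
      -- for x_b x^e.
      go e ue = trans (cong₂ (λ u v → u + - + 1 * v) left right)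
        (trans (cong (λ z → (antidiff a b f ea A (suc B) + f (put a b ea A B)) + - + 1 * z)
                 (antidiff-cong a b f f eb ea (λ p q → fcong t (put-≐ a b eb p q (put a b ea p q) ne
                   (getE-put-a a b ea p q ne) (getE-put-b a b ea p q)
                   λ k na nb → trans (off-b k nb) (sym (trans (getE-put-other a b ea p q k na nb) (off-a k na)))) ≐-refl) A (suc B)))
        (trans (solve 2 (λ u v → u :+ v :+ con (- + 1) :* u := v) refl (antidiff a b f ea A (suc B)) (f (put a b ea A B)))
          (fcong t (put-≐ a b ea A B e ne refl refl λ k na nb → off-a k na) ≐-refl)))
        where
        f : Exps → ℤ
        f x = φ x ue
        ea = addE (unitE (suc a)) e
        eb = addE (unitE (suc b)) e
        A = getE e (suc a)
        B = getE e (suc b)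
        off-a : ∀ k → ¬ k ≡ suc a → getE ea k ≡ getE e k
        off-a k na = trans (getE-add (unitE (suc a)) e k) (cong (_+ℕ getE e k) (getE-unit-other a k na))
        off-b : ∀ k → ¬ k ≡ suc b → getE eb k ≡ getE e k
        off-b k nb = trans (getE-add (unitE (suc b)) e k) (cong (_+ℕ getE e k) (getE-unit-other b k nb))
        left : ψ ea ue ≡ antidiff a b f ea (suc A) B
        left = cong₂ (antidiff a b f ea)
          (trans (getE-add (unitE (suc a)) e (suc a)) (cong (_+ℕ A) (getE-unit-same a)))
          (off-a (suc b) (λ x → ne (sym (ℕₚ.suc-injective x))))
        right : ψ eb ue ≡ antidiff a b f eb A (suc B)
        right = cong₂ (antidiff a b f eb)
          (off-b (suc a) (ne ∘ ℕₚ.suc-injective))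
          (trans (getE-add (unitE (suc b)) e (suc b)) (cong (_+ℕ B) (getE-unit-same b)))

    δ-cancel : ∀ a b → ¬ a ≡ b → ∀ {p q} → δ a b *P p ≋ δ a b *P q → p ≋ q
    δ-cancel a b ne {p} {q} e = tests λ t → trans (sym (antidiffT-δ a b ne t p))
      (trans (test e (antidiffT a b ne t)) (antidiffT-δ a b ne t q))

    ≋-refl : ∀ {p} → p ≋ p
    ≋-refl = tests λ _ → refl

    ≋-sym : ∀ {p q} → p ≋ q → q ≋ p
    ≋-sym e = tests λ t → sym (test e t)

    ≋-trans : ∀ {p q r} → p ≋ q → q ≋ r → p ≋ r
    ≋-trans e f = tests λ t → trans (test e t) (test f t)

    ≡⇒≋ : ∀ {p q} → p ≡ q → p ≋ q
    ≡⇒≋ refl = ≋-refl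

    +P-cong : ∀ {p p′ q q′} → p ≋ p′ → q ≋ q′ → p +P q ≋ p′ +P q′
    +P-cong {p} {p′} {q} {q′} e f = tests λ t →
      trans (ev-++ (fun t) p q) (trans (cong₂ _+_ (test e t) (test f t)) (sym (ev-++ (fun t) p′ q′)))

    +P-comm : ∀ p q → p +P q ≋ q +P p
    +P-comm p q = tests λ t →
      trans (ev-++ (fun t) p q) (trans (ℤₚ.+-comm (ev (fun t) p) _) (sym (ev-++ (fun t) q p)))

    +P-assoc : ∀ p q r → (p +P q) +P r ≋ p +P (q +P r)
    +P-assoc p q r = ≡⇒≋ (Data.List.Properties.++-assoc p q r)

    negP-cong : ∀ {p q} → p ≋ q → negP p ≋ negP q
    negP-cong {p} {q} e = tests λ t → trans (ev-neg (fun t) p) (trans (cong -_ (test e t)) (sym (ev-neg (fun t) q)))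

    negP-inverse : ∀ p → negP p +P p ≋ []
    negP-inverse p = tests λ t → trans (ev-++ (fun t) (negP p) p)
      (trans (cong (_+ ev (fun t) p) (ev-neg (fun t) p)) (ℤₚ.+-inverseˡ (ev (fun t) p)))

    *P-cong : ∀ {p p′ q q′} → p ≋ p′ → q ≋ q′ → p *P q ≋ p′ *P q′
    *P-cong {p} {p′} {q} {q′} e f = tests λ t → trans (ev-*P (fun t) p q) (trans (test e (convolve q t))
      (trans (ev-cong (λ xe te → test f (shiftT xe te t)) p′) (sym (ev-*P (fun t) p′ q′))))

    *P-comm : ∀ p q → p *P q ≋ q *P p
    *P-comm p q = tests λ t → trans (ev-*P (fun t) p q) (trans (ev-swap _ p q)
      (trans (ev-cong (λ ye ue → ev-cong (λ xe te → fcong t (addE-comm xe ye) (addE-comm te ue)) p) q)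
        (sym (ev-*P (fun t) q p))))

    *P-assoc : ∀ p q r → (p *P q) *P r ≋ p *P (q *P r)
    *P-assoc p q r = tests λ t → trans (ev-*P (fun t) (p *P q) r) (trans (ev-*P _ p q)
      (trans (ev-cong (λ xe te → trans
          (ev-cong (λ ye ue → ev-cong (λ ze ve → fcong t (addE-assoc xe ye ze) (addE-assoc te ue ve)) r) q)
          (sym (ev-*P (shift xe te (fun t)) q r))) p)
        (sym (ev-*P (fun t) p (q *P r)))))

    *P-identityˡ : ∀ p → oneP *P p ≋ p
    *P-identityˡ p = tests λ t → trans (ev-*P (fun t) oneP p) (trans (ℤₚ.+-identityʳ _) (ℤₚ.*-identityˡ _))

    *P-distribʳ : ∀ r p q → (p +P q) *P r ≋ (p *P r) +P (q *P r)
    *P-distribʳ r p q = tests λ t → trans (ev-*P (fun t) (p +P q) r) (trans (ev-++ _ p q)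
      (trans (cong₂ _+_ (sym (ev-*P (fun t) p r)) (sym (ev-*P (fun t) q r))) (sym (ev-++ (fun t) (p *P r) (q *P r)))))

    polyRing : CommutativeRing 0ℓ 0ℓ
    polyRing = record
      { Carrier = Poly ; _≈_ = _≋_ ; _+_ = _+P_ ; _*_ = _*P_ ; -_ = negP ; 0# = [] ; 1# = oneP
      ; isCommutativeRing = record
        { isRing = record
          { +-isAbelianGroup = record
            { isGroup = record
              { isMonoid = record
                { isSemigroup = record
                  { isMagma = record
                    { isEquivalence = record { refl = ≋-refl ; sym = ≋-sym ; trans = ≋-trans }
                    ; ∙-cong = +P-cong }
                  ; assoc = +P-assoc }
                ; identity = (λ p → ≋-refl) , (λ p → +P-comm p []) }
              ; inverse = negP-inverse , (λ p → ≋-trans (+P-comm p (negP p)) (negP-inverse p))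
              ; ⁻¹-cong = negP-cong }
            ; comm = +P-comm }
          ; *-cong = *P-cong
          ; *-assoc = *P-assoc
          ; *-identity = *P-identityˡ , (λ p → ≋-trans (*P-comm p oneP) (*P-identityˡ p))
          ; distrib = (λ r p q → ≋-trans (*P-comm r (p +P q)) (≋-trans (*P-distribʳ r p q) (+P-cong (*P-comm p r) (*P-comm q r))))
                    , *P-distribʳ }
        ; *-comm = *P-comm } }

    swapP-cong : ∀ j {p q} → p ≋ q → swapP j p ≋ swapP j q
    swapP-cong j {p} {q} e = tests λ t →
      trans (ev-swapP (fun t) j p) (trans (test e (swapT j t)) (sym (ev-swapP (fun t) j q)))

    swapP-+ : ∀ j p q → swapP j (p +P q) ≋ swapP j p +P swapP j q
    swapP-+ j p q = ≡⇒≋ (map-++ _ p q)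

    swapP-neg : ∀ j p → swapP j (negP p) ≡ negP (swapP j p)
    swapP-neg j [] = refl
    swapP-neg j ((c , xe , te) ∷ p) = cong (_ ∷_) (swapP-neg j p)

    swapP-* : ∀ j p q → swapP j (p *P q) ≋ swapP j p *P swapP j q
    swapP-* j p q = tests λ t → trans (ev-swapP (fun t) j (p *P q)) (trans (ev-*P _ p q)
      (trans (ev-cong (λ xe te → trans
         (ev-cong (λ ye ue → fcong t (swapE-add j xe ye) ≐-refl) q) (sym (ev-swapP _ j q))) p)
      (trans (sym (ev-swapP (λ xe te → ev (shift xe te (fun t)) (swapP j q)) j p)) (sym (ev-*P (fun t) (swapP j p) (swapP j q))))))

    swapP-involutive : ∀ j p → swapP j (swapP j p) ≋ p
    swapP-involutive j p = tests λ t → trans (ev-swapP² (fun t) j j p)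
      (ev-cong (λ xe te → fcong t (swapE-involutive j xe) ≐-refl) p)

    swapP-far : ∀ j d p → swapP j (swapP (2 +ℕ j +ℕ d) p) ≋ swapP (2 +ℕ j +ℕ d) (swapP j p)
    swapP-far j d p = tests λ t → trans (ev-swapP² (fun t) j (2 +ℕ j +ℕ d) p)
      (trans (ev-cong (λ xe te → fcong t (swapE-far j d xe) ≐-refl) p)
        (sym (ev-swapP² (fun t) (2 +ℕ j +ℕ d) j p)))

    swapP-braid : ∀ j p → swapP j (swapP (suc j) (swapP j p)) ≋ swapP (suc j) (swapP j (swapP (suc j) p))
    swapP-braid j p = tests λ t → trans (ev-swapP³ (fun t) j (suc j) j p)
      (trans (ev-cong (λ xe te → fcong t (swapE-braid j xe) ≐-refl) p)
        (sym (ev-swapP³ (fun t) (suc j) j (suc j) p)))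

    term-cong : ∀ c {xe xe′ te te′} → xe ≐ xe′ → te ≐ te′ → ((c , xe , te) ∷ []) ≋ ((c , xe′ , te′) ∷ [])
    term-cong c e f = tests λ t → cong (λ z → c * z + + 0) (fcong t e f)

    swapP-xVar : ∀ j m → swapP j (xVar (suc m)) ≋ xVar (suc (sw j m))
    swapP-xVar j m = term-cong (+ 1) (swapE-unit j m) ≐-refl

open TruncatedPolynomials

-- Demazure operators over an abstract ring: braid relations and products.

module DemazureAlgebra where

  open import Algebra.Bundles using (CommutativeRing; RawRing)
  open import Algebra.Solver.Ring.AlmostCommutativeRing using (fromCommutativeRing; _-Raw-AlmostCommutative⟶_)
  import Algebra.Solver.Ring
  open import Level using (0ℓ)
  open import Data.Integer using (ℤ; +_)
  import Data.Integer as ℤ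
  open import Data.Maybe using (Maybe; just; nothing)
  open import Data.Nat as ℕ using (ℕ; suc; s≤s)
  import Data.Nat.Properties as ℕₚ
  open import Data.List using (List; []; _∷_; _++_; map; foldr; concatMap)
  open import Data.List.Properties using (map-++; map-∘)
  open import Data.List.Relation.Binary.Permutation.Propositional.Properties using (map⁺)
  open import Data.List.Relation.Binary.Permutation.Propositional as ↭ using (_↭_)
  open import Relation.Nullary using (¬_; yes; no)
  open import Relation.Binary.PropositionalEquality as ≡ using (_≡_)
  import Relation.Binary.Reasoning.Setoid as SetoidReasoning

  ℤ-rawRing : RawRing 0ℓ 0ℓ
  ℤ-rawRing = record { Carrier = ℤ ; _≈_ = _≡_ ; _+_ = ℤ._+_ ; _*_ = ℤ._*_ ; -_ = ℤ.-_ ; 0# = + 0 ; 1# = + 1 }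

  module BraidIdentity (R : CommutativeRing 0ℓ 0ℓ)
                       (ι : ℤ-rawRing -Raw-AlmostCommutative⟶ fromCommutativeRing R) where

    open CommutativeRing R

    ≟-coeff : (a b : ℤ) → Maybe (_-Raw-AlmostCommutative⟶_.⟦_⟧ ι a ≈ _-Raw-AlmostCommutative⟶_.⟦_⟧ ι b)
    ≟-coeff a b with a ℤ.≟ b
    ... | yes ≡.refl = just refl
    ... | no _ = nothing

    module Solver = Algebra.Solver.Ring ℤ-rawRing (fromCommutativeRing R) ι ≟-coeff

    open Solver using (solve; _:=_; _:+_; _:*_; _:-_; :-_)
    open SetoidReasoning setoid

    -- Two nested Demazure operators: c is the denominator of the outer one, a and b are the
    -- denominators of the two inner values that it combines.
    clear-denominators : ∀ a b c u v {A A₂ B P Q} → c * B ≈ u * A - v * A₂ → a * A ≈ P → b * A₂ ≈ Q →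
      a * b * c * B ≈ u * b * P - v * a * Q
    clear-denominators a b c u v {A} {A₂} {B} {P} {Q} hB hA hA₂ = begin
      a * b * c * B                          ≈⟨ solve 4 (λ a b c B → a :* b :* c :* B := a :* b :* (c :* B)) refl a b c B ⟩
      a * b * (c * B)                        ≈⟨ *-congˡ hB ⟩
      a * b * (u * A - v * A₂)               ≈⟨ solve 6 (λ a b u v A A₂ → a :* b :* (u :* A :- v :* A₂) := u :* b :* (a :* A) :- v :* a :* (b :* A₂)) refl a b u v A A₂ ⟩
      u * b * (a * A) - v * a * (b * A₂)     ≈⟨ +-cong (*-congˡ hA) (-‿cong (*-congˡ hA₂)) ⟩
      u * b * P - v * a * Q                  ∎

    -- D is the Vandermonde product of three variables. The reflection in the outermost operator
    -- permutes its factors and reverses one of them; this is the sign in `D₁ ≈ - D`.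
    combine : ∀ D D₀ D₁ e x y {B B₁ C P Q} → e * C ≈ x * B - y * B₁ → D₀ ≈ D → D₁ ≈ - D →
      D₀ * B ≈ P → D₁ * B₁ ≈ Q → D * (e * C) ≈ x * P + y * Q
    combine D D₀ D₁ e x y {B} {B₁} {C} {P} {Q} hC h₀ h₁ hB hB₁ = begin
      D * (e * C)                    ≈⟨ *-congˡ hC ⟩
      D * (x * B - y * B₁)           ≈⟨ solve 5 (λ D x y B B₁ → D :* (x :* B :- y :* B₁) := x :* (D :* B) :+ y :* ((:- D) :* B₁)) refl D x y B B₁ ⟩
      x * (D * B) + y * (- D * B₁)   ≈⟨ +-cong (*-congˡ (*-congʳ (sym h₀))) (*-congˡ (*-congʳ (sym h₁))) ⟩
      x * (D₀ * B) + y * (D₁ * B₁)   ≈⟨ +-cong (*-congˡ hB) (*-congˡ hB₁) ⟩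
      x * P + y * Q                  ∎

    -- Both sides equal (x - y) (y - z) times the antisymmetrisation of x² y f, where
    -- f₁, f₂, f₁₂, f₂₁, g are the images of f under the non-trivial elements of S₃.
    braid : ∀ x y z f f₁ f₂ f₁₂ f₂₁ g {A A₁ A₂ A₁₂ B B₁ C A′ A₁′ A₂′ A₂₁′ B′ B₂′ C′} →
      (x - y) * A ≈ x * f - y * f₁ → (y - x) * A₁ ≈ y * f₁ - x * f →
      (x - z) * A₂ ≈ x * f₂ - z * f₂₁ → (y - z) * A₁₂ ≈ y * f₁₂ - z * g →
      (y - z) * B ≈ y * A - z * A₂ → (x - z) * B₁ ≈ x * A₁ - z * A₁₂ → (x - y) * C ≈ x * B - y * B₁ →
      (y - z) * A′ ≈ y * f - z * f₂ → (z - y) * A₂′ ≈ z * f₂ - y * f →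
      (x - z) * A₁′ ≈ x * f₁ - z * f₁₂ → (x - y) * A₂₁′ ≈ x * f₂₁ - y * g →
      (x - y) * B′ ≈ x * A′ - y * A₁′ → (x - z) * B₂′ ≈ x * A₂′ - z * A₂₁′ → (y - z) * C′ ≈ y * B′ - z * B₂′ →
      (y - z) * ((x - y) * (x - z) * (y - z) * ((x - y) * C)) ≈ (x - y) * ((x - y) * (x - z) * (y - z) * ((y - z) * C′))
    braid x y z f f₁ f₂ f₁₂ f₂₁ g hA hA₁ hA₂ hA₁₂ hB hB₁ hC hA′ hA₂′ hA₁′ hA₂₁′ hB′ hB₂′ hC′ = begin
      (y - z) * (D * ((x - y) * _))
        ≈⟨ *-congˡ (combine D _ _ (x - y) x y hC refl
             (solve 3 (λ x y z → (y :- x) :* (y :- z) :* (x :- z) := :- ((x :- y) :* (x :- z) :* (y :- z))) refl x y z)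
             (clear-denominators (x - y) (x - z) (y - z) y z hB hA hA₂)
             (clear-denominators (y - x) (y - z) (x - z) x z hB₁ hA₁ hA₁₂)) ⟩
      (y - z) * (x * (y * (x - z) * (x * f - y * f₁) - z * (x - y) * (x * f₂ - z * f₂₁))
               + y * (x * (y - z) * (y * f₁ - x * f) - z * (y - x) * (y * f₁₂ - z * g)))
        ≈⟨ solve 9 (λ x y z f f₁ f₂ f₁₂ f₂₁ g →
             (y :- z) :* (x :* (y :* (x :- z) :* (x :* f :- y :* f₁) :- z :* (x :- y) :* (x :* f₂ :- z :* f₂₁))
               :+ y :* (x :* (y :- z) :* (y :* f₁ :- x :* f) :- z :* (y :- x) :* (y :* f₁₂ :- z :* g)))
             := (x :- y) :* (y :* (x :* (x :- z) :* (y :* f :- z :* f₂) :- y :* (y :- z) :* (x :* f₁ :- z :* f₁₂))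
               :+ z :* (x :* (x :- y) :* (z :* f₂ :- y :* f) :- z :* (z :- y) :* (x :* f₂₁ :- y :* g))))
           refl x y z f f₁ f₂ f₁₂ f₂₁ g ⟩
      (x - y) * (y * (x * (x - z) * (y * f - z * f₂) - y * (y - z) * (x * f₁ - z * f₁₂))
               + z * (x * (x - y) * (z * f₂ - y * f) - z * (z - y) * (x * f₂₁ - y * g)))
        ≈⟨ *-congˡ (combine D _ _ (y - z) y z hC′
             (solve 3 (λ x y z → (y :- z) :* (x :- z) :* (x :- y) := (x :- y) :* (x :- z) :* (y :- z)) refl x y z)
             (solve 3 (λ x y z → (z :- y) :* (x :- y) :* (x :- z) := :- ((x :- y) :* (x :- z) :* (y :- z))) refl x y z)
             (clear-denominators (y - z) (x - z) (x - y) x y hB′ hA′ hA₁′)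
             (clear-denominators (z - y) (x - y) (x - z) x z hB₂′ hA₂′ hA₂₁′)) ⟨
      (x - y) * (D * ((y - z) * _)) ∎
      where D = (x - y) * (x - z) * (y - z)

  -- `X m` is the variable x_{m+1}. The operators enter only through `δ-ϖ`, which together with
  -- `δ-cancel` characterises them, so the identities below are ring identities in opaque elements
  -- rather than computations with terms.
  record DemazureStructure : Set₁ where
    field
      polynomials : CommutativeRing 0ℓ 0ℓ
      scalar      : ℤ-rawRing -Raw-AlmostCommutative⟶ fromCommutativeRing polynomials
    open CommutativeRing polynomials public
    field
      X : ℕ → Carrier
      s : ℕ → Carrier → Carrier
      ϖ : ℕ → Carrier → Carrier
      s-cong       : ∀ j {p q} → p ≈ q → s j p ≈ s j q
      s-+          : ∀ j p q → s j (p + q) ≈ s j p + s j q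
      s-neg        : ∀ j p → s j (- p) ≈ - s j p
      s-*          : ∀ j p q → s j (p * q) ≈ s j p * s j q
      s-zero       : ∀ j → s j 0# ≈ 0#
      s-one        : ∀ j → s j 1# ≈ 1#
      s-involutive : ∀ j p → s j (s j p) ≈ p
      s-far        : ∀ j d p → s j (s (2 ℕ.+ j ℕ.+ d) p) ≈ s (2 ℕ.+ j ℕ.+ d) (s j p)
      s-braid      : ∀ j p → s j (s (suc j) (s j p)) ≈ s (suc j) (s j (s (suc j) p))
      s-X          : ∀ j m → s j (X m) ≈ X (sw j m)
      δ-cancel     : ∀ a b → ¬ a ≡ b → ∀ {p q} → (X a - X b) * p ≈ (X a - X b) * q → p ≈ q
      δ-ϖ          : ∀ j p → (X j - X (suc j)) * ϖ j p ≈ X j * p - X (suc j) * s j p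

  module DemazureOperators (𝓓 : DemazureStructure) where

    open DemazureStructure 𝓓
    open BraidIdentity polynomials scalar
    open Solver using (solve; _:=_; _:+_; _:*_; _:-_; :-_; con)
    open SetoidReasoning setoid

    root : ℕ → ℕ → Carrier
    root a b = X a - X b

    -- Reduces an identity for π to its version cleared of the denominator.
    ϖ-unique : ∀ j {p q} → root j (suc j) * q ≈ (X j * p) - (X (suc j) * s j p) → ϖ j p ≈ q
    ϖ-unique j {p} h = δ-cancel j (suc j) suc≢ (trans (δ-ϖ j p) (sym h))

    ϖ-cong : ∀ j {p q} → p ≈ q → ϖ j p ≈ ϖ j q
    ϖ-cong j {p} {q} e = ϖ-unique j (trans (δ-ϖ j q)
      (+-cong (*-congˡ (sym e)) (-‿cong (*-congˡ (s-cong j (sym e))))))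

    ϖ-+ : ∀ j p q → ϖ j (p + q) ≈ ϖ j p + ϖ j q
    ϖ-+ j p q = ϖ-unique j (begin
      root j (suc j) * (ϖ j p + ϖ j q)
        ≈⟨ solve 3 (λ d a b → d :* (a :+ b) := d :* a :+ d :* b) refl (root j (suc j)) (ϖ j p) (ϖ j q) ⟩
      (root j (suc j) * ϖ j p) + (root j (suc j) * ϖ j q)
        ≈⟨ +-cong (δ-ϖ j p) (δ-ϖ j q) ⟩
      ((X j * p) - (X (suc j) * s j p)) + ((X j * q) - (X (suc j) * s j q))
        ≈⟨ solve 6 (λ x y p q p′ q′ → x :* p :- y :* p′ :+ (x :* q :- y :* q′) := x :* (p :+ q) :- y :* (p′ :+ q′)) refl
             (X j) (X (suc j)) p q (s j p) (s j q) ⟩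
      (X j * (p + q)) - (X (suc j) * (s j p + s j q))
        ≈⟨ +-cong refl (-‿cong (*-congˡ (s-+ j p q))) ⟨
      (X j * (p + q)) - (X (suc j) * s j (p + q)) ∎)

    ϖ-zero : ∀ j → ϖ j 0# ≈ 0#
    ϖ-zero j = ϖ-unique j (trans (zeroʳ (root j (suc j))) (sym (trans (+-cong (zeroʳ (X j)) (-‿cong (trans (*-congˡ (s-zero j)) (zeroʳ (X (suc j)))))) (-‿inverseʳ 0#))))

    -- Through this, symmetric denominators and monomials in t pass through π.
    ϖ-symmetric : ∀ j p g → s j g ≈ g → ϖ j (p * g) ≈ ϖ j p * g
    ϖ-symmetric j p g h = ϖ-unique j (begin
      root j (suc j) * (ϖ j p * g)
        ≈⟨ *-assoc (root j (suc j)) (ϖ j p) g ⟨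
      (root j (suc j) * ϖ j p) * g
        ≈⟨ *-congʳ (δ-ϖ j p) ⟩
      ((X j * p) - (X (suc j) * s j p)) * g
        ≈⟨ solve 5 (λ x y p q g → (x :* p :- y :* q) :* g := x :* (p :* g) :- y :* (q :* g)) refl (X j) (X (suc j)) p (s j p) g ⟩
      (X j * (p * g)) - (X (suc j) * (s j p * g))
        ≈⟨ +-cong refl (-‿cong (*-congˡ (trans (s-* j p g) (*-congˡ h)))) ⟨
      (X j * (p * g)) - (X (suc j) * s j (p * g)) ∎)

    s-δ : ∀ m a b → s m (root a b) ≈ root (sw m a) (sw m b)
    s-δ m a b = trans (s-+ m (X a) (- (X b))) (+-cong (s-X m a)
      (trans (s-neg m (X b)) (-‿cong (s-X m b))))

    s-combination : ∀ m a b p q →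
      s m ((X a * p) - (X b * q)) ≈ (X (sw m a) * s m p) - (X (sw m b) * s m q)
    s-combination m a b p q = trans (s-+ m (X a * p) (- (X b * q)))
      (+-cong (trans (s-* m (X a) p) (*-congʳ (s-X m a)))
        (trans (s-neg m (X b * q))
          (-‿cong (trans (s-* m (X b) q) (*-congʳ (s-X m b))))))

    -- A reflection is a ring automorphism permuting the variables, so it carries the relation
    -- characterising π to one for the reflected value, with permuted denominator. All the inner
    -- relations required by `braid` and `far-identity` arise this way.
    s-relation : ∀ m {a b} {r p q} → root a b * r ≈ (X a * p) - (X b * q) →
      root (sw m a) (sw m b) * s m r ≈ (X (sw m a) * s m p) - (X (sw m b) * s m q)
    s-relation m {a} {b} {r} {p} {q} h = begin
      root (sw m a) (sw m b) * s m r
        ≈⟨ *-congʳ (s-δ m a b) ⟨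
      s m (root a b) * s m r
        ≈⟨ s-* m (root a b) r ⟨
      s m (root a b * r)
        ≈⟨ s-cong m h ⟩
      s m ((X a * p) - (X b * q))
        ≈⟨ s-combination m a b p q ⟩
      (X (sw m a) * s m p) - (X (sw m b) * s m q) ∎

    s-δ-ϖ : ∀ m j p {a b} → sw m j ≡ a → sw m (suc j) ≡ b →
      root a b * s m (ϖ j p) ≈ (X a * s m p) - (X b * s m (s j p))
    s-δ-ϖ m j p ≡.refl ≡.refl = s-relation m {j} {suc j} (δ-ϖ j p)

    -- Cleared of both denominators, the two composites become the same signed sum over the four
    -- elements of the group generated by two commuting reflections.
    far-identity : ∀ x x′ y y′ {A A₁ C A′ A₁′ C′} f f₁ f₂ f₁₂ →
      (y - y′) * A ≈ (y * f) - (y′ * f₂) → (y - y′) * A₁ ≈ (y * f₁) - (y′ * f₁₂) →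
      (x - x′) * C ≈ (x * A) - (x′ * A₁) →
      (x - x′) * A′ ≈ (x * f) - (x′ * f₁) → (x - x′) * A₁′ ≈ (x * f₂) - (x′ * f₁₂) →
      (y - y′) * C′ ≈ (y * A′) - (y′ * A₁′) →
      (y - y′) * ((x - x′) * C) ≈ (y - y′) * ((x - x′) * C′)
    far-identity x x′ y y′ {A} {A₁} {C} {A′} {A₁′} {C′} f f₁ f₂ f₁₂ hA hA₁ hC hA′ hA₁′ hC′ = begin
      d′ * (d * C)
        ≈⟨ *-congˡ hC ⟩
      d′ * ((x * A) - (x′ * A₁))
        ≈⟨ solve 5 (λ d x x′ A A₁ → d :* (x :* A :- x′ :* A₁) := x :* (d :* A) :- x′ :* (d :* A₁)) refl d′ x x′ A A₁ ⟩
      (x * (d′ * A)) - (x′ * (d′ * A₁))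
        ≈⟨ +-cong (*-congˡ hA) (-‿cong (*-congˡ hA₁)) ⟩
      (x * ((y * f) - (y′ * f₂))) - (x′ * ((y * f₁) - (y′ * f₁₂)))
        ≈⟨ solve 8 (λ x x′ y y′ f f₁ f₂ f₁₂ → x :* (y :* f :- y′ :* f₂) :- x′ :* (y :* f₁ :- y′ :* f₁₂) :=
              y :* (x :* f :- x′ :* f₁) :- y′ :* (x :* f₂ :- x′ :* f₁₂)) refl x x′ y y′ f f₁ f₂ f₁₂ ⟩
      (y * ((x * f) - (x′ * f₁))) - (y′ * ((x * f₂) - (x′ * f₁₂)))
        ≈⟨ +-cong (*-congˡ hA′) (-‿cong (*-congˡ hA₁′)) ⟨
      (y * (d * A′)) - (y′ * (d * A₁′))
        ≈⟨ solve 5 (λ d x x′ A A₁ → x :* (d :* A) :- x′ :* (d :* A₁) := d :* (x :* A :- x′ :* A₁)) refl d y y′ A′ A₁′ ⟩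
      d * ((y * A′) - (y′ * A₁′))
        ≈⟨ *-congˡ hC′ ⟨
      d * (d′ * C′)
        ≈⟨ solve 3 (λ a b c → a :* (b :* c) := b :* (a :* c)) refl d d′ C′ ⟩
      d′ * (d * C′) ∎
      where
      d = x - x′
      d′ = y - y′

    ϖ-far : ∀ j d p → ϖ j (ϖ (2 ℕ.+ j ℕ.+ d) p) ≈ ϖ (2 ℕ.+ j ℕ.+ d) (ϖ j p)
    ϖ-far j d p = δ-cancel j (suc j) suc≢ (δ-cancel k (suc k) suc≢
      (far-identity (X j) (X (suc j)) (X k) (X (suc k)) p (s j p) (s k p) (s j (s k p))
        (δ-ϖ k p)
        (s-δ-ϖ j k p (sw-above j k (s≤s (s≤s (ℕₚ.m≤m+n j d)))) (sw-above j (suc k) (ℕₚ.m≤n⇒m≤1+n (s≤s (s≤s (ℕₚ.m≤m+n j d))))))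
        (δ-ϖ j (ϖ k p))
        (δ-ϖ j p)
        (trans (s-δ-ϖ k j p (sw-below k j (ℕₚ.m≤n⇒m≤1+n (s≤s (ℕₚ.m≤m+n j d)))) (sw-below k (suc j) (s≤s (s≤s (ℕₚ.m≤m+n j d)))))
          (+-cong refl (-‿cong (*-congˡ (sym (s-far j d p))))))
        (δ-ϖ k (ϖ j p))))
      where k = 2 ℕ.+ j ℕ.+ d

    ϖ-braid : ∀ j p → ϖ j (ϖ (suc j) (ϖ j p)) ≈ ϖ (suc j) (ϖ j (ϖ (suc j) p))
    -- With x, y, z the three variables, `braid` compares the two sides after multiplication by
    -- (x-y)²(x-z)(y-z)²; these five factors are cancelled one by one.
    ϖ-braid j p = δ-cancel j (suc j) suc≢ (δ-cancel j (2 ℕ.+ j) ne (δ-cancel (suc j) (2 ℕ.+ j) suc≢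
        (δ-cancel j (suc j) suc≢ (δ-cancel (suc j) (2 ℕ.+ j) suc≢
      (trans (rearrange (root (suc j) (2 ℕ.+ j)) (root j (suc j)) (root j (2 ℕ.+ j)) _)
      (trans (braid (X j) (X (suc j)) (X (2 ℕ.+ j)) p (s j p) (s (suc j) p) (s j (s (suc j) p)) (s (suc j) (s j p)) (s j (s (suc j) (s j p)))
        (δ-ϖ j p)
        (trans (s-δ-ϖ j j p (sw-left j) (sw-right j)) (+-cong refl (-‿cong (*-congˡ (s-involutive j p)))))
        (s-δ-ϖ (suc j) j p below₁ (sw-left (suc j)))
        (twice j (suc j) j p below₁ (sw-left j) (sw-left (suc j)) above₁)
        (δ-ϖ (suc j) (ϖ j p))
        (s-δ-ϖ j (suc j) (ϖ j p) (sw-right j) above₁)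
        (δ-ϖ j (ϖ (suc j) (ϖ j p)))
        (δ-ϖ (suc j) p)
        (trans (s-δ-ϖ (suc j) (suc j) p (sw-left (suc j)) (sw-right (suc j)))
          (+-cong refl (-‿cong (*-congˡ (s-involutive (suc j) p)))))
        (s-δ-ϖ j (suc j) p (sw-right j) above₁)
        (trans (twice (suc j) j (suc j) p (sw-right j) below₁ above₁ (sw-right (suc j)))
          (+-cong refl (-‿cong (*-congˡ (sym (s-braid j p))))))
        (δ-ϖ j (ϖ (suc j) p))
        (s-δ-ϖ (suc j) j (ϖ (suc j) p) below₁ (sw-left (suc j)))
        (δ-ϖ (suc j) (ϖ j (ϖ (suc j) p))))
      (sym (rearrange′ (root (suc j) (2 ℕ.+ j)) (root j (suc j)) (root j (2 ℕ.+ j)) _))))))))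
      where
      ne : ¬ j ≡ 2 ℕ.+ j
      ne e = ℕₚ.<-irrefl e (ℕₚ.m≤n⇒m≤1+n ℕₚ.≤-refl)
      below₁ : sw (suc j) j ≡ j
      below₁ = sw-below (suc j) j ℕₚ.≤-refl
      above₁ : sw j (2 ℕ.+ j) ≡ 2 ℕ.+ j
      above₁ = sw-above j (2 ℕ.+ j) ℕₚ.≤-refl
      rearrange : ∀ a b c q → a * (b * (a * (c * (b * q)))) ≈ a * (((b * c) * a) * (b * q))
      rearrange = solve 4 (λ a b c q → a :* (b :* (a :* (c :* (b :* q)))) := a :* (b :* c :* a :* (b :* q))) refl
      rearrange′ : ∀ a b c q → a * (b * (a * (c * (b * q)))) ≈ b * (((b * c) * a) * (a * q))
      rearrange′ = solve 4 (λ a b c q → a :* (b :* (a :* (c :* (b :* q)))) := b :* (b :* c :* a :* (a :* q))) refl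
      twice : ∀ m n k q {a b a′ b′} → sw n k ≡ a → sw m a ≡ a′ → sw n (suc k) ≡ b → sw m b ≡ b′ →
        root a′ b′ * s m (s n (ϖ k q)) ≈ (X a′ * s m (s n q)) - (X b′ * s m (s n (s k q)))
      twice m n k q {a} {b} ≡.refl ≡.refl ≡.refl ≡.refl = s-relation m {a} {b} (s-δ-ϖ n k q ≡.refl ≡.refl)

    ϖ* : List ℕ → Carrier → Carrier
    ϖ* [] p = p
    ϖ* (j ∷ r) p = ϖ j (ϖ* r p)

    ϖ*-~ : ∀ {r r′} → r ~ r′ → ∀ p → ϖ* r p ≈ ϖ* r′ p
    ϖ*-~ ~refl p = refl
    ϖ*-~ (~sym e) p = sym (ϖ*-~ e p)
    ϖ*-~ (~trans e f) p = trans (ϖ*-~ e p) (ϖ*-~ f p)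
    ϖ*-~ (~cons j e) p = ϖ-cong j (ϖ*-~ e p)
    ϖ*-~ (~braid j r) p = ϖ-braid j (ϖ* r p)
    ϖ*-~ (~far j d r) p = ϖ-far j d (ϖ* r p)

    ϖ*-cong : ∀ r {p q} → p ≈ q → ϖ* r p ≈ ϖ* r q
    ϖ*-cong [] e = e
    ϖ*-cong (j ∷ r) e = ϖ-cong j (ϖ*-cong r e)

    ϖ*-+ : ∀ r p q → ϖ* r (p + q) ≈ ϖ* r p + ϖ* r q
    ϖ*-+ [] p q = refl
    ϖ*-+ (j ∷ r) p q = trans (ϖ-cong j (ϖ*-+ r p q)) (ϖ-+ j (ϖ* r p) (ϖ* r q))

    ϖ*-zero : ∀ r → ϖ* r 0# ≈ 0#
    ϖ*-zero [] = refl
    ϖ*-zero (j ∷ r) = trans (ϖ-cong j (ϖ*-zero r)) (ϖ-zero j)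

    ϖ*-symmetric : ∀ r p g → (∀ j → s j g ≈ g) → ϖ* r (p * g) ≈ ϖ* r p * g
    ϖ*-symmetric [] p g h = refl
    ϖ*-symmetric (j ∷ r) p g h = trans (ϖ-cong j (ϖ*-symmetric r p g h)) (ϖ-symmetric j (ϖ* r p) g (h j))

    prod : List Carrier → Carrier
    prod = foldr _*_ 1#

    prod-++ : ∀ ps qs → prod (ps ++ qs) ≈ prod ps * prod qs
    prod-++ [] qs = sym (*-identityˡ (prod qs))
    prod-++ (p ∷ ps) qs = trans (*-congˡ (prod-++ ps qs)) (sym (*-assoc p (prod ps) (prod qs)))

    prod-↭ : ∀ {ps qs} → ps ↭ qs → prod ps ≈ prod qs
    prod-↭ ↭.refl = refl
    prod-↭ (↭.prep p e) = *-congˡ (prod-↭ e)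
    prod-↭ (↭.swap {ps} {qs} p q e) = trans (*-congˡ (*-congˡ (prod-↭ e)))
      (solve 3 (λ p q r → p :* (q :* r) := q :* (p :* r)) refl p q (prod qs))
    prod-↭ (↭.trans e f) = trans (prod-↭ e) (prod-↭ f)

    s-prod : ∀ {A : Set} j {f g : A → Carrier} → (∀ a → s j (f a) ≈ g a) → ∀ xs → s j (prod (map f xs)) ≈ prod (map g xs)
    s-prod j e [] = s-one j
    s-prod j {f} e (x ∷ xs) = trans (s-* j (f x) (prod (map f xs))) (*-cong (e x) (s-prod j e xs))

    ϖ-clear : ∀ j {F D P N D′} → F * D ≈ P → D * N ≈ D′ → s j D′ ≈ D′ → ϖ j F * D′ ≈ ϖ j (P * N)
    ϖ-clear j {F} {D} {P} {N} {D′} hP hD hs = begin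
      ϖ j F * D′        ≈⟨ ϖ-symmetric j F D′ hs ⟨
      ϖ j (F * D′)      ≈⟨ ϖ-cong j (*-congˡ (sym hD)) ⟩
      ϖ j (F * (D * N)) ≈⟨ ϖ-cong j (*-assoc F D N) ⟨
      ϖ j (F * D * N)   ≈⟨ ϖ-cong j (*-congʳ hP) ⟩
      ϖ j (P * N)       ∎

    layers : (ℕ → List Carrier) → ℕ → Carrier
    layers f n = prod (concatMap f (range1 n))

    layers-suc : ∀ f n → layers f (suc n) ≈ layers f n * prod (f (suc n))
    layers-suc f n = trans (reflexive (≡.cong prod (concatMap-range1-suc f n))) (prod-++ (concatMap f (range1 n)) (f (suc n)))

    layers-* : ∀ {f g h} → (∀ l → prod (f l) * prod (g l) ≈ prod (h l)) → ∀ n → layers f n * layers g n ≈ layers h n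
    layers-* e 0 = *-identityˡ 1#
    layers-* {f} {g} {h} e (suc n) = begin
      layers f (suc n) * layers g (suc n)
        ≈⟨ *-cong (layers-suc f n) (layers-suc g n) ⟩
      layers f n * prod (f (suc n)) * (layers g n * prod (g (suc n)))
        ≈⟨ solve 4 (λ a b c d → a :* b :* (c :* d) := a :* c :* (b :* d)) refl (layers f n) (prod (f (suc n))) (layers g n) (prod (g (suc n))) ⟩
      layers f n * layers g n * (prod (f (suc n)) * prod (g (suc n)))
        ≈⟨ *-cong (layers-* e n) (e (suc n)) ⟩
      layers h n * prod (h (suc n))
        ≈⟨ layers-suc h n ⟨
      layers h (suc n) ∎

    s-layers : ∀ j {f} → (∀ l → s j (prod (f l)) ≈ prod (f l)) → ∀ n → s j (layers f n) ≈ layers f n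
    s-layers j e 0 = s-one j
    s-layers j {f} e (suc n) = begin
      s j (layers f (suc n))                    ≈⟨ s-cong j (layers-suc f n) ⟩
      s j (layers f n * prod (f (suc n)))       ≈⟨ s-* j (layers f n) (prod (f (suc n))) ⟩
      s j (layers f n) * s j (prod (f (suc n))) ≈⟨ *-cong (s-layers j e n) (e (suc n)) ⟩
      layers f n * prod (f (suc n))             ≈⟨ layers-suc f n ⟨
      layers f (suc n)                          ∎

    prod-grow : ∀ {A : Set} (f : A → Carrier) (g : A → A) {as bs cs} → cs ↭ as ++ map g bs →
      prod (map f as) * prod (map (λ b → f (g b)) bs) ≈ prod (map f cs)
    prod-grow f g {as} {bs} {cs} e = begin
      prod (map f as) * prod (map (λ b → f (g b)) bs) ≈⟨ prod-++ (map f as) (map (λ b → f (g b)) bs) ⟨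
      prod (map f as ++ map (λ b → f (g b)) bs)       ≡⟨ ≡.cong (λ z → prod (map f as ++ z)) (map-∘ bs) ⟩
      prod (map f as ++ map f (map g bs))             ≡⟨ ≡.cong prod (map-++ f as (map g bs)) ⟨
      prod (map f (as ++ map g bs))                   ≈⟨ prod-↭ (map⁺ f e) ⟨
      prod (map f cs)                                 ∎

    s-prod-stable : ∀ {A : Set} j (f : A → Carrier) (g : A → A) → (∀ a → s j (f a) ≈ f (g a)) →
      ∀ {as} → map g as ↭ as → s j (prod (map f as)) ≈ prod (map f as)
    s-prod-stable j f g h {as} e = begin
      s j (prod (map f as))        ≈⟨ s-prod j h as ⟩
      prod (map (λ a → f (g a)) as) ≡⟨ ≡.cong prod (map-∘ as) ⟩
      prod (map f (map g as))      ≈⟨ prod-↭ (map⁺ f e) ⟩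
      prod (map f as)              ∎

open DemazureAlgebra

-- The explicit divided differences satisfy the abstract axioms.

module DividedDifferences where

  open import Algebra.Solver.Ring.AlmostCommutativeRing using (fromCommutativeRing; _-Raw-AlmostCommutative⟶_)
  open import Data.Nat using (ℕ; zero; suc; _≤_; _<_; z≤n; s≤s; _≡ᵇ_; _<ᵇ_; _⊓_; _∸_) renaming (_+_ to _+ℕ_)
  import Data.Nat.Properties as ℕₚ
  open import Data.Integer using (ℤ; +_; -_; _+_; _*_; _-_)
  import Data.Integer.Properties as ℤₚ
  open import Data.Integer.Solver using (module +-*-Solver)
  open import Data.Bool using (if_then_else_)
  open import Data.Empty using (⊥-elim)
  open import Data.List using (List; []; _∷_; map; applyUpTo; upTo)
  open import Data.Product using (_,_)
  open import Function using (_∘_; id)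
  open import Relation.Nullary using (¬_)
  open import Relation.Binary.Definitions using (tri<; tri≈; tri>)
  open import Relation.Binary.PropositionalEquality
  import Relation.Binary.Reasoning.Setoid as SetoidReasoning

  if-≡ : ∀ {A : Set} {k j} (x y : A) → k ≡ j → (if k ≡ᵇ j then x else y) ≡ x
  if-≡ {k = k} x y refl = if-≡ᵇ k x y

  if-< : ∀ {A : Set} {k j} (x y : A) → k < j → (if k <ᵇ j then x else y) ≡ x
  if-< {k = zero} {suc j} x y p = refl
  if-< {k = suc k} {suc j} x y (s≤s p) = if-< {k = k} {j} x y p

  if-≮ : ∀ {A : Set} {k j} (x y : A) → j ≤ k → (if k <ᵇ j then x else y) ≡ y
  if-≮ {k = k} {zero} x y p = refl
  if-≮ {k = suc k} {suc j} x y (s≤s p) = if-≮ {k = k} {j} x y p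

  -- The arbitrary `f` is for the induction: the tail of `upTo n` is not itself an `upTo`.
  telescope : ∀ θ c (g : ℕ → Term) (G : ℕ → ℤ) n f →
    (∀ k → k < n → ev θ (g (f k) ∷ []) ≡ c * (G k - G (suc k))) →
    ev θ (map g (applyUpTo f n)) ≡ c * (G 0 - G n)
  telescope θ c g G zero f h = solve 2 (λ c a → con (+ 0) := c :* (a :- a)) refl c (G 0)
    where open +-*-Solver
  telescope θ c g G (suc n) f h = trans (ev-++ θ (g (f 0) ∷ []) (map g (applyUpTo (f ∘ suc) n)))
    (trans (cong₂ _+_ (h 0 (s≤s z≤n)) (telescope θ c g (G ∘ suc) n (f ∘ suc) λ k p → h (suc k) (s≤s p)))
      (solve 4 (λ c a b d → c :* (a :- b) :+ c :* (b :- d) := c :* (a :- d)) refl c (G 0) (G 1) (G (suc n))))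
    where open +-*-Solver

  swapE-put : ∀ j e p q → getE e (suc j) ≡ q → getE e (2 +ℕ j) ≡ p → put j (suc j) e p q ≐ swapE j e
  swapE-put j e p q ea eb = put-≐ j (suc j) e p q (swapE j e) suc≢
    (trans (getE-swap j e (suc j)) (trans (cong (getE e) (sw-left (suc j))) eb))
    (trans (getE-swap j e (2 +ℕ j)) (trans (cong (getE e) (sw-right (suc j))) ea))
    λ k na nb → sym (trans (getE-swap j e k) (cong (getE e) (sw-other j k na nb)))
    where
    sw-other : ∀ j k → ¬ k ≡ suc j → ¬ k ≡ 2 +ℕ j → sw (suc j) k ≡ k
    sw-other j k na nb with ℕₚ.<-cmp k (suc j)
    ... | tri< lt _ _ = sw-below (suc j) k lt
    ... | tri≈ _ e _ = ⊥-elim (na e)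
    ... | tri> _ _ gt = sw-above (suc j) k (ℕₚ.≤∧≢⇒< gt (nb ∘ sym))

  suc-∸-suc : ∀ {k d} → k < d → suc (d ∸ suc k) ≡ d ∸ k
  suc-∸-suc {k} {suc d} (s≤s p) = sym (ℕₚ.+-∸-assoc 1 p)

  -- The list in `∂term` with sign, minimum and difference of the two exponents as free parameters,
  -- so that both orders of the exponents share one computation.
  ∂term′ : ℕ → ℤ → Exps → Exps → ℕ → ℕ → Poly
  ∂term′ j c xe te m d =
    map (λ k → (c , put j (suc j) xe (m +ℕ (d ∸ suc k)) (m +ℕ k) , te)) (upTo d)

  module Demazure (μ : Exps) where

    open Modulo μ

    -- The transpose of multiplication by x_{j+1} - x_{j+2}.
    step : (t : Test μ) → ℕ → Exps → Exps → ℤ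
    step t j e ue = fun t (addE (unitE (suc j)) e) ue + - + 1 * fun t (addE (unitE (2 +ℕ j)) e) ue

    ev-δ-step : ∀ t j p → ev (fun t) (δ j (suc j) *P p) ≡ ev (step t j) p
    ev-δ-step t j p = trans (ev-δ (fun t) j (suc j) p) (sym (trans (ev-+ φ₁ _ p)
      (trans (cong (λ z → ev φ₁ p + z) (ev-* (- + 1) φ₂ p)) (cong (λ z → ev φ₁ p + z) (ℤₚ.-1*i≡-i (ev φ₂ p))))))
      where
      φ₁ = shift (unitE (suc j)) [] (fun t)
      φ₂ = shift (unitE (2 +ℕ j)) [] (fun t)

    -- The d + 1 monomials with these two exponents running from (m+d, m) to (m, m+d) form a chain.
    -- The k-th monomial of the list times x_{j+1} is the k-th of the chain, times x_{j+2} it is the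
    -- next one, so the sum telescopes.
    ev-∂term′ : ∀ t j c xe te m d → ev (step t j) (∂term′ j c xe te m d) ≡
      c * (fun t (put j (suc j) xe (m +ℕ d) m) te - fun t (put j (suc j) xe m (m +ℕ d)) te)
    ev-∂term′ t j c xe te m d = trans (telescope (step t j) c _ G d id term)
      (cong₂ (λ u v → c * (u - v))
        (cong (λ z → fun t (put j (suc j) xe (m +ℕ d) z) te) (ℕₚ.+-identityʳ m))
        (cong (λ z → fun t (put j (suc j) xe z (m +ℕ d)) te) (trans (cong (m +ℕ_) (ℕₚ.n∸n≡0 d)) (ℕₚ.+-identityʳ m))))
      where
      G : ℕ → ℤ
      G k = fun t (put j (suc j) xe (m +ℕ (d ∸ k)) (m +ℕ k)) te
      E : ℕ → Exps
      E k = put j (suc j) xe (m +ℕ (d ∸ suc k)) (m +ℕ k)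
      Ea : ∀ k → getE (E k) (suc j) ≡ m +ℕ (d ∸ suc k)
      Ea k = getE-put-a j (suc j) xe _ _ suc≢
      Eb : ∀ k → getE (E k) (2 +ℕ j) ≡ m +ℕ k
      Eb k = getE-put-b j (suc j) xe (m +ℕ (d ∸ suc k)) _
      first : ∀ k → k < d → put j (suc j) xe (m +ℕ (d ∸ k)) (m +ℕ k) ≐ addE (unitE (suc j)) (E k)
      first k p = put-≐ j (suc j) xe _ _ _ suc≢
        (trans (getE-add (unitE (suc j)) (E k) (suc j)) (trans (cong₂ _+ℕ_ (getE-unit-same j) (Ea k))
          (trans (sym (ℕₚ.+-suc m _)) (cong (m +ℕ_) (suc-∸-suc p)))))
        (trans (getE-add (unitE (suc j)) (E k) (2 +ℕ j)) (cong₂ _+ℕ_ (getE-unit-other j (2 +ℕ j) (suc≢ ∘ sym)) (Eb k)))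
        λ k′ na nb → sym (trans (getE-add (unitE (suc j)) (E k) k′)
          (cong₂ _+ℕ_ (getE-unit-other j k′ na) (getE-put-other j (suc j) xe _ _ k′ na nb)))
      second : ∀ k → put j (suc j) xe (m +ℕ (d ∸ suc k)) (m +ℕ suc k) ≐ addE (unitE (2 +ℕ j)) (E k)
      second k = put-≐ j (suc j) xe _ _ _ suc≢
        (trans (getE-add (unitE (2 +ℕ j)) (E k) (suc j)) (cong₂ _+ℕ_ (getE-unit-other (suc j) (suc j) suc≢) (Ea k)))
        (trans (getE-add (unitE (2 +ℕ j)) (E k) (2 +ℕ j)) (trans (cong₂ _+ℕ_ (getE-unit-same (suc j)) (Eb k)) (sym (ℕₚ.+-suc m k))))
        λ k′ na nb → sym (trans (getE-add (unitE (2 +ℕ j)) (E k) k′)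
          (cong₂ _+ℕ_ (getE-unit-other (suc j) k′ nb) (getE-put-other j (suc j) xe _ _ k′ na nb)))
      term : ∀ k → k < d → ev (step t j) ((c , E k , te) ∷ []) ≡ c * (G k - G (suc k))
      term k p = trans (ℤₚ.+-identityʳ _) (cong (c *_) (trans
        (cong₂ (λ u v → u + - + 1 * v) (fcong t (≐-sym (first k p)) ≐-refl) (fcong t (≐-sym (second k)) ≐-refl))
        (cong (λ z → G k + z) (ℤₚ.-1*i≡-i (G (suc k))))))

    ev-∂term : ∀ t j c xe te → ev (step t j) (∂term (suc j) (c , xe , te)) ≡ c * (fun t xe te - fun t (swapE j xe) te)
    ev-∂term t j c xe te with ℕₚ.<-cmp (getE xe (suc j)) (getE xe (2 +ℕ j))
    ... | tri≈ _ e _ = trans (cong (ev (step t j)) (if-≡ [] _ e))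
      (trans (solve 2 (λ c a → con (+ 0) := c :* (a :- a)) refl c (fun t xe te))
        (cong (λ z → c * (fun t xe te - z)) (fcong t
          (≐-trans (≐-sym (put-≐ j (suc j) xe _ _ xe suc≢ refl refl λ _ _ _ → refl)) (swapE-put j xe _ _ e (sym e))) ≐-refl)))
      where open +-*-Solver
    -- Here the chain runs from the swapped monomial to the original one; the sign in `∂term` turns
    -- the difference around.
    ... | tri< lt ne _ = trans (cong (ev (step t j)) (trans (if-≢ᵇ A B [] _ ne)
            (cong₂ (λ c′ d → ∂term′ j c′ xe te (A ⊓ B) d) (if-≮ {k = B} c (- c) (ℕₚ.<⇒≤ lt)) (cong (_+ℕ (B ∸ A)) (ℕₚ.m≤n⇒m∸n≡0 (ℕₚ.<⇒≤ lt))))))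
      (trans (cong (λ m → ev (step t j) (∂term′ j (- c) xe te m (B ∸ A))) (ℕₚ.m≤n⇒m⊓n≡m (ℕₚ.<⇒≤ lt)))
      (trans (ev-∂term′ t j (- c) xe te A (B ∸ A))
      (trans (solve 3 (λ c u v → (:- c) :* (u :- v) := c :* (v :- u)) refl c (fun t (put j (suc j) xe (A +ℕ (B ∸ A)) A) te) (fun t (put j (suc j) xe A (A +ℕ (B ∸ A))) te))
      (cong₂ (λ u v → c * (u - v))
        (fcong t (put-≐ j (suc j) xe _ _ xe suc≢ refl (sym sum) λ _ _ _ → refl) ≐-refl)
        (fcong t (swapE-put j xe _ _ refl (sym sum)) ≐-refl)))))
      where
      open +-*-Solver
      A = getE xe (suc j)
      B = getE xe (2 +ℕ j)
      sum : A +ℕ (B ∸ A) ≡ B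
      sum = ℕₚ.m+[n∸m]≡n (ℕₚ.<⇒≤ lt)
    ... | tri> _ ne gt = trans (cong (ev (step t j)) (trans (if-≢ᵇ A B [] _ ne)
            (cong₂ (λ c′ d → ∂term′ j c′ xe te (A ⊓ B) d) (if-< {k = B} c (- c) gt)
               (trans (cong ((A ∸ B) +ℕ_) (ℕₚ.m≤n⇒m∸n≡0 (ℕₚ.<⇒≤ gt))) (ℕₚ.+-identityʳ _)))))
      (trans (cong (λ m → ev (step t j) (∂term′ j c xe te m (A ∸ B))) (ℕₚ.m≥n⇒m⊓n≡n (ℕₚ.<⇒≤ gt)))
      (trans (ev-∂term′ t j c xe te B (A ∸ B))
      (cong₂ (λ u v → c * (u - v))
        (fcong t (put-≐ j (suc j) xe _ _ xe suc≢ (sym sum) refl λ _ _ _ → refl) ≐-refl)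
        (fcong t (swapE-put j xe _ _ (sym sum) refl) ≐-refl))))
      where
      A = getE xe (suc j)
      B = getE xe (2 +ℕ j)
      sum : B +ℕ (A ∸ B) ≡ A
      sum = ℕₚ.m+[n∸m]≡n (ℕₚ.<⇒≤ gt)

    δ-∂ : ∀ j p → δ j (suc j) *P ∂ (suc j) p ≋ p +P negP (swapP j p)
    δ-∂ j p = tests λ t → trans (ev-δ-step t j (∂ (suc j) p))
      (trans (ev-concatMap (step t j) _ (∂term (suc j)) (ev-∂term t j) p)
      (trans (ev-+ (fun t) (λ xe te → - fun t (swapE j xe) te) p)
      (trans (cong (λ z → ev (fun t) p + z) (trans (ev-cong (λ xe te → sym (ℤₚ.-1*i≡-i _)) p)
         (trans (ev-* (- + 1) (λ xe te → fun t (swapE j xe) te) p) (trans (ℤₚ.-1*i≡-i _)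
           (trans (cong -_ (sym (ev-swapP (fun t) j p))) (sym (ev-neg (fun t) (swapP j p))))))))
        (sym (ev-++ (fun t) p (negP (swapP j p)))))))

    constP : ℤ → Poly
    constP c = (c , [] , []) ∷ []

    constP-hom : ℤ-rawRing -Raw-AlmostCommutative⟶ fromCommutativeRing polyRing
    constP-hom = record
      { ⟦_⟧ = constP
      ; +-homo = λ a b → tests λ t → solve 3 (λ a b u → (a :+ b) :* u :+ con (+ 0) := a :* u :+ (b :* u :+ con (+ 0))) refl a b (fun t [] [])
      ; *-homo = λ a b → ≋-refl
      ; -‿homo = λ a → ≋-refl
      ; 0-homo = tests λ t → refl
      ; 1-homo = ≋-refl
      }
      where open +-*-Solver

    swapP-one : ∀ j → swapP j oneP ≋ oneP
    swapP-one j = term-cong (+ 1) (swapE-[] j) ≐-refl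

    δ-π : ∀ j p → δ j (suc j) *P π (suc j) p ≋ (xVar (suc j) *P p) +P negP (xVar (2 +ℕ j) *P swapP j p)
    δ-π j p = ≋-trans (δ-∂ j (xVar (suc j) *P p))
      (+P-cong {xVar (suc j) *P p} ≋-refl (negP-cong (≋-trans (swapP-* j (xVar (suc j)) p)
        (*P-cong {q = swapP j p} (≋-trans (swapP-xVar j j) (≡⇒≋ (cong (xVar ∘ suc) (sw-left j)))) ≋-refl))))

    demazureStructure : DemazureStructure
    demazureStructure = record
      { polynomials = polyRing ; scalar = constP-hom
      ; X = xVar ∘ suc ; s = swapP ; ϖ = π ∘ suc
      ; s-cong = swapP-cong ; s-+ = swapP-+ ; s-neg = λ j p → ≡⇒≋ (swapP-neg j p) ; s-* = swapP-*
      ; s-zero = λ j → ≋-refl ; s-one = λ j → swapP-one j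
      ; s-involutive = swapP-involutive ; s-far = swapP-far ; s-braid = swapP-braid ; s-X = swapP-xVar
      ; δ-cancel = λ a b ne → δ-cancel a b ne ; δ-ϖ = δ-π
      }

    open DemazureOperators demazureStructure public

open DividedDifferences

-- Counting functions of sequences and membership in A_l(w).

module CountingFunctions where

  open import Data.Nat
  open import Data.Nat.Properties
  open import Algebra.Properties.CommutativeSemigroup +-commutativeSemigroup using (interchange)
  open import Data.Bool using (Bool; true; false; _∧_)
  open import Data.Empty using (⊥; ⊥-elim)
  open import Data.List using (List; []; _∷_; map; length)
  open import Data.List.Properties using (length-map)
  open import Data.List.Membership.Propositional using (_∈_)
  open import Data.List.Membership.Propositional.Properties using (∈-map⁺; ∈-map⁻; ∈-++⁺ˡ; ∈-++⁺ʳ; ∈-++⁻)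
  open import Data.List.Relation.Unary.Any using (here; there)
  open import Data.List.Relation.Unary.All as All using (All; []; _∷_)
  open import Data.List.Relation.Unary.AllPairs as AllPairs using (AllPairs; []; _∷_)
  import Data.List.Relation.Unary.AllPairs.Properties as AllPairsₚ
  open import Data.List.Relation.Unary.Unique.Propositional using (Unique)
  import Data.List.Relation.Unary.Unique.Propositional.Properties as Uniqueₚ
  open import Data.List.Relation.Binary.Permutation.Propositional using (_↭_; ↭-refl; ↭-sym; ↭-trans; prep; swap)
  import Data.List.Relation.Binary.Permutation.Propositional as ↭
  open import Data.List.Relation.Binary.Permutation.Propositional.Properties using (↭-length; map⁺; All-resp-↭)
  open import Data.Product using (_×_; _,_; proj₁; proj₂)
  open import Data.Sum using (inj₁; inj₂)
  open import Function using (_∘_)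
  open import Relation.Nullary using (¬_; yes; no)
  open import Relation.Binary.PropositionalEquality

  -- A number rather than a Boolean, so that counts satisfy linear identities.
  le : ℕ → ℕ → ℕ
  le zero k = 1
  le (suc x) zero = 0
  le (suc x) (suc k) = le x k

  cnt : ℕ → List ℕ → ℕ
  cnt k [] = 0
  cnt k (x ∷ xs) = le x k + cnt k xs

  le-yes : ∀ {x k} → x ≤ k → le x k ≡ 1
  le-yes z≤n = refl
  le-yes (s≤s p) = le-yes p

  le-no : ∀ {x k} → k < x → le x k ≡ 0
  le-no {suc x} {zero} p = refl
  le-no {suc x} {suc k} (s≤s p) = le-no p

  le≤1 : ∀ x k → le x k ≤ 1
  le≤1 zero k = ≤-refl
  le≤1 (suc x) zero = z≤n
  le≤1 (suc x) (suc k) = le≤1 x k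

  le-mono : ∀ x k → le x k ≤ le x (suc k)
  le-mono zero k = ≤-refl
  le-mono (suc x) zero = z≤n
  le-mono (suc x) (suc k) = le-mono x k

  le-anti : ∀ {x y} k → x ≤ y → le y k ≤ le x k
  le-anti {x} {y} k p with y ≤? k
  ... | yes q = ≤-reflexive (trans (le-yes q) (sym (le-yes (≤-trans p q))))
  ... | no q = subst (_≤ le x k) (sym (le-no (≰⇒> q))) z≤n

  cnt-mono : ∀ xs k → cnt k xs ≤ cnt (suc k) xs
  cnt-mono [] k = z≤n
  cnt-mono (x ∷ xs) k = +-mono-≤ (le-mono x k) (cnt-mono xs k)

  cnt-↭ : ∀ k {xs ys} → xs ↭ ys → cnt k xs ≡ cnt k ys
  cnt-↭ k ↭.refl = refl
  cnt-↭ k (prep x e) = cong (le x k +_) (cnt-↭ k e)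
  cnt-↭ k (swap {xs} {ys} x y e) = trans (sym (+-assoc (le x k) (le y k) _))
    (trans (cong₂ _+_ (+-comm (le x k) (le y k)) (cnt-↭ k e)) (+-assoc (le y k) (le x k) _))
  cnt-↭ k (↭.trans e f) = trans (cnt-↭ k e) (cnt-↭ k f)

  cnt-none : ∀ k xs → All (k <_) xs → cnt k xs ≡ 0
  cnt-none k [] [] = refl
  cnt-none k (x ∷ xs) (p ∷ ps) = cong₂ _+_ (le-no p) (cnt-none k xs ps)

  -- The entries i and i+1 lie on the same side of every threshold other than i.
  le-sw : ∀ i x k → ¬ k ≡ i → le (sw i x) k ≡ le x k
  le-sw zero zero zero ne = ⊥-elim (ne refl)
  le-sw zero zero (suc k) ne = refl
  le-sw zero (suc zero) zero ne = ⊥-elim (ne refl)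
  le-sw zero (suc zero) (suc k) ne = refl
  le-sw zero (suc (suc x)) k ne = refl
  le-sw (suc i) zero k ne = refl
  le-sw (suc i) (suc x) zero ne = refl
  le-sw (suc i) (suc x) (suc k) ne = le-sw i x k (ne ∘ cong suc)

  -- With i = j + 1: the threshold i-1 admits neither of i and i+1, the threshold i+1 admits both,
  -- and s_i exchanges which of the two the threshold i admits. Summed over a sequence, s_i reflects
  -- the count at i in the mean of its neighbours.
  le-sw-at : ∀ j x → le (sw (suc j) x) (suc j) + le x (suc j) ≡ le x j + le x (2 + j)
  le-sw-at j zero = refl
  le-sw-at zero (suc zero) = refl
  le-sw-at zero (suc (suc zero)) = refl
  le-sw-at zero (suc (suc (suc x))) = refl
  le-sw-at (suc j) (suc x) = le-sw-at j x

  cnt-sw : ∀ i xs k → ¬ k ≡ i → cnt k (map (sw i) xs) ≡ cnt k xs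
  cnt-sw i [] k ne = refl
  cnt-sw i (x ∷ xs) k ne = cong₂ _+_ (le-sw i x k ne) (cnt-sw i xs k ne)

  cnt-sw-at : ∀ j xs → cnt (suc j) (map (sw (suc j)) xs) + cnt (suc j) xs ≡ cnt j xs + cnt (2 + j) xs
  cnt-sw-at j [] = refl
  cnt-sw-at j (x ∷ xs) = trans (interchange (le (sw (suc j) x) (suc j)) _ (le x (suc j)) _)
    (trans (cong₂ _+_ (le-sw-at j x) (cnt-sw-at j xs)) (interchange (le x j) (le x (2 + j)) (cnt j xs) _))

  -- Componentwise comparison of increasing sequences is comparison of counting functions.

  leAll-sound : ∀ α β → leAll α β ≡ true → length α ≡ length β × ∀ k → cnt k β ≤ cnt k α
  leAll-sound [] [] e = refl , λ _ → z≤n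
  leAll-sound (a ∷ α) (b ∷ β) e with a ≤ᵇ b in a≤b
  ... | true with len , rest ← leAll-sound α β e =
    cong suc len , λ k → +-mono-≤ (le-anti k (≤ᵇ⇒≤ a b (subst Data.Bool.T (sym a≤b) _))) (rest k)

  T-≡ : ∀ {b} → Data.Bool.T b → b ≡ true
  T-≡ {true} _ = refl

  ≡-T : ∀ {b} → b ≡ true → Data.Bool.T b
  ≡-T refl = _

  Sorted : List ℕ → Set
  Sorted = AllPairs _≤_

  Strict : List ℕ → Set
  Strict = AllPairs _<_

  leAll-complete : ∀ α β → Sorted α → Sorted β → length α ≡ length β → (∀ k → cnt k β ≤ cnt k α) → leAll α β ≡ true
  leAll-complete [] [] _ _ _ _ = refl
  leAll-complete (a ∷ α) (b ∷ β) (pa ∷ sa) (pb ∷ sb) len h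
    = trans (cong (_∧ leAll α β) (T-≡ (≤⇒≤ᵇ a≤b))) (leAll-complete α β sa sb (suc-injective len) tail)
    where
    a≤b : a ≤ b
    a≤b with a ≤? b
    ... | yes p = p
    -- If b < a, then β has an entry at most b while all entries of the increasing α exceed b,
    -- contrary to the counts at b.
    ... | no ¬p = ⊥-elim (1+n≰n (≤-trans (≤-trans (≤-trans (≤-reflexive (sym (le-yes {b} ≤-refl))) (m≤m+n _ _)) (h b))
       (≤-reflexive (cnt-none b (a ∷ α) (≰⇒> ¬p ∷ All.map (≤-trans (≰⇒> ¬p)) pa)))))
    tail : ∀ k → cnt k β ≤ cnt k α
    tail k with b ≤? k
    ... | yes p = +-cancelˡ-≤ 1 _ _ (subst₂ (λ u v → u + cnt k β ≤ v + cnt k α) (le-yes p) (le-yes (≤-trans a≤b p)) (h k))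
    ... | no ¬p = subst (_≤ cnt k α) (sym (cnt-none k β (All.map (≤-trans (≰⇒> ¬p)) pb))) z≤n

  leAll-antisym : ∀ α β → leAll α β ≡ true → leAll β α ≡ true → α ≡ β
  leAll-antisym [] [] _ _ = refl
  leAll-antisym (a ∷ α) (b ∷ β) p q with a ≤ᵇ b in a≤b | b ≤ᵇ a in b≤a
  ... | true | true = cong₂ _∷_ (≤-antisym (≤ᵇ⇒≤ a b (≡-T a≤b)) (≤ᵇ⇒≤ b a (≡-T b≤a))) (leAll-antisym α β p q)

  sorted-unique : ∀ {α β} → Sorted α → Sorted β → length α ≡ length β → (∀ k → cnt k α ≡ cnt k β) → α ≡ β
  sorted-unique {α} {β} sα sβ len e = leAll-antisym α β
    (leAll-complete α β sα sβ len (λ k → ≤-reflexive (sym (e k))))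
    (leAll-complete β α sβ sα (sym len) (λ k → ≤-reflexive (e k)))

  insertN-↭ : ∀ x xs → insertN x xs ↭ x ∷ xs
  insertN-↭ x [] = ↭-refl
  insertN-↭ x (y ∷ ys) with x ≤ᵇ y
  ... | true = ↭-refl
  ... | false = ↭-trans (prep y (insertN-↭ x ys)) (swap y x ↭-refl)

  sortN-↭ : ∀ xs → sortN xs ↭ xs
  sortN-↭ [] = ↭-refl
  sortN-↭ (x ∷ xs) = ↭-trans (insertN-↭ x (sortN xs)) (prep x (sortN-↭ xs))

  insertN-sorted : ∀ x xs → Sorted xs → Sorted (insertN x xs)
  insertN-sorted x [] [] = [] ∷ []
  insertN-sorted x (y ∷ ys) (py ∷ sy) with x ≤ᵇ y in e
  ... | true = (x≤y ∷ All.map (≤-trans x≤y) py) ∷ py ∷ sy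
    where x≤y = ≤ᵇ⇒≤ x y (≡-T e)
  ... | false = All-resp-↭ (↭-sym (insertN-↭ x ys)) (<⇒≤ (≰⇒> λ p → subst Data.Bool.T e (≤⇒≤ᵇ p)) ∷ py) ∷ insertN-sorted x ys sy

  sortN-sorted : ∀ xs → Sorted (sortN xs)
  sortN-sorted [] = []
  sortN-sorted (x ∷ xs) = insertN-sorted x (sortN xs) (sortN-sorted xs)

  cnt-sortN : ∀ k xs → cnt k (sortN xs) ≡ cnt k xs
  cnt-sortN k xs = cnt-↭ k (sortN-↭ xs)

  length-sortN : ∀ xs → length (sortN xs) ≡ length xs
  length-sortN xs = ↭-length (sortN-↭ xs)

  ∈-boolFilter⁺ : ∀ {A : Set} (p : A → Bool) {x} xs → x ∈ xs → p x ≡ true → x ∈ boolFilter p xs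
  ∈-boolFilter⁺ p (y ∷ xs) (here refl) e rewrite e = here refl
  ∈-boolFilter⁺ p (y ∷ xs) (there i) e with p y
  ... | true = there (∈-boolFilter⁺ p xs i e)
  ... | false = ∈-boolFilter⁺ p xs i e

  ∈-boolFilter⁻ : ∀ {A : Set} (p : A → Bool) {x} xs → x ∈ boolFilter p xs → x ∈ xs × p x ≡ true
  ∈-boolFilter⁻ p (y ∷ xs) i with p y in e
  ∈-boolFilter⁻ p (y ∷ xs) (here refl) | true = here refl , e
  ∈-boolFilter⁻ p (y ∷ xs) (there i) | true with j , f ← ∈-boolFilter⁻ p xs i = there j , f
  ∈-boolFilter⁻ p (y ∷ xs) i | false with j , f ← ∈-boolFilter⁻ p xs i = there j , f

  boolFilter-All : ∀ {A : Set} {P : A → Set} (p : A → Bool) {xs} → All P xs → All P (boolFilter p xs)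
  boolFilter-All p [] = []
  boolFilter-All p {x ∷ _} (px ∷ h) with p x
  ... | true = px ∷ boolFilter-All p h
  ... | false = boolFilter-All p h

  boolFilter-unique : ∀ {A : Set} (p : A → Bool) {xs} → Unique xs → Unique (boolFilter p xs)
  boolFilter-unique p [] = []
  boolFilter-unique p {x ∷ _} (nx ∷ u) with p x
  ... | true = boolFilter-All p nx ∷ boolFilter-unique p u
  ... | false = boolFilter-unique p u

  Strict⇒Sorted : ∀ {xs} → Strict xs → Sorted xs
  Strict⇒Sorted = AllPairs.map <⇒≤

  Strict⇒Unique : ∀ {xs} → Strict xs → Unique xs
  Strict⇒Unique = AllPairs.map <⇒≢

  ∈-choose⁺ : ∀ {α xs} → Strict xs → Strict α → All (_∈ xs) α → α ∈ choose (length α) xs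
  ∈-choose⁺ {[]} _ _ _ = here refl
  ∈-choose⁺ {a ∷ α} {x ∷ xs} (px ∷ sx) (pa ∷ sa) (here refl ∷ ins) =
    ∈-++⁺ˡ (∈-map⁺ (x ∷_) (∈-choose⁺ sx sa (All.zipWith skip (pa , ins))))
    where
    skip : ∀ {b} → (x < b) × (b ∈ x ∷ xs) → b ∈ xs
    skip (lt , here refl) = ⊥-elim (<-irrefl refl lt)
    skip (lt , there i) = i
  ∈-choose⁺ {a ∷ α} {x ∷ xs} (px ∷ sx) (pa ∷ sa) (there i ∷ ins) =
    ∈-++⁺ʳ (map (x ∷_) (choose (length α) xs)) (∈-choose⁺ sx (pa ∷ sa) (i ∷ All.zipWith skip (pa , ins)))
    where
    skip : ∀ {b} → (a < b) × (b ∈ x ∷ xs) → b ∈ xs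
    skip (lt , here refl) = ⊥-elim (<-asym lt (All.lookup px i))
    skip (lt , there i) = i

  ∈-choose⁻ : ∀ k xs {α} → Strict xs → α ∈ choose k xs → Strict α × All (_∈ xs) α × length α ≡ k
  ∈-choose⁻ zero xs sx (here refl) = [] , [] , refl
  ∈-choose⁻ (suc k) (x ∷ xs) (px ∷ sx) i with ∈-++⁻ (map (x ∷_) (choose k xs)) i
  ... | inj₁ j with α , jα , refl ← ∈-map⁻ (x ∷_) j
    with sα , ins , len ← ∈-choose⁻ k xs sx jα
    = All.map (All.lookup px) ins ∷ sα , here refl ∷ All.map there ins , cong suc len
  ... | inj₂ j with sα , ins , len ← ∈-choose⁻ (suc k) xs sx j = sα , All.map there ins , len

  choose-unique : ∀ k xs → Strict xs → Unique (choose k xs)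
  choose-unique zero xs sx = [] ∷ []
  choose-unique (suc k) [] sx = []
  choose-unique (suc k) (x ∷ xs) (px ∷ sx) = Uniqueₚ.++⁺
    (Uniqueₚ.map⁺ (λ { refl → refl }) (choose-unique k xs sx)) (choose-unique (suc k) xs sx)
    λ { (i , j) → disjoint i j }
    where
    disjoint : ∀ {α} → α ∈ map (x ∷_) (choose k xs) → α ∈ choose (suc k) xs → ⊥
    disjoint i j with α , _ , refl ← ∈-map⁻ (x ∷_) i with _ , (x∈ ∷ _) , _ ← ∈-choose⁻ (suc k) xs sx j
      = <-irrefl refl (All.lookup px x∈)

  range1-strict : ∀ n → Strict (range1 n)
  range1-strict n = subst Strict (sym (range1≡ n)) (AllPairsₚ.applyUpTo⁺₁ suc n (λ i<j _ → s≤s i<j))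

  ∈-range1⁻ : ∀ n {x} → x ∈ range1 n → 1 ≤ x × x ≤ n
  ∈-range1⁻ (suc n) i with ∈-++⁻ (range1 n) i
  ... | inj₁ j with p , q ← ∈-range1⁻ n j = p , m≤n⇒m≤1+n q
  ... | inj₂ (here refl) = s≤s z≤n , ≤-refl

  ∈-range1⁺ : ∀ n {x} → 1 ≤ x → x ≤ n → x ∈ range1 n
  ∈-range1⁺ zero (s≤s _) ()
  ∈-range1⁺ (suc n) {x} p q with x ≟ suc n
  ... | yes refl = ∈-++⁺ʳ (range1 n) (here refl)
  ... | no ne = ∈-++⁺ˡ (∈-range1⁺ n p (≤-pred (≤∧≢⇒< q ne)))

  -- α ∈ A_l for a permutation whose first l values are W
  record Admissible (l : ℕ) (W α : List ℕ) : Set where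
    constructor admissible
    field
      increasing : Strict α
      positive   : All (1 ≤_) α
      size       : length α ≡ l
      bounded    : ∀ k → cnt k W ≤ cnt k α
  open Admissible

  -- `Aset` draws its candidates from 1, ..., `maxL (wl w l)`; by this bound no sequence below
  -- `wl w l` is lost.
  leAll-bounded : ∀ α β → leAll α β ≡ true → All (_≤ maxL β) α
  leAll-bounded [] [] e = []
  leAll-bounded (a ∷ α) (b ∷ β) e with a ≤ᵇ b in a≤b
  ... | true = ≤-trans (≤ᵇ⇒≤ a b (≡-T a≤b)) (m≤m⊔n b (maxL β)) ∷ All.map (λ p → ≤-trans p (m≤n⊔m b (maxL β))) (leAll-bounded α β e)

  length-wl : ∀ w l → length (wl w l) ≡ l
  length-wl w l = trans (length-sortN (map (app w) (range1 l))) (trans (length-map (app w) (range1 l)) (length-range1 l))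

  ∈-Aset⁺ : ∀ w l {α} → Admissible l (map (app w) (range1 l)) α → α ∈ Aset w l
  ∈-Aset⁺ w l {α} (admissible st po refl bd) = ∈-boolFilter⁺ (λ α → leAll α (wl w l)) (choose (length α) (range1 (maxL (wl w l))))
    (∈-choose⁺ (range1-strict (maxL (wl w l))) st (All.zipWith (λ (p , q) → ∈-range1⁺ (maxL (wl w l)) p q) (po , leAll-bounded α (wl w l) leq))) leq
    where
    leq : leAll α (wl w l) ≡ true
    leq = leAll-complete α (wl w l) (Strict⇒Sorted st) (sortN-sorted (map (app w) (range1 l))) (sym (length-wl w l))
      λ k → subst (_≤ cnt k α) (sym (cnt-sortN k (map (app w) (range1 l)))) (bd k)

  ∈-Aset⁻ : ∀ w l {α} → α ∈ Aset w l → Admissible l (map (app w) (range1 l)) α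
  ∈-Aset⁻ w l {α} i with j , leq ← ∈-boolFilter⁻ (λ α → leAll α (wl w l)) (choose l (range1 (maxL (wl w l)))) i
    with st , ins , len ← ∈-choose⁻ l (range1 (maxL (wl w l))) (range1-strict (maxL (wl w l))) j
    = admissible st (All.map (proj₁ ∘ ∈-range1⁻ (maxL (wl w l))) ins) len
        λ k → subst (_≤ cnt k α) (cnt-sortN k (map (app w) (range1 l))) (proj₂ (leAll-sound α (wl w l) leq) k)

  Aset-unique : ∀ w l → Unique (Aset w l)
  Aset-unique w l = boolFilter-unique _ (choose-unique l (range1 (maxL (wl w l))) (range1-strict (maxL (wl w l))))

  -- A strictly increasing sequence contains k+1 at most once. This is how distinctness of entries
  -- enters the stability under s_i.
  strict-step : ∀ {α} → Strict α → ∀ k → cnt (suc k) α ≤ suc (cnt k α)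
  strict-step [] k = z≤n
  strict-step {a ∷ α} (pa ∷ sa) k with a ≤? k
  ... | yes p = subst₂ (λ u v → u + cnt (suc k) α ≤ suc (v + cnt k α)) (sym (le-yes (m≤n⇒m≤1+n p))) (sym (le-yes p)) (s≤s (strict-step sa k))
  ... | no ¬p = ≤-trans (≤-reflexive (trans (cong (le a (suc k) +_) (cnt-none (suc k) α (All.map (≤-<-trans (≰⇒> ¬p)) pa))) (+-identityʳ _)))
                  (≤-trans (le≤1 a (suc k)) (s≤s z≤n))

open CountingFunctions

-- How A_l(w) changes when w is multiplied by s_i at an ascent.

module AdmissibleSets where

  open import Data.Nat
  open import Data.Nat.Properties
  open import Algebra.Properties.CommutativeSemigroup +-commutativeSemigroup using (interchange)
  open import Data.Bool using (Bool; true; false; _∧_; not)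
  open import Data.Empty using (⊥-elim)
  open import Data.List using (List; []; _∷_; _++_; map; length)
  open import Data.List.Properties using (length-map; map-cong; map-∘; map-++)
  open import Data.List.Membership.Propositional using (_∈_)
  open import Data.List.Membership.Propositional.Properties using (∈-map⁺; ∈-map⁻; ∈-++⁺ˡ; ∈-++⁺ʳ; ∈-++⁻)
  open import Data.List.Membership.Propositional.Properties.WithK using (unique∧set⇒bag)
  open import Data.List.Relation.Binary.BagAndSetEquality using (∼bag⇒↭)
  open import Data.List.Relation.Unary.Any using (here; there)
  open import Data.List.Relation.Unary.All as All using (All; []; _∷_)
  import Data.List.Relation.Unary.All.Properties as Allₚ
  open import Data.List.Relation.Unary.AllPairs as AllPairs using (AllPairs; []; _∷_)
  open import Data.List.Relation.Unary.Unique.Propositional using (Unique)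
  import Data.List.Relation.Unary.Unique.Propositional.Properties as Uniqueₚ
  open import Data.List.Relation.Binary.Permutation.Propositional using (_↭_; ↭-sym; ↭⇒↭ₛ)
  open import Data.List.Relation.Binary.Permutation.Propositional.Properties using (↭-length; map⁺; All-resp-↭)
  import Data.List.Relation.Binary.Permutation.Setoid.Properties as ↭ₛ
  open import Data.Product using (_×_; _,_; proj₁; proj₂)
  open import Data.Sum using (inj₁; inj₂)
  open import Function using (_∘_; mk⇔)
  open import Relation.Nullary using (¬_; yes; no)
  open import Relation.Binary.PropositionalEquality
  open Admissible

  Unique-resp-↭ : ∀ {A : Set} {xs ys : List A} → xs ↭ ys → Unique xs → Unique ys
  Unique-resp-↭ {A} e = ↭ₛ.Unique-resp-↭ (setoid A) (↭⇒↭ₛ e)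

  unique-set-↭ : ∀ {A : Set} {xs ys : List A} → Unique xs → Unique ys →
    (∀ {x} → x ∈ xs → x ∈ ys) → (∀ {x} → x ∈ ys → x ∈ xs) → xs ↭ ys
  unique-set-↭ u v f g = ∼bag⇒↭ (unique∧set⇒bag u v (mk⇔ f g))

  map-unique : ∀ {A B : Set} {P : A → Set} (f : A → B) → (∀ {x y} → P x → P y → f x ≡ f y → x ≡ y) →
    ∀ {xs} → All P xs → Unique xs → Unique (map f xs)
  map-unique f inj [] [] = []
  map-unique f inj (p ∷ ps) (n ∷ u) =
    Allₚ.map⁺ (All.zipWith (λ (q , ne) e → ne (inj p q e)) (ps , n)) ∷ map-unique f inj ps u

  strict-sorted : ∀ {xs} → Sorted xs → Unique xs → Strict xs
  strict-sorted s u = AllPairs.zipWith (λ (p , q) → ≤∧≢⇒< p q) (s , u)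

  sw-injective : ∀ i {x y} → sw i x ≡ sw i y → x ≡ y
  sw-injective i {x} {y} e = trans (sym (sw-involutive i x)) (trans (cong (sw i) e) (sw-involutive i y))

  sα-↭ : ∀ i α → sα i α ↭ map (sw i) α
  sα-↭ i α = subst (sα i α ↭_) (map-cong (swapIdx≗sw i) α) (sortN-↭ (map (swapIdx i) α))

  sα-strict : ∀ i {α} → Strict α → Strict (sα i α)
  sα-strict i {α} st = strict-sorted (sortN-sorted (map (swapIdx i) α))
    (Unique-resp-↭ (↭-sym (sα-↭ i α)) (Uniqueₚ.map⁺ (sw-injective i) (Strict⇒Unique st)))

  length-sα : ∀ i α → length (sα i α) ≡ length α
  length-sα i α = trans (↭-length (sα-↭ i α)) (length-map (sw i) α)

  cnt-sα : ∀ i α k → cnt k (sα i α) ≡ cnt k (map (sw i) α)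
  cnt-sα i α k = cnt-↭ k (sα-↭ i α)

  sα-involutive : ∀ i {α} → Strict α → sα i (sα i α) ≡ α
  sα-involutive i {α} st = sorted-unique (Strict⇒Sorted (sα-strict i (sα-strict i st))) (Strict⇒Sorted st)
    (trans (length-sα i (sα i α)) (length-sα i α))
    λ k → trans (cnt-sα i (sα i α) k) (trans (cnt-↭ k (map⁺ (sw i) (sα-↭ i α)))
      (cong (cnt k) (trans (sym (map-∘ α)) (trans (map-cong (sw-involutive i) α) (Data.List.Properties.map-id α)))))

  sα-positive : ∀ j {α} → All (1 ≤_) α → All (1 ≤_) (sα (suc j) α)
  sα-positive j {α} po = All-resp-↭ (↭-sym (sα-↭ (suc j) α)) (Allₚ.map⁺ (All.map pos po))
    where
    pos : ∀ {x} → 1 ≤ x → 1 ≤ sw (suc j) x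
    pos {suc x} _ = s≤s z≤n

  -- Only the count at j+1 changes, to cnt j α + cnt (2+j) α - cnt (suc j) α; the last hypothesis is
  -- the bound on it, written without subtraction. `V` may differ from `W` so that a sequence
  -- admissible for s_i w can be carried to w.
  sα-admissible : ∀ j {l V W α} → Admissible l V α →
    (∀ k → ¬ k ≡ suc j → cnt k W ≤ cnt k α) → cnt (suc j) W + cnt (suc j) α ≤ cnt j α + cnt (2 + j) α →
    Admissible l W (sα (suc j) α)
  sα-admissible j {l} {V} {W} {α} ad h h₀ = admissible (sα-strict (suc j) (increasing ad)) (sα-positive j (positive ad))
    (trans (length-sα (suc j) α) (size ad)) bd
    where
    bd : ∀ k → cnt k W ≤ cnt k (sα (suc j) α)
    bd k with k ≟ suc j
    ... | no ne = subst (cnt k W ≤_) (sym (trans (cnt-sα (suc j) α k) (cnt-sw (suc j) α k ne))) (h k ne)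
    ... | yes refl = +-cancelʳ-≤ (cnt (suc j) α) _ _
      (subst (cnt (suc j) W + cnt (suc j) α ≤_) (sym (trans (cong (_+ cnt (suc j) α) (cnt-sα (suc j) α (suc j))) (cnt-sw-at j α))) h₀)

  -- Let a, b, c and x, y, z be the counts of W and α at i-1, i, i+1; the claim bounds the reflected
  -- count x + z - y from below by b. If y < z, it is at least x + 1 ≥ y ≥ b. If y = z, it is x, and
  -- b > x would give 2b > x + (x + 1) ≥ a + c, against convexity.
  convex-exchange : ∀ {a b c x y z} → a ≤ x → b ≤ y → c ≤ z → y ≤ z → y ≤ suc x → b + b ≤ a + c → b + y ≤ x + z
  convex-exchange {a} {b} {c} {x} {y} {z} ax by cz yz yx conv with z ≤? y
  ... | no ¬p = ≤-trans (+-mono-≤ (≤-trans by yx) ≤-refl) (≤-trans (≤-reflexive (sym (+-suc x y))) (+-monoʳ-≤ x (≰⇒> ¬p)))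
  ... | yes p with b ≤? x
  ... | yes q = +-mono-≤ q yz
  ... | no ¬q = ⊥-elim (<-irrefl refl (begin-strict
    x + suc x ≡⟨ +-suc x x ⟩
    suc x + x <⟨ +-mono-≤-< (≰⇒> ¬q) (≰⇒> ¬q) ⟩
    b + b     ≤⟨ conv ⟩
    a + c     ≤⟨ +-mono-≤ ax (≤-trans cz (≤-trans p yx)) ⟩
    x + suc x ∎))
    where open ≤-Reasoning

  sα-closed : ∀ j {l W α} → cnt (suc j) W + cnt (suc j) W ≤ cnt j W + cnt (2 + j) W →
    Admissible l W α → Admissible l W (sα (suc j) α)
  sα-closed j {α = α} conv ad = sα-admissible j ad (λ k _ → bounded ad k)
    (convex-exchange (bounded ad j) (bounded ad (suc j)) (bounded ad (2 + j))
      (cnt-mono α (suc j)) (strict-step (increasing ad) j) conv)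

  eq : ℕ → ℕ → ℕ
  eq zero zero = 1
  eq zero (suc y) = 0
  eq (suc x) zero = 0
  eq (suc x) (suc y) = eq x y

  eq-refl : ∀ x → eq x x ≡ 1
  eq-refl zero = refl
  eq-refl (suc x) = eq-refl x

  eq-≢ : ∀ x y → ¬ x ≡ y → eq x y ≡ 0
  eq-≢ zero zero ne = ⊥-elim (ne refl)
  eq-≢ zero (suc y) ne = refl
  eq-≢ (suc x) zero ne = refl
  eq-≢ (suc x) (suc y) ne = eq-≢ x y (ne ∘ cong suc)

  eq-cong : ∀ {x y a b} → (x ≡ y → a ≡ b) → (a ≡ b → x ≡ y) → eq x y ≡ eq a b
  eq-cong {x} {y} {a} {b} f g with x ≟ y
  ... | yes refl with refl ← f refl = trans (eq-refl x) (sym (eq-refl a))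
  ... | no ne = trans (eq-≢ x y ne) (sym (eq-≢ a b (ne ∘ g)))

  le-suc : ∀ p l → le p (suc l) ≡ le p l + eq (suc l) p
  le-suc zero l = refl
  le-suc (suc zero) zero = refl
  le-suc (suc (suc p)) zero = refl
  le-suc (suc p) (suc l) = le-suc p l

  le-sw-eq : ∀ i x → le (sw i x) i + eq x i ≡ le x i + eq x (suc i)
  le-sw-eq zero zero = refl
  le-sw-eq zero (suc zero) = refl
  le-sw-eq zero (suc (suc x)) = refl
  le-sw-eq (suc i) zero = refl
  le-sw-eq (suc i) (suc x) = le-sw-eq i x

  cnt-++ : ∀ k xs ys → cnt k (xs ++ ys) ≡ cnt k xs + cnt k ys
  cnt-++ k [] ys = refl
  cnt-++ k (x ∷ xs) ys = trans (cong (le x k +_) (cnt-++ k xs ys)) (sym (+-assoc (le x k) _ _))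

  firstValues : List ℕ → ℕ → List ℕ
  firstValues r l = map (fwd r) (range1 l)

  firstValues-∷ : ∀ j r l → firstValues (j ∷ r) l ≡ map (sw (suc j)) (firstValues r l)
  firstValues-∷ j r l = map-∘ (range1 l)

  cnt-firstValues-suc : ∀ r k l → cnt k (firstValues r (suc l)) ≡ cnt k (firstValues r l) + le (fwd r (suc l)) k
  cnt-firstValues-suc r k l = trans (cong (cnt k) (map-++ (fwd r) (range1 l) (suc l ∷ [])))
    (trans (cnt-++ k (firstValues r l) _) (cong (cnt k (firstValues r l) +_) (+-identityʳ _)))

  inv-positive : ∀ r k → 1 ≤ k → 1 ≤ inv r k
  inv-positive r k p with inv r k in e
  ... | suc _ = s≤s z≤n
  ... | zero = ⊥-elim (<-irrefl (sym (trans (sym (fwd-inv r k)) (trans (cong (fwd r) e) (fwd-zero r)))) p)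

  eq-fwd : ∀ r l k → eq (fwd r l) k ≡ eq l (inv r k)
  eq-fwd r l k = eq-cong (λ e → trans (sym (inv-fwd r l)) (cong (inv r) e)) (λ e → trans (cong (fwd r) e) (fwd-inv r k))

  -- Passing from w to s_i w, the value i at position `inv r (suc j)` stops counting at the
  -- threshold i = j + 1, and the value i+1 at position `inv r (2 + j)` starts to count. Each
  -- matters only if its position is among the first l.
  cnt-firstValues : ∀ j r l → cnt (suc j) (firstValues (j ∷ r) l) + le (inv r (suc j)) l ≡
                              cnt (suc j) (firstValues r l) + le (inv r (2 + j)) l
  cnt-firstValues j r zero = trans (le-no (inv-positive r (suc j) (s≤s z≤n))) (sym (le-no (inv-positive r (2 + j) (s≤s z≤n))))
  cnt-firstValues j r (suc l) = begin
    cnt i (firstValues (j ∷ r) (suc l)) + le p (suc l)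
      ≡⟨ cong₂ _+_ (cnt-firstValues-suc (j ∷ r) i l) (le-suc p l) ⟩
    (cnt i (firstValues (j ∷ r) l) + le (sw i x) i) + (le p l + eq (suc l) p)
      ≡⟨ interchange (cnt i (firstValues (j ∷ r) l)) (le (sw i x) i) (le p l) (eq (suc l) p) ⟩
    (cnt i (firstValues (j ∷ r) l) + le p l) + (le (sw i x) i + eq (suc l) p)
      ≡⟨ cong₂ _+_ (cnt-firstValues j r l) (trans (cong (le (sw i x) i +_) (sym (eq-fwd r (suc l) i)))
           (trans (le-sw-eq i x) (cong (le x i +_) (eq-fwd r (suc l) (suc i))))) ⟩
    (cnt i (firstValues r l) + le q l) + (le x i + eq (suc l) q)
      ≡⟨ interchange (cnt i (firstValues r l)) (le q l) (le x i) (eq (suc l) q) ⟩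
    (cnt i (firstValues r l) + le x i) + (le q l + eq (suc l) q)
      ≡⟨ cong₂ _+_ (cnt-firstValues-suc r i l) (le-suc q l) ⟨
    cnt i (firstValues r (suc l)) + le q (suc l) ∎
    where
    open ≡-Reasoning
    i = suc j
    x = fwd r (suc l)
    p = inv r i
    q = inv r (suc i)

  module Ascent (j : ℕ) (r : List ℕ) (asc : inv r (suc j) < inv r (2 + j)) (l : ℕ) where

    W W′ : List ℕ
    W = firstValues r l
    W′ = firstValues (j ∷ r) l

    -- At an ascent i stands before i+1 in w, so the first l values contain i+1 only if they contain
    -- i.
    drop : cnt (suc j) W′ ≤ cnt (suc j) W
    drop = +-cancelʳ-≤ (le (inv r (suc j)) l) _ _ (≤-trans (≤-reflexive (cnt-firstValues j r l))
      (+-monoʳ-≤ (cnt (suc j) W) (le-anti l (<⇒≤ asc))))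

    drop≤1 : cnt (suc j) W ≤ suc (cnt (suc j) W′)
    drop≤1 = ≤-trans (m≤m+n _ (le (inv r (2 + j)) l)) (≤-trans (≤-reflexive (sym (cnt-firstValues j r l)))
      (≤-trans (+-monoʳ-≤ (cnt (suc j) W′) (le≤1 (inv r (suc j)) l)) (≤-reflexive (+-comm _ 1))))

    same-elsewhere : ∀ k → ¬ k ≡ suc j → cnt k W′ ≡ cnt k W
    same-elsewhere k ne = trans (cong (cnt k) (firstValues-∷ j r l)) (cnt-sw (suc j) W k ne)

    sum : cnt (suc j) W′ + cnt (suc j) W ≡ cnt j W + cnt (2 + j) W
    sum = trans (cong (λ V → cnt (suc j) V + cnt (suc j) W) (firstValues-∷ j r l)) (cnt-sw-at j W)

    -- The counts of W and W′ at i are reflections of each other, and W′ has the smaller one, hence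
    -- one below the mean of the neighbouring counts.
    convex : cnt (suc j) W′ + cnt (suc j) W′ ≤ cnt j W′ + cnt (2 + j) W′
    convex = ≤-trans (+-monoʳ-≤ (cnt (suc j) W′) drop) (≤-reflexive (trans sum
      (cong₂ _+_ (sym (same-elsewhere j suc≢)) (sym (same-elsewhere (2 + j) (suc≢ ∘ sym))))))

    raise : ∀ {α} → Admissible l W α → Admissible l W′ α
    raise {α} ad = admissible (increasing ad) (positive ad) (size ad) bd
      where
      bd : ∀ k → cnt k W′ ≤ cnt k α
      bd k with k ≟ suc j
      ... | yes refl = ≤-trans drop (bounded ad k)
      ... | no ne = ≤-trans (≤-reflexive (same-elsewhere k ne)) (bounded ad k)

    closed : ∀ {α} → Admissible l W′ α → Admissible l W′ (sα (suc j) α)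
    closed = sα-closed j convex

    -- The conditions for W and W′ differ only at i, so β fails there. As the two counts differ by
    -- at most 1, the count of β at i is at most that of W′; reflecting reverses this inequality and
    -- turns the count of W′ into that of W.
    lower : ∀ {β} → Admissible l W′ β → ¬ Admissible l W β → Admissible l W (sα (suc j) β)
    lower {β} ad ¬ad = sα-admissible j ad elsewhere (begin
      cnt (suc j) W + cnt (suc j) β  ≤⟨ +-monoʳ-≤ (cnt (suc j) W) (≤-pred (≤-trans small drop≤1)) ⟩
      cnt (suc j) W + cnt (suc j) W′ ≡⟨ trans (+-comm (cnt (suc j) W) _) sum ⟩
      cnt j W + cnt (2 + j) W        ≤⟨ +-mono-≤ (elsewhere j suc≢) (elsewhere (2 + j) (suc≢ ∘ sym)) ⟩
      cnt j β + cnt (2 + j) β        ∎)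
      where
      open ≤-Reasoning
      elsewhere : ∀ k → ¬ k ≡ suc j → cnt k W ≤ cnt k β
      elsewhere k ne = ≤-trans (≤-reflexive (sym (same-elsewhere k ne))) (bounded ad k)
      bd : cnt (suc j) W ≤ cnt (suc j) β → ∀ k → cnt k W ≤ cnt k β
      bd h k with k ≟ suc j
      ... | yes refl = h
      ... | no ne = elsewhere k ne
      small : cnt (suc j) β < cnt (suc j) W
      small = ≰⇒> λ h → ¬ad (admissible (increasing ad) (positive ad) (size ad) (bd h))

    -- Once the first l values contain both i and i+1, exchanging them does not change the counts,
    -- so W inherits the convexity of W′.
    stable : inv r (suc j) ≤ l → inv r (2 + j) ≤ l → ∀ {α} → Admissible l W α → Admissible l W (sα (suc j) α)
    stable p≤l q≤l = sα-closed j (≤-reflexive (trans (cong (_+ cnt (suc j) W) (sym counts-agree)) sum))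
      where
      counts-agree : cnt (suc j) W′ ≡ cnt (suc j) W
      counts-agree = +-cancelʳ-≡ 1 _ _ (trans (cong (cnt (suc j) W′ +_) (sym (le-yes p≤l)))
        (trans (cnt-firstValues j r l) (cong (cnt (suc j) W +_) (le-yes q≤l))))

  eqL-sound : ∀ α β → eqL α β ≡ true → α ≡ β
  eqL-sound [] [] _ = refl
  eqL-sound (a ∷ α) (b ∷ β) e with a ≡ᵇ b in a≡b
  ... | true = cong₂ _∷_ (≡ᵇ⇒≡ a b (≡-T a≡b)) (eqL-sound α β e)

  eqL-refl : ∀ α → eqL α α ≡ true
  eqL-refl [] = refl
  eqL-refl (a ∷ α) = trans (cong (_∧ eqL α α) (T-≡ (≡⇒≡ᵇ a a refl))) (eqL-refl α)

  anyB-sound : ∀ α xs → anyB (eqL α) xs ≡ true → α ∈ xs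
  anyB-sound α (x ∷ xs) e with eqL α x in f
  ... | true = here (eqL-sound α x f)
  ... | false = there (anyB-sound α xs e)

  anyB-complete : ∀ α xs → α ∈ xs → anyB (eqL α) xs ≡ true
  anyB-complete α (x ∷ xs) (here refl) rewrite eqL-refl α = refl
  anyB-complete α (x ∷ xs) (there i) with eqL α x
  ... | true = refl
  ... | false = anyB-complete α xs i

  not-true : ∀ {b} → not b ≡ true → ¬ b ≡ true
  not-true {false} _ ()

  Represents : Perm → List ℕ → Set
  Represents w r = ∀ k → app w k ≡ fwd r k

  module AscentSets (w w′ : Perm) (j : ℕ) (r : List ℕ) (repr : Represents w r) (repr′ : Represents w′ (j ∷ r))
                    (asc : inv r (suc j) < inv r (2 + j)) (l : ℕ) where

    open Ascent j r asc l

    out : ∀ {α} → α ∈ Aset w l → Admissible l W α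
    out i = subst (λ V → Admissible l V _) (map-cong repr (range1 l)) (∈-Aset⁻ w l i)

    into : ∀ {α} → Admissible l W α → α ∈ Aset w l
    into ad = ∈-Aset⁺ w l (subst (λ V → Admissible l V _) (sym (map-cong repr (range1 l))) ad)

    out′ : ∀ {α} → α ∈ Aset w′ l → Admissible l W′ α
    out′ i = subst (λ V → Admissible l V _) (map-cong repr′ (range1 l)) (∈-Aset⁻ w′ l i)

    into′ : ∀ {α} → Admissible l W′ α → α ∈ Aset w′ l
    into′ ad = ∈-Aset⁺ w′ l (subst (λ V → Admissible l V _) (sym (map-cong repr′ (range1 l))) ad)

    i₀ : ℕ
    i₀ = suc j

    leaves : List ℕ → Bool
    leaves α = not (anyB (eqL (sα i₀ α)) (Aset w l))

    ∈-AsetI⁻ : ∀ {α} → α ∈ AsetI w l i₀ → α ∈ Aset w l × ¬ sα i₀ α ∈ Aset w l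
    ∈-AsetI⁻ {α} i with k , e ← ∈-boolFilter⁻ leaves (Aset w l) i =
      k , λ m → not-true e (anyB-complete (sα i₀ α) (Aset w l) m)

    ∈-AsetI⁺ : ∀ {α} → α ∈ Aset w l → ¬ sα i₀ α ∈ Aset w l → α ∈ AsetI w l i₀
    ∈-AsetI⁺ {α} i n = ∈-boolFilter⁺ leaves (Aset w l) i lem
      where
      lem : leaves α ≡ true
      lem with anyB (eqL (sα i₀ α)) (Aset w l) in e
      ... | true = ⊥-elim (n (anyB-sound (sα i₀ α) (Aset w l) e))
      ... | false = refl

    sα-inj : ∀ {α β} → Strict α → Strict β → sα i₀ α ≡ sα i₀ β → α ≡ β
    sα-inj sa sb e = trans (sym (sα-involutive i₀ sa)) (trans (cong (sα i₀) e) (sα-involutive i₀ sb))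

    sα-unique : ∀ {αs} → (∀ {α} → α ∈ αs → Strict α) → Unique αs → Unique (map (sα i₀) αs)
    sα-unique st u = map-unique {P = Strict} (sα i₀) sα-inj (All.tabulate st) u

    Aset-grows : Aset w′ l ↭ Aset w l ++ map (sα i₀) (AsetI w l i₀)
    Aset-grows = unique-set-↭ (Aset-unique w′ l)
      (Uniqueₚ.++⁺ (Aset-unique w l) (sα-unique (λ i → increasing (out (proj₁ (∈-AsetI⁻ i)))) (boolFilter-unique leaves (Aset-unique w l))) disjoint)
      to from
      where
      disjoint : ∀ {α} → ¬ (α ∈ Aset w l × α ∈ map (sα i₀) (AsetI w l i₀))
      disjoint (i , k) with β , m , refl ← ∈-map⁻ (sα i₀) k = proj₂ (∈-AsetI⁻ m) i
      to : ∀ {α} → α ∈ Aset w′ l → α ∈ Aset w l ++ map (sα i₀) (AsetI w l i₀)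
      to {α} i with anyB (eqL α) (Aset w l) in e
      ... | true = ∈-++⁺ˡ (anyB-sound α (Aset w l) e)
      ... | false = ∈-++⁺ʳ (Aset w l) (subst (_∈ map (sα i₀) (AsetI w l i₀)) back
          (∈-map⁺ (sα i₀) (∈-AsetI⁺ (into (lower (out′ i) (λ ad → α∉ (into ad)))) (λ m → α∉ (subst (_∈ Aset w l) back m)))))
        where
        back : sα i₀ (sα i₀ α) ≡ α
        back = sα-involutive i₀ (increasing (out′ i))
        α∉ : ¬ α ∈ Aset w l
        α∉ m with trans (sym e) (anyB-complete α (Aset w l) m)
        ... | ()
      from : ∀ {α} → α ∈ Aset w l ++ map (sα i₀) (AsetI w l i₀) → α ∈ Aset w′ l
      from {α} i with ∈-++⁻ (Aset w l) i
      ... | inj₁ k = into′ (raise (out k))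
      ... | inj₂ k with β , m , refl ← ∈-map⁻ (sα i₀) k = into′ (closed (raise (out (proj₁ (∈-AsetI⁻ m)))))

    Aset-symmetric : map (sα i₀) (Aset w′ l) ↭ Aset w′ l
    Aset-symmetric = unique-set-↭ (sα-unique (increasing ∘ out′) (Aset-unique w′ l)) (Aset-unique w′ l) to from
      where
      to : ∀ {α} → α ∈ map (sα i₀) (Aset w′ l) → α ∈ Aset w′ l
      to k with β , m , refl ← ∈-map⁻ (sα i₀) k = into′ (closed (out′ m))
      from : ∀ {α} → α ∈ Aset w′ l → α ∈ map (sα i₀) (Aset w′ l)
      from {α} i = subst (_∈ map (sα i₀) (Aset w′ l)) (sα-involutive i₀ (increasing (out′ i)))
        (∈-map⁺ (sα i₀) (into′ (closed (out′ i))))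

    -- This is what makes the product defining N_{w,i} finite.
    AsetI-empty : inv r (suc j) ≤ l → inv r (2 + j) ≤ l → AsetI w l i₀ ≡ []
    AsetI-empty p q = none λ i → proj₂ (∈-AsetI⁻ i) (into (stable p q (out (proj₁ (∈-AsetI⁻ i)))))
      where
      none : ∀ {αs : List (List ℕ)} → (∀ {α} → ¬ α ∈ αs) → αs ≡ []
      none {[]} h = refl
      none {α ∷ αs} h = ⊥-elim (h (here refl))

  sw-bound : ∀ i k L → suc i ≤ L → k ≤ L → sw i k ≤ L
  sw-bound zero zero L p q = p
  sw-bound zero (suc zero) L p q = z≤n
  sw-bound zero (suc (suc k)) L p q = q
  sw-bound (suc i) zero L p q = z≤n
  sw-bound (suc i) (suc k) (suc L) (s≤s p) (s≤s q) = s≤s (sw-bound i k L p q)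

  -- The letter j moves only j+1 and j+2, so these are the words in the generators of S_L.
  Below : ℕ → List ℕ → Set
  Below L = All (λ j → 2 + j ≤ L)

  inv-bound : ∀ {L} r → Below L r → ∀ k → k ≤ L → inv r k ≤ L
  inv-bound [] [] k p = p
  inv-bound {L} (j ∷ r) (q ∷ b) k p = inv-bound r b (sw (suc j) k) (sw-bound (suc j) k L q p)

  fwd-bound : ∀ {L} r → Below L r → ∀ k → k ≤ L → fwd r k ≤ L
  fwd-bound [] [] k p = p
  fwd-bound {L} (j ∷ r) (q ∷ b) k p = sw-bound (suc j) (fwd r k) L q (fwd-bound r b k p)

  fwd-fixes : ∀ {L} r → Below L r → ∀ k → L < k → fwd r k ≡ k
  fwd-fixes [] [] k p = refl
  fwd-fixes (j ∷ r) (q ∷ b) k p = trans (cong (sw (suc j)) (fwd-fixes r b k p)) (sw-above (suc j) k (≤-<-trans q p))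

open AdmissibleSets

-- The denominators D_w and the recursion for P_w.

module Denominators where

  open import Data.Nat
  open import Data.Nat.Properties
  open import Data.Integer using (ℤ; +_; -_)
  import Data.Integer as ℤ
  open import Data.List using (List; []; _∷_; _++_; map; length; concatMap)
  open import Data.List.Properties using (length-map; map-∘; ++-identityʳ)
  open import Data.List.Relation.Unary.All as All using (All; []; _∷_)
  open import Data.List.Relation.Binary.Permutation.Propositional using (_↭_; prep; swap)
  import Data.List.Relation.Binary.Permutation.Propositional as ↭
  open import Data.Product using (_,_)
  open import Function using (_∘_)
  open import Relation.Nullary using (yes; no)
  open import Relation.Binary.PropositionalEquality

  permR : List ℕ → Perm
  permR [] = []
  permR (j ∷ r) = sMul (suc j) (permR r)

  length-sMul : ∀ i w → length (sMul i w) ≡ length w ⊔ suc i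
  length-sMul i w = trans (length-map (swapIdx i) (map (app w) (range1 (length w ⊔ suc i)))) (length-mk (length w ⊔ suc i) (app w))

  app-beyond : ∀ w k → length w < k → app w k ≡ k
  app-beyond w (suc k) (s≤s p) = look-beyond w k (suc k) p

  app-sMul : ∀ j w k → app (sMul (suc j) w) k ≡ sw (suc j) (app w k)
  app-sMul j w zero = refl
  app-sMul j w (suc k) with k <? length w ⊔ (2 + j)
  ... | yes p = trans (cong (λ z → look z k (suc k)) (trans (sym (map-∘ (range1 (length w ⊔ (2 + j))))) (map-range1 (swapIdx (suc j) ∘ app w) (length w ⊔ (2 + j)))))
    (trans (look-applyUpTo _ (length w ⊔ (2 + j)) k (suc k) p) (swapIdx≗sw (suc j) (app w (suc k))))
  ... | no ¬p = trans (app-beyond (sMul (suc j) w) (suc k) (s≤s (subst (_≤ k) (sym (length-sMul (suc j) w)) (≮⇒≥ ¬p))))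
    (sym (trans (cong (sw (suc j)) (app-beyond w (suc k) (s≤s (≤-trans (m≤m⊔n (length w) (2 + j)) (≮⇒≥ ¬p)))))
                (sw-above (suc j) (suc k) (s≤s (≤-trans (m≤n⊔m (length w) (2 + j)) (≮⇒≥ ¬p))))))

  permR-represents : ∀ r → Represents (permR r) r
  permR-represents [] zero = refl
  permR-represents [] (suc k) = refl
  permR-represents (j ∷ r) k = trans (app-sMul j (permR r) k) (cong (sw (suc j)) (permR-represents r k))

  Below-mono : ∀ {m n r} → m ≤ n → Below m r → Below n r
  Below-mono p = All.map (λ q → ≤-trans q p)

  Below-length : ∀ r → Below (length (permR r)) r
  Below-length [] = []
  Below-length (j ∷ r) = subst (λ n → Below n (j ∷ r)) (sym (length-sMul (suc j) (permR r)))
    (m≤n⊔m (length (permR r)) (2 + j) ∷ Below-mono (m≤m⊔n (length (permR r)) (2 + j)) (Below-length r))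

  length-permR : ∀ {n} r → Below n r → length (permR r) ≤ n
  length-permR [] b = z≤n
  length-permR (j ∷ r) (q ∷ b) = subst (_≤ _) (sym (length-sMul (suc j) (permR r))) (⊔-lub (length-permR r b) q)

  PR : List ℕ → Poly
  PR [] = oneP
  PR (j ∷ r) = π (suc j) (PR r *P Nwi (permR r) (suc j))

  monoOf-↭ : ∀ {α β} → α ↭ β → monoOf α ≐ monoOf β
  monoOf-↭ ↭.refl = ≐-refl
  monoOf-↭ (prep x e) = addE-cong {a = unitE x} ≐-refl (monoOf-↭ e)
  monoOf-↭ (swap {α} {β} x y e) = ≐-trans (≐-sym (addE-assoc (unitE x) (unitE y) (monoOf α)))
    (≐-trans (addE-cong (addE-comm (unitE x) (unitE y)) (monoOf-↭ e)) (addE-assoc (unitE y) (unitE x) (monoOf β)))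
  monoOf-↭ (↭.trans e f) = ≐-trans (monoOf-↭ e) (monoOf-↭ f)

  monoOf-sw : ∀ j α → monoOf (map (sw (suc j)) α) ≐ swapE j (monoOf α)
  monoOf-sw j [] = ≐-sym (swapE-[] j)
  monoOf-sw j (x ∷ α) = ≐-trans (addE-cong (unit x) (monoOf-sw j α)) (≐-sym (swapE-add j (unitE x) (monoOf α)))
    where
    unit : ∀ x → unitE (sw (suc j) x) ≐ swapE j (unitE x)
    unit zero = ≐-sym (swapE-[] j)
    unit (suc m) = ≐-sym (swapE-unit j m)

  monoOf-sα : ∀ j α → monoOf (sα (suc j) α) ≐ swapE j (monoOf α)
  monoOf-sα j α = ≐-trans (monoOf-↭ (sα-↭ (suc j) α)) (monoOf-sw j α)

  concatMap-range1-empty : ∀ {A : Set} (f : ℕ → List A) m d → (∀ l → m < l → f l ≡ []) →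
    concatMap f (range1 (d + m)) ≡ concatMap f (range1 m)
  concatMap-range1-empty f m zero h = refl
  concatMap-range1-empty f m (suc d) h = trans (concatMap-range1-suc f (d + m))
    (trans (cong (concatMap f (range1 (d + m)) ++_) (h (suc (d + m)) (s≤s (m≤n+m m d))))
    (trans (++-identityʳ _) (concatMap-range1-empty f m d h)))

  factors : Perm → ℕ → List Poly
  factors w l = map (λ α → factor α l) (Aset w l)

  newFactors : Perm → ℕ → ℕ → List Poly
  newFactors w i l = map (λ α → factor (sα i α) l) (AsetI w l i)

  -- `Nwi` stops at a layer depending on w and i, the denominators at n. Multiplying them layer by
  -- layer requires a common range, and the layers in between are empty.
  Nwi-range : ∀ j r n → inv r (suc j) < inv r (2 + j) → Below n (j ∷ r) →
    prodP (concatMap (newFactors (permR r) (suc j)) (range1 n)) ≡ Nwi (permR r) (suc j)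
  Nwi-range j r n asc (q ∷ b) = cong prodP (trans (cong (λ z → concatMap f (range1 z)) (sym (m∸n+n≡m L≤n)))
    (concatMap-range1-empty f L (n ∸ L) empty))
    where
    f = newFactors (permR r) (suc j)
    L = length (permR r) ⊔ (2 + j)
    L≤n : L ≤ n
    L≤n = ⊔-lub (length-permR r b) q
    bL : Below L r
    bL = Below-mono (m≤m⊔n (length (permR r)) (2 + j)) (Below-length r)
    2+j≤L : 2 + j ≤ L
    2+j≤L = m≤n⊔m (length (permR r)) (2 + j)
    empty : ∀ l → L < l → f l ≡ []
    empty l L<l = cong (map (λ α → factor (sα (suc j) α) l)) (AscentSets.AsetI-empty (permR r) (permR (j ∷ r)) j r
      (permR-represents r) (permR-represents (j ∷ r)) asc l
      (≤-trans (inv-bound r bL (suc j) (<⇒≤ 2+j≤L)) (<⇒≤ L<l)) (≤-trans (inv-bound r bL (2 + j) 2+j≤L) (<⇒≤ L<l)))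

  module Induction (μ : Exps) where

    open Modulo μ
    open Demazure μ

    swapP-factor : ∀ j α l → swapP j (factor α l) ≋ factor (sα (suc j) α) l
    swapP-factor j α l = tests λ t → cong₂ (λ u v → + 1 ℤ.* u ℤ.+ (- + 1 ℤ.* v ℤ.+ + 0))
      (fcong t (swapE-[] j) ≐-refl) (fcong t (≐-sym (monoOf-sα j α)) ≐-refl)

    Dfin-grows : ∀ j r n → inv r (suc j) < inv r (2 + j) → Below n (j ∷ r) →
      Dfin (permR r) n *P Nwi (permR r) (suc j) ≋ Dfin (permR (j ∷ r)) n
    Dfin-grows j r n asc b = subst (λ N → Dfin (permR r) n *P N ≋ Dfin (permR (j ∷ r)) n) (Nwi-range j r n asc b)
      (layers-* {f = factors (permR r)} {g = newFactors (permR r) (suc j)} {h = factors (permR (j ∷ r))}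
        (λ l → prod-grow (λ α → factor α l) (sα (suc j)) {as = Aset (permR r) l} {bs = AsetI (permR r) l (suc j)}
          (AscentSets.Aset-grows (permR r) (permR (j ∷ r)) j r (permR-represents r) (permR-represents (j ∷ r)) asc l)) n)

    Dfin-symmetric : ∀ j r n → inv r (suc j) < inv r (2 + j) → swapP j (Dfin (permR (j ∷ r)) n) ≋ Dfin (permR (j ∷ r)) n
    Dfin-symmetric j r n asc = s-layers j {f = factors (permR (j ∷ r))}
      (λ l → s-prod-stable j (λ α → factor α l) (sα (suc j)) (λ α → swapP-factor j α l) {as = Aset (permR (j ∷ r)) l}
        (AscentSets.Aset-symmetric (permR r) (permR (j ∷ r)) j r (permR-represents r) (permR-represents (j ∷ r)) asc l)) n

    -- The induction over the letters uses the series at the identity only as an inverse `F` of the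
    -- denominator there.
    ϖ*-Dfin : ∀ F n → F *P Dfin [] n ≋ oneP → ∀ r → Asc r → Below n r → ϖ* r F *P Dfin (permR r) n ≋ PR r
    ϖ*-Dfin F n base [] _ _ = base
    ϖ*-Dfin F n base (j ∷ r) (asc , as) (q ∷ b) =
      ϖ-clear j {F = ϖ* r F} {D = Dfin (permR r) n} {P = PR r} {N = Nwi (permR r) (suc j)} {D′ = Dfin (permR (j ∷ r)) n}
        (ϖ*-Dfin F n base r as b) (Dfin-grows j r n asc (q ∷ b)) (Dfin-symmetric j r n asc)

open Denominators

-- The base case: the series and the denominator of the identity.

module IdentityPermutation where

  open import Data.Nat
  open import Data.Nat.Properties
  open import Data.Integer using (ℤ; +_; -_)
  import Data.Integer as ℤ
  import Data.Integer.Properties as ℤₚ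
  open import Data.Integer.Solver using () renaming (module +-*-Solver to ℤ-Solver)
  open import Data.Bool using (Bool; true; false; if_then_else_; _∧_)
  open import Data.Empty using (⊥)
  open import Data.Unit using (⊤; tt)
  open import Data.List using (List; []; _∷_; _++_; map; length; concatMap; upTo; replicate)
  open import Data.List.Properties using (map-cong; map-id; length-replicate)
  open import Data.List.Membership.Propositional using (_∈_)
  open import Data.List.Membership.Propositional.Properties using (∈-map⁺; ∈-map⁻; ∈-++⁺ˡ; ∈-++⁺ʳ; ∈-++⁻; ∈-upTo⁺; ∈-upTo⁻)
  open import Data.List.Relation.Unary.Any using (here; there)
  open import Data.List.Relation.Unary.All as All using (All; []; _∷_)
  open import Data.List.Relation.Unary.AllPairs as AllPairs using ([]; _∷_)
  open import Data.List.Relation.Unary.Unique.Propositional using (Unique)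
  import Data.List.Relation.Unary.Unique.Propositional.Properties as Uniqueₚ
  open import Data.List.Relation.Binary.Pointwise as Pointwise using (Pointwise; []; _∷_; Pointwise-length)
  open import Data.List.Relation.Binary.Permutation.Propositional using (_↭_; prep; swap)
  import Data.List.Relation.Binary.Permutation.Propositional as ↭
  open import Data.Product using (_×_; _,_; proj₁; proj₂; ∃)
  open import Data.Sum using (inj₁; inj₂)
  open import Function using (_∘_)
  open import Relation.Nullary using (¬_; yes; no)
  open import Relation.Binary.Definitions using (tri<; tri≈; tri>)
  open import Relation.Binary.PropositionalEquality

  app-[] : ∀ k → app [] k ≡ k
  app-[] zero = refl
  app-[] (suc k) = refl

  maxL-++ : ∀ xs y → maxL (xs ++ y ∷ []) ≡ maxL xs ⊔ y
  maxL-++ [] y = ⊔-identityʳ y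
  maxL-++ (x ∷ xs) y = trans (cong (x ⊔_) (maxL-++ xs y)) (sym (⊔-assoc x (maxL xs) y))

  maxL-range1 : ∀ l → maxL (range1 l) ≡ l
  maxL-range1 zero = refl
  maxL-range1 (suc l) = trans (maxL-++ (range1 l) (suc l)) (trans (cong (_⊔ suc l) (maxL-range1 l)) (m≤n⇒m⊔n≡n (n≤1+n l)))

  choose-none : ∀ k xs → length xs < k → choose k xs ≡ []
  choose-none (suc k) [] p = refl
  choose-none (suc k) (x ∷ xs) (s≤s p) = cong₂ _++_ (cong (map (x ∷_)) (choose-none k xs p)) (choose-none (suc k) xs (m≤n⇒m≤1+n p))

  choose-all : ∀ xs → choose (length xs) xs ≡ xs ∷ []
  choose-all [] = refl
  choose-all (x ∷ xs) = cong₂ _++_ (cong (map (x ∷_)) (choose-all xs)) (choose-none (suc (length xs)) xs ≤-refl)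

  leAll-refl : ∀ α → leAll α α ≡ true
  leAll-refl [] = refl
  leAll-refl (a ∷ α) = trans (cong (_∧ leAll α α) (T-≡ (≤⇒≤ᵇ (≤-refl {a})))) (leAll-refl α)

  wl-[] : ∀ l → wl [] l ≡ range1 l
  wl-[] l = trans (cong sortN (trans (map-cong app-[] (range1 l)) (map-id (range1 l))))
    (sorted-unique (sortN-sorted (range1 l)) (Strict⇒Sorted (range1-strict l)) (length-sortN (range1 l)) (λ k → cnt-sortN k (range1 l)))

  -- The largest entry of `wl [] l` is l, and 1, ..., l has just one subsequence of length l.
  Aset-[] : ∀ l → Aset [] l ≡ range1 l ∷ []
  Aset-[] l = trans (cong₂ (λ v xs → boolFilter (λ α → leAll α v) xs) (wl-[] l)
      (trans (cong (λ z → choose l (range1 z)) (trans (cong maxL (wl-[] l)) (maxL-range1 l)))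
        (trans (cong (λ z → choose z (range1 l)) (sym (length-range1 l))) (choose-all (range1 l)))))
    (cong (λ b → if b then range1 l ∷ [] else []) (leAll-refl (range1 l)))

  monoOf-++ : ∀ α β → monoOf (α ++ β) ≐ addE (monoOf α) (monoOf β)
  monoOf-++ [] β = ≐-refl
  monoOf-++ (x ∷ α) β = ≐-trans (addE-cong {a = unitE x} ≐-refl (monoOf-++ α β)) (≐-sym (addE-assoc (unitE x) (monoOf α) (monoOf β)))

  getE-Texp : ∀ n k → k < n → getE (Texp n) (suc k) ≡ 1
  getE-Texp (suc n) zero p = refl
  getE-Texp (suc n) (suc k) (s≤s p) = getE-Texp n k p

  getE-Texp-beyond : ∀ n k → n < k → getE (Texp n) k ≡ 0
  getE-Texp-beyond n k p = getE-beyond (Texp n) k (subst (_< k) (sym (length-replicate n)) p)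

  Texp-suc : ∀ n → Texp (suc n) ≐ addE (Texp n) (unitE (suc n))
  Texp-suc n = pointwise λ k → trans (go k) (sym (getE-add (Texp n) (unitE (suc n)) k))
    where
    go : ∀ k → getE (Texp (suc n)) k ≡ getE (Texp n) k + getE (unitE (suc n)) k
    go zero = refl
    go (suc k) with <-cmp k n
    ... | tri< lt ne _ = trans (getE-Texp (suc n) k (m≤n⇒m≤1+n lt)) (sym (cong₂ _+_ (getE-Texp n k lt) (getE-unit-other n (suc k) (ne ∘ suc-injective))))
    ... | tri≈ _ refl _ = trans (getE-Texp (suc n) k ≤-refl) (sym (cong₂ _+_ (getE-Texp-beyond n (suc k) ≤-refl) (getE-unit-same n)))
    ... | tri> _ ne gt = trans (getE-Texp-beyond (suc n) (suc k) (s≤s gt)) (sym (cong₂ _+_ (getE-Texp-beyond n (suc k) (m≤n⇒m≤1+n gt)) (getE-unit-other n (suc k) (ne ∘ suc-injective))))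

  monoOf-range1 : ∀ n → monoOf (range1 n) ≐ Texp n
  monoOf-range1 zero = ≐-refl
  monoOf-range1 (suc n) = ≐-trans (monoOf-++ (range1 n) (suc n ∷ []))
    (≐-trans (addE-cong (monoOf-range1 n) (pointwise λ k → cong (λ z → getE z k) (addE-[] (unitE (suc n))))) (≐-sym (Texp-suc n)))

  -- Adding the column (1ⁿ) is a bijection from the partitions with at most n parts
  -- onto those with exactly n parts.

  bump : ℕ → List ℕ → List ℕ
  bump zero ν = ν
  bump (suc n) [] = []
  bump (suc n) (a ∷ ν) = suc a ∷ bump n ν

  headLe : ℕ → List ℕ → Set
  headLe a [] = ⊤
  headLe a (b ∷ _) = b ≤ a

  ∧-true : ∀ {a b} → a ∧ b ≡ true → a ≡ true × b ≡ true
  ∧-true {true} {true} _ = refl , refl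

  true-∧ : ∀ {a b} → a ≡ true → b ≡ true → a ∧ b ≡ true
  true-∧ refl refl = refl

  isPartition-∷⁻ : ∀ a ν → isPartition (a ∷ ν) ≡ true → headLe a ν × isPartition ν ≡ true
  isPartition-∷⁻ a [] _ = tt , refl
  isPartition-∷⁻ a (b ∷ ν) e with p , q ← ∧-true e = ≤ᵇ⇒≤ b a (≡-T p) , q

  isPartition-∷⁺ : ∀ a ν → headLe a ν → isPartition ν ≡ true → isPartition (a ∷ ν) ≡ true
  isPartition-∷⁺ a [] _ _ = refl
  isPartition-∷⁺ a (b ∷ ν) p q = true-∧ (T-≡ (≤⇒≤ᵇ p)) q

  nonzeros-zero : ∀ ν → isPartition (0 ∷ ν) ≡ true → nonzeros ν ≡ 0
  nonzeros-zero [] _ = refl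
  nonzeros-zero (b ∷ ν) e with p , q ← isPartition-∷⁻ 0 (b ∷ ν) e with refl ← n≤0⇒n≡0 p = nonzeros-zero ν q

  nonzeros≤length : ∀ ν → nonzeros ν ≤ length ν
  nonzeros≤length [] = z≤n
  nonzeros≤length (zero ∷ ν) = m≤n⇒m≤1+n (nonzeros≤length ν)
  nonzeros≤length (suc a ∷ ν) = s≤s (nonzeros≤length ν)

  tail-nonzeros : ∀ {n} a ν → isPartition (a ∷ ν) ≡ true → nonzeros (a ∷ ν) ≤ suc n → nonzeros ν ≤ n
  tail-nonzeros zero ν p _ = subst (_≤ _) (sym (nonzeros-zero ν p)) z≤n
  tail-nonzeros (suc a) ν _ (s≤s q) = q

  bump-partition : ∀ n ν → isPartition ν ≡ true → nonzeros ν ≤ n → n ≤ length ν →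
    isPartition (bump n ν) ≡ true × nonzeros (bump n ν) ≡ n
  bump-partition zero ν p q _ = p , n≤0⇒n≡0 q
  bump-partition (suc n) (a ∷ ν) p q (s≤s l)
    with h , pν ← isPartition-∷⁻ a ν p
    with pb , nb ← bump-partition n ν pν (tail-nonzeros a ν p q) l
    = isPartition-∷⁺ (suc a) (bump n ν) (head n ν h) pb , cong suc nb
    where
    head : ∀ n ν → headLe a ν → headLe (suc a) (bump n ν)
    head zero [] h = tt
    head zero (b ∷ ν) h = m≤n⇒m≤1+n h
    head (suc n) [] h = tt
    head (suc n) (b ∷ ν) h = s≤s h

  -- The bound `ν′ ≤ ν` keeps the preimage among the divisors of t^μ.
  unbump : ∀ n ν → isPartition ν ≡ true → nonzeros ν ≡ n →
    ∃ λ ν′ → bump n ν′ ≡ ν × isPartition ν′ ≡ true × nonzeros ν′ ≤ n × Pointwise _≤_ ν′ ν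
  unbump zero ν p q = ν , refl , p , ≤-reflexive q , Pointwise.refl ≤-refl
  unbump (suc n) [] p ()
  unbump (suc n) (zero ∷ ν) p q with () ← trans (sym q) (nonzeros-zero ν p)
  unbump (suc n) (suc a ∷ ν) p q with h , pν ← isPartition-∷⁻ (suc a) ν p
    with ν′ , refl , p′ , q′ , le ← unbump n ν pν (suc-injective q)
    = a ∷ ν′ , refl , isPartition-∷⁺ a ν′ (head n ν′ q′ h) p′ , nz a , (n≤1+n a ∷ le)
    where
    nz : ∀ a → nonzeros (a ∷ ν′) ≤ suc n
    nz zero = m≤n⇒m≤1+n q′
    nz (suc a) = s≤s q′
    head : ∀ n ν′ → nonzeros ν′ ≤ n → headLe (suc a) (bump n ν′) → headLe a ν′
    head zero [] _ h = tt
    head zero (zero ∷ ν′) _ h = z≤n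
    head (suc n) [] _ h = tt
    head (suc n) (b ∷ ν′) _ (s≤s h) = h

  bump-injective : ∀ n {ν ν′} → bump n ν ≡ bump n ν′ → ν ≡ ν′
  bump-injective zero e = e
  bump-injective (suc n) {[]} {[]} e = refl
  bump-injective (suc n) {a ∷ ν} {a′ ∷ ν′} e =
    cong₂ _∷_ (suc-injective (Data.List.Properties.∷-injectiveˡ e)) (bump-injective n (Data.List.Properties.∷-injectiveʳ e))

  length-bump : ∀ n ν → length (bump n ν) ≡ length ν
  length-bump zero ν = refl
  length-bump (suc n) [] = refl
  length-bump (suc n) (a ∷ ν) = cong suc (length-bump n ν)

  addE-Texp : ∀ n ν → n ≤ length ν → addE ν (Texp n) ≡ bump n ν
  addE-Texp zero ν _ = addE-[] ν
  addE-Texp (suc n) (a ∷ ν) (s≤s p) = cong₂ _∷_ (+-comm a 1) (addE-Texp n ν p)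

  Pointwise-leAll : ∀ {α β} → Pointwise _≤_ α β → leAll α β ≡ true
  Pointwise-leAll [] = refl
  Pointwise-leAll (p ∷ ps) = true-∧ (T-≡ (≤⇒≤ᵇ p)) (Pointwise-leAll ps)

  leAll-Pointwise : ∀ α β → leAll α β ≡ true → Pointwise _≤_ α β
  leAll-Pointwise [] [] _ = []
  leAll-Pointwise (a ∷ α) (b ∷ β) e with p , q ← ∧-true e = ≤ᵇ⇒≤ a b (≡-T p) ∷ leAll-Pointwise α β q

  ⊑-Pointwise : ∀ α β → length α ≡ length β → α ⊑ β → Pointwise _≤_ α β
  ⊑-Pointwise [] [] _ _ = []
  ⊑-Pointwise (a ∷ α) (b ∷ β) len h = h 1 ∷ ⊑-Pointwise α β (suc-injective len) tail
    where
    tail : α ⊑ β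
    tail zero = z≤n
    tail (suc k) = h (suc (suc k))

  prepend : List (List ℕ) → List ℕ → List (List ℕ)
  prepend B = concatMap (λ a → map (a ∷_) B)

  ∈-prepend⁺ : ∀ {B xs a ν} → a ∈ xs → ν ∈ B → a ∷ ν ∈ prepend B xs
  ∈-prepend⁺ (here refl) j = ∈-++⁺ˡ (∈-map⁺ (_ ∷_) j)
  ∈-prepend⁺ {B} {x ∷ xs} (there i) j = ∈-++⁺ʳ (map (x ∷_) B) (∈-prepend⁺ i j)

  ∈-prepend⁻ : ∀ B xs {ν} → ν ∈ prepend B xs → ∃ λ a → ∃ λ ν′ → ν ≡ a ∷ ν′ × a ∈ xs × ν′ ∈ B
  ∈-prepend⁻ B (x ∷ xs) i with ∈-++⁻ (map (x ∷_) B) i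
  ... | inj₁ j with ν′ , k , e ← ∈-map⁻ (x ∷_) j = x , ν′ , e , here refl , k
  ... | inj₂ j with a , ν′ , e , m , k ← ∈-prepend⁻ B xs j = a , ν′ , e , there m , k

  prepend-unique : ∀ {B xs} → Unique B → Unique xs → Unique (prepend B xs)
  prepend-unique uB [] = []
  prepend-unique {B} {x ∷ xs} uB (nx ∷ u) = Uniqueₚ.++⁺ (Uniqueₚ.map⁺ (λ { refl → refl }) uB) (prepend-unique uB u) disjoint
    where
    disjoint : ∀ {ν} → ¬ (ν ∈ map (x ∷_) B × ν ∈ prepend B xs)
    disjoint (i , j) with _ , _ , refl ← ∈-map⁻ (x ∷_) i with _ , _ , refl , m , _ ← ∈-prepend⁻ B xs j = All.lookup nx m refl

  ∈-below⁺ : ∀ {ν μ} → Pointwise _≤_ ν μ → ν ∈ below μ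
  ∈-below⁺ [] = here refl
  ∈-below⁺ (p ∷ ps) = ∈-prepend⁺ (∈-upTo⁺ (s≤s p)) (∈-below⁺ ps)

  ∈-below⁻ : ∀ μ {ν} → ν ∈ below μ → Pointwise _≤_ ν μ
  ∈-below⁻ [] (here refl) = []
  ∈-below⁻ (m ∷ μ) i with a , ν′ , refl , j , k ← ∈-prepend⁻ (below μ) (upTo (suc m)) i =
    ≤-pred (∈-upTo⁻ j) ∷ ∈-below⁻ μ k

  below-unique : ∀ μ → Unique (below μ)
  below-unique [] = [] ∷ []
  below-unique (m ∷ μ) = prepend-unique (below-unique μ) (Uniqueₚ.upTo⁺ (suc m))

  hasParts : ℕ → Exps → Bool
  hasParts n ν = isPartition ν ∧ (nonzeros ν ≤ᵇ n)

  hasParts⁺ : ∀ {n} ν → isPartition ν ≡ true → nonzeros ν ≤ n → hasParts n ν ≡ true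
  hasParts⁺ ν p q = true-∧ p (T-≡ (≤⇒≤ᵇ q))

  hasParts⁻ : ∀ {n} ν → hasParts n ν ≡ true → isPartition ν ≡ true × nonzeros ν ≤ n
  hasParts⁻ {n} ν e with p , q ← ∧-true {isPartition ν} e = p , ≤ᵇ⇒≤ (nonzeros ν) n (≡-T q)

  partitions : ℕ → Exps → List Exps
  partitions n μ = boolFilter (hasParts n) (below μ)

  -- The length test excludes lists with fewer than n entries, on which `bump n` stops early and is
  -- not the addition of a full column.
  fits : ℕ → Exps → Exps → Bool
  fits n μ ν = (n ≤ᵇ length ν) ∧ leAll (bump n ν) μ

  -- A partition with at most n+1 parts either has at most n, or loses a full column. The bumped
  -- summands are those cancelled by the second term of 1 - x_1⋯x_{n+1} T_{n+1}; products with ν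
  -- that do not fit vanish by truncation.
  partitions-suc : ∀ n μ → partitions (suc n) μ ↭
    partitions n μ ++ map (bump (suc n)) (boolFilter (fits (suc n) μ) (partitions (suc n) μ))
  partitions-suc n μ = unique-set-↭ uS (Uniqueₚ.++⁺ (boolFilter-unique (hasParts n) (below-unique μ))
      (Uniqueₚ.map⁺ (bump-injective (suc n)) (boolFilter-unique (fits (suc n) μ) uS)) disjoint) to from
    where
    S = partitions (suc n) μ
    uS : Unique S
    uS = boolFilter-unique (hasParts (suc n)) (below-unique μ)
    info : ∀ {m ν} → ν ∈ partitions m μ → ν ∈ below μ × isPartition ν ≡ true × nonzeros ν ≤ m
    info {m} {ν} i with j , e ← ∈-boolFilter⁻ (hasParts m) (below μ) i = j , hasParts⁻ ν e
    bumped : ∀ {ν} → ν ∈ boolFilter (fits (suc n) μ) S → isPartition (bump (suc n) ν) ≡ true × nonzeros (bump (suc n) ν) ≡ suc n × Pointwise _≤_ (bump (suc n) ν) μ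
    bumped {ν} i with j , e ← ∈-boolFilter⁻ (fits (suc n) μ) S i with l , le ← ∧-true {suc n ≤ᵇ length ν} e
      with _ , p , q ← info j with pb , nb ← bump-partition (suc n) ν p q (≤ᵇ⇒≤ (suc n) (length ν) (≡-T l))
      = pb , nb , leAll-Pointwise (bump (suc n) ν) μ le
    disjoint : ∀ {ν} → ¬ (ν ∈ partitions n μ × ν ∈ map (bump (suc n)) (boolFilter (fits (suc n) μ) S))
    disjoint (i , j) with _ , k , refl ← ∈-map⁻ (bump (suc n)) j with _ , nb , _ ← bumped k with _ , _ , q ← info i
      = <-irrefl refl (subst (_≤ n) nb q)
    to : ∀ {ν} → ν ∈ S → ν ∈ partitions n μ ++ map (bump (suc n)) (boolFilter (fits (suc n) μ) S)
    to {ν} i with b , p , q ← info i with nonzeros ν ≤? n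
    ... | yes q′ = ∈-++⁺ˡ (∈-boolFilter⁺ (hasParts n) (below μ) b (hasParts⁺ ν p q′))
    ... | no ¬q with ν′ , refl , p′ , q′ , le ← unbump (suc n) ν p (≤-antisym q (≰⇒> ¬q))
      = ∈-++⁺ʳ (partitions n μ) (∈-map⁺ (bump (suc n)) (∈-boolFilter⁺ (fits (suc n) μ) S
          (∈-boolFilter⁺ (hasParts (suc n)) (below μ) (∈-below⁺ (Pointwise.transitive ≤-trans le (∈-below⁻ μ b))) (hasParts⁺ ν′ p′ q′))
          (true-∧ (T-≡ (≤⇒≤ᵇ long)) (Pointwise-leAll (∈-below⁻ μ b)))))
      where
      long : suc n ≤ length ν′
      long = subst (suc n ≤_) (length-bump (suc n) ν′) (≤-trans (≰⇒> ¬q) (nonzeros≤length (bump (suc n) ν′)))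
    from : ∀ {ν} → ν ∈ partitions n μ ++ map (bump (suc n)) (boolFilter (fits (suc n) μ) S) → ν ∈ S
    from {ν} i with ∈-++⁻ (partitions n μ) i
    ... | inj₁ j with b , p , q ← info j = ∈-boolFilter⁺ (hasParts (suc n)) (below μ) b (hasParts⁺ ν p (m≤n⇒m≤1+n q))
    ... | inj₂ j with ν′ , k , refl ← ∈-map⁻ (bump (suc n)) j with pb , nb , le ← bumped k
      = ∈-boolFilter⁺ (hasParts (suc n)) (below μ) (∈-below⁺ le) (hasParts⁺ (bump (suc n) ν′) pb (≤-reflexive nb))

  sumOver : (Exps → ℤ) → List Exps → ℤ
  sumOver f [] = + 0
  sumOver f (ν ∷ νs) = f ν ℤ.+ sumOver f νs

  sumOver-++ : ∀ f xs ys → sumOver f (xs ++ ys) ≡ sumOver f xs ℤ.+ sumOver f ys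
  sumOver-++ f [] ys = sym (ℤₚ.+-identityˡ _)
  sumOver-++ f (x ∷ xs) ys = trans (cong (λ z → f x ℤ.+ z) (sumOver-++ f xs ys)) (sym (ℤₚ.+-assoc (f x) _ _))

  sumOver-↭ : ∀ f {xs ys} → xs ↭ ys → sumOver f xs ≡ sumOver f ys
  sumOver-↭ f ↭.refl = refl
  sumOver-↭ f (prep x e) = cong (λ z → f x ℤ.+ z) (sumOver-↭ f e)
  sumOver-↭ f (swap {xs} {ys} x y e) = trans (sym (ℤₚ.+-assoc (f x) (f y) _))
    (trans (cong₂ ℤ._+_ (ℤₚ.+-comm (f x) (f y)) (sumOver-↭ f e)) (ℤₚ.+-assoc (f y) (f x) _))
  sumOver-↭ f (↭.trans e g) = trans (sumOver-↭ f e) (sumOver-↭ f g)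

  sumOver-bump : ∀ {f : Exps → ℤ} {g h} (p : Exps → Bool) xs → (∀ x → x ∈ xs → p x ≡ true → g x ≡ f (h x)) →
    (∀ x → x ∈ xs → p x ≡ false → g x ≡ + 0) → sumOver g xs ≡ sumOver f (map h (boolFilter p xs))
  sumOver-bump p [] _ _ = refl
  sumOver-bump p (x ∷ xs) t z with p x in e
  ... | true = cong₂ ℤ._+_ (t x (here refl) e) (sumOver-bump p xs (λ y i → t y (there i)) (λ y i → z y (there i)))
  ... | false = trans (cong₂ ℤ._+_ (z x (here refl) e) (sumOver-bump p xs (λ y i → t y (there i)) (λ y i → z y (there i)))) (ℤₚ.+-identityˡ _)

  -- For the identity K_ν = x^ν, so the summand K_ν t^ν has equal exponents in x and t.
  diagonal : ℕ → Exps → Poly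
  diagonal n ν = if hasParts n ν then (+ 1 , ν , ν) ∷ [] else []

  -- 𝒦⁽ⁿ⁾ of the identity permutation, truncated to the divisors of t^μ.
  truncation : ℕ → Exps → Poly
  truncation n μ = concatMap (diagonal n) (below μ)

  ev-diagonal : ∀ φ n νs → ev φ (concatMap (diagonal n) νs) ≡ sumOver (λ ν → φ ν ν) (boolFilter (hasParts n) νs)
  ev-diagonal φ n [] = refl
  ev-diagonal φ n (ν ∷ νs) with hasParts n ν
  ... | true = cong₂ ℤ._+_ (ℤₚ.*-identityˡ (φ ν ν)) (ev-diagonal φ n νs)
  ... | false = ev-diagonal φ n νs

  module Base (μ : Exps) where

    open Modulo μ
    open Demazure μ

    -- If ν has fewer than n entries, so has μ, and the variable t_n of the column does not divide
    -- t^μ. Otherwise adding the column gives `bump n ν`, which is then not below μ.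
    not-below : ∀ n ν → length ν ≡ length μ → fits n μ ν ≡ false → addE ν (Texp n) ⊑ μ → ⊥
    not-below zero ν len e h with () ← trans (sym e) (Pointwise-leAll (⊑-Pointwise ν μ len (subst (_⊑ μ) (addE-[] ν) h)))
    not-below (suc n) ν len e h with suc n ≤? length ν
    ... | yes p with () ← trans (sym e) (true-∧ (T-≡ (≤⇒≤ᵇ p)) (Pointwise-leAll (⊑-Pointwise (bump (suc n) ν) μ
            (trans (length-bump (suc n) ν) len) (subst (_⊑ μ) (addE-Texp (suc n) ν p) h))))
    ... | no ¬p = <-irrefl refl (≤-trans (≤-trans (≤-trans (≤-reflexive (sym (getE-Texp (suc n) n ≤-refl)))
          (≤-trans (m≤n+m _ (getE ν (suc n))) (≤-reflexive (sym (getE-add ν (Texp (suc n)) (suc n))))))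
          (h (suc n))) (≤-reflexive (getE-beyond μ (suc n) (subst (_< suc n) len (≰⇒> ¬p)))))

    truncation-factor : ∀ n → truncation (suc n) μ *P factor (range1 (suc n)) (suc n) ≋ truncation n μ
    truncation-factor n = tests λ t → trans (ev-*P (fun t) (truncation (suc n) μ) F)
      (trans (ev-cong (expand t) (truncation (suc n) μ))
      (trans (ev-+ (fun t) (λ xe te → - + 1 ℤ.* moved t xe te) (truncation (suc n) μ))
      (trans (cong (λ z → ev (fun t) (truncation (suc n) μ) ℤ.+ z) (ev-* (- + 1) (moved t) (truncation (suc n) μ)))
      (trans (cong₂ (λ u v → u ℤ.+ - + 1 ℤ.* v) (ev-diagonal (fun t) (suc n) (below μ)) (ev-diagonal (moved t) (suc n) (below μ)))
      (trans (cong₂ (λ u v → u ℤ.+ - + 1 ℤ.* v) (sumOver-↭ (λ ν → fun t ν ν) (partitions-suc n μ)) (shifted t))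
      (trans (cong (λ z → z ℤ.+ - + 1 ℤ.* sumOver (λ ν → fun t ν ν) B) (sumOver-++ (λ ν → fun t ν ν) (partitions n μ) B))
      (trans (ℤ-Solver.solve 2 (λ a b → (a ℤ-Solver.:+ b) ℤ-Solver.:+ ℤ-Solver.con (- + 1) ℤ-Solver.:* b ℤ-Solver.:= a) refl
         (sumOver (λ ν → fun t ν ν) (partitions n μ)) (sumOver (λ ν → fun t ν ν) B))
       (sym (ev-diagonal (fun t) n (below μ))))))))))
      where
      F = factor (range1 (suc n)) (suc n)
      B = map (bump (suc n)) (boolFilter (fits (suc n) μ) (partitions (suc n) μ))
      moved : Test μ → Exps → Exps → ℤ
      moved t xe te = fun t (addE xe (Texp (suc n))) (addE te (Texp (suc n)))
      expand : ∀ t xe te → ev (shift xe te (fun t)) F ≡ fun t xe te ℤ.+ - + 1 ℤ.* moved t xe te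
      expand t xe te = cong₂ ℤ._+_ (trans (ℤₚ.*-identityˡ _) (cong₂ (fun t) (addE-[] xe) (addE-[] te)))
        (trans (ℤₚ.+-identityʳ _) (cong (λ z → - + 1 ℤ.* z) (fcong t (addE-cong {a = xe} ≐-refl (monoOf-range1 (suc n))) ≐-refl)))
      shifted : ∀ t → sumOver (λ ν → moved t ν ν) (partitions (suc n) μ) ≡ sumOver (λ ν → fun t ν ν) B
      shifted t = sumOver-bump (fits (suc n) μ) (partitions (suc n) μ)
        (λ ν _ e → let l = ≤ᵇ⇒≤ (suc n) (length ν) (≡-T (proj₁ (∧-true {suc n ≤ᵇ length ν} e))) in
          cong₂ (fun t) (addE-Texp (suc n) ν l) (addE-Texp (suc n) ν l))
        (λ ν i e → vanish t _ _ (not-below (suc n) ν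
          (Pointwise-length (∈-below⁻ μ (proj₁ (∈-boolFilter⁻ (hasParts (suc n)) (below μ) i)))) e))

    truncation-zero : truncation 0 μ ≋ oneP
    truncation-zero = tests λ t → trans (ev-diagonal (fun t) 0 (below μ))
      (trans (sumOver-↭ (λ ν → fun t ν ν) only-zero)
      (cong₂ ℤ._+_ (trans (fcong t zeros zeros) (sym (ℤₚ.*-identityˡ _))) refl))
      where
      Z = replicate (length μ) 0
      getE-zeros : ∀ m k → getE (replicate m 0) k ≡ 0
      getE-zeros m zero = refl
      getE-zeros zero (suc k) = refl
      getE-zeros (suc m) (suc zero) = refl
      getE-zeros (suc m) (suc (suc k)) = getE-zeros m (suc k)
      zeros : Z ≐ []
      zeros = pointwise λ k → trans (getE-zeros (length μ) k) (sym (getE-[] k))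
      Z≤ : ∀ ν → Pointwise _≤_ (replicate (length ν) 0) ν
      Z≤ [] = []
      Z≤ (a ∷ ν) = z≤n ∷ Z≤ ν
      Z-parts : ∀ m → isPartition (replicate m 0) ≡ true × nonzeros (replicate m 0) ≡ 0
      Z-parts zero = refl , refl
      Z-parts (suc zero) = refl , refl
      Z-parts (suc (suc m)) = Z-parts (suc m)
      no-parts : ∀ ν → nonzeros ν ≤ 0 → ν ≡ replicate (length ν) 0
      no-parts [] _ = refl
      no-parts (zero ∷ ν) p = cong (0 ∷_) (no-parts ν p)
      only-zero : partitions 0 μ ↭ Z ∷ []
      only-zero = unique-set-↭ (boolFilter-unique (hasParts 0) (below-unique μ)) ([] ∷ []) to
        λ { (here refl) → ∈-boolFilter⁺ (hasParts 0) (below μ) (∈-below⁺ (Z≤ μ))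
              (hasParts⁺ Z (proj₁ (Z-parts (length μ))) (≤-reflexive (proj₂ (Z-parts (length μ))))) }
        where
        to : ∀ {ν} → ν ∈ partitions 0 μ → ν ∈ Z ∷ []
        to {ν} i with j , e ← ∈-boolFilter⁻ (hasParts 0) (below μ) i with _ , q ← hasParts⁻ ν e
          = here (trans (no-parts ν q) (cong (λ z → replicate z 0) (Pointwise-length (∈-below⁻ μ j))))

    layer-[] : ∀ l → prodP (factors [] l) ≋ factor (range1 l) l
    layer-[] l = ≋-trans (≡⇒≋ (cong (prodP ∘ map (λ α → factor α l)) (Aset-[] l)))
      (≋-trans (*P-comm (factor (range1 l) l) oneP) (*P-identityˡ (factor (range1 l) l)))

    truncation-Dfin : ∀ n → truncation n μ *P Dfin [] n ≋ oneP
    truncation-Dfin zero = ≋-trans (*P-comm (truncation 0 μ) oneP) (≋-trans (*P-identityˡ (truncation 0 μ)) truncation-zero)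
    truncation-Dfin (suc n) =
      ≋-trans (*P-cong {truncation (suc n) μ} ≋-refl (≋-trans (layers-suc (factors []) n)
        (≋-trans (*P-cong {Dfin [] n} ≋-refl (layer-[] (suc n))) (*P-comm (Dfin [] n) F))))
      (≋-trans (≋-sym (*P-assoc (truncation (suc n) μ) F (Dfin [] n)))
      (≋-trans (*P-cong {q = Dfin [] n} (truncation-factor n) ≋-refl) (truncation-Dfin n)))
      where F = factor (range1 (suc n)) (suc n)

open IdentityPermutation

-- From the truncated rings to coefficients of power series.

module Coefficients where

  open import Data.Nat
  open import Data.Nat.Properties
  open import Data.Integer using (ℤ; +_; -_)
  import Data.Integer as ℤ
  import Data.Integer.Properties as ℤₚ
  open import Data.Bool using (Bool; true; false; if_then_else_; _∧_)
  open import Data.Bool.Properties using (∧-zeroʳ; ∧-identityʳ)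
  open import Data.Empty using (⊥-elim)
  open import Data.List using (List; []; _∷_; map; length; concatMap; upTo)
  open import Data.List.Membership.Propositional using (_∈_)
  open import Data.List.Relation.Unary.Any using (here; there)
  open import Data.List.Relation.Unary.All as All using (All; []; _∷_)
  import Data.List.Relation.Unary.All.Properties as Allₚ
  open import Data.List.Relation.Binary.Pointwise as Pointwise using (Pointwise; []; _∷_; Pointwise-length)
  open import Data.Product using (_,_; proj₂)
  open import Relation.Nullary using (¬_)
  open import Relation.Binary.PropositionalEquality

  ≐-∷ : ∀ {a b x y} → x ≡ y → a ≐ b → (x ∷ a) ≐ (y ∷ b)
  ≐-∷ {a} {b} {x} {y} e f = pointwise go
    where
    go : ∀ k → getE (x ∷ a) k ≡ getE (y ∷ b) k
    go zero = refl
    go (suc zero) = e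
    go (suc (suc k)) = at f (suc k)

  ≐-tail : ∀ {a b x y} → (x ∷ a) ≐ (y ∷ b) → a ≐ b
  ≐-tail {a} {b} {x} {y} f = pointwise go
    where
    go : ∀ k → getE a k ≡ getE b k
    go zero = refl
    go (suc k) = at f (suc (suc k))

  0∷[] : (0 ∷ []) ≐ []
  0∷[] = pointwise λ { zero → refl ; (suc zero) → refl ; (suc (suc k)) → refl }

  eqE-sound : ∀ a b → eqE a b ≡ true → a ≐ b
  eqE-sound [] [] _ = ≐-refl
  eqE-sound [] (b ∷ bs) e with p , q ← ∧-true {b ≡ᵇ 0} e =
    ≐-trans (≐-sym 0∷[]) (≐-∷ (sym (≡ᵇ⇒≡ b 0 (≡-T p))) (eqE-sound [] bs q))
  eqE-sound (a ∷ as) [] e with p , q ← ∧-true {a ≡ᵇ 0} e =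
    ≐-trans (≐-∷ (≡ᵇ⇒≡ a 0 (≡-T p)) (eqE-sound as [] q)) 0∷[]
  eqE-sound (a ∷ as) (b ∷ bs) e with p , q ← ∧-true {a ≡ᵇ b} e =
    ≐-∷ (≡ᵇ⇒≡ a b (≡-T p)) (eqE-sound as bs q)

  eqE-complete : ∀ a b → a ≐ b → eqE a b ≡ true
  eqE-complete [] [] _ = refl
  eqE-complete [] (b ∷ bs) e = true-∧ (T-≡ (≡⇒≡ᵇ b 0 (sym (at e 1)))) (eqE-complete [] bs (≐-tail (≐-trans 0∷[] e)))
  eqE-complete (a ∷ as) [] e = true-∧ (T-≡ (≡⇒≡ᵇ a 0 (at e 1))) (eqE-complete as [] (≐-tail (≐-trans e (≐-sym 0∷[]))))
  eqE-complete (a ∷ as) (b ∷ bs) e = true-∧ (T-≡ (≡⇒≡ᵇ a b (at e 1))) (eqE-complete as bs (≐-tail e))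

  bool-ext : ∀ {p q} → (p ≡ true → q ≡ true) → (q ≡ true → p ≡ true) → p ≡ q
  bool-ext {true} f g = sym (f refl)
  bool-ext {false} {false} f g = refl
  bool-ext {false} {true} f g = g refl

  eqE-cong : ∀ {a a′} b → a ≐ a′ → eqE a b ≡ eqE a′ b
  eqE-cong {a} {a′} b e = bool-ext (λ h → eqE-complete a′ b (≐-trans (≐-sym e) (eqE-sound a b h)))
    (λ h → eqE-complete a b (≐-trans e (eqE-sound a′ b h)))

  χ : Exps → Exps → Exps → Exps → ℤ
  χ e f xe te = if eqE xe e ∧ eqE te f then + 1 else + 0

  χ-cong : ∀ e f {a a′ b b′} → a ≐ a′ → b ≐ b′ → χ e f a b ≡ χ e f a′ b′
  χ-cong e f p q = cong₂ (λ u v → if u ∧ v then + 1 else + 0) (eqE-cong e p) (eqE-cong f q)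

  coeff-ev : ∀ p e f → coeff p e f ≡ ev (χ e f) p
  coeff-ev [] e f = refl
  coeff-ev ((c , xe , te) ∷ p) e f = cong₂ ℤ._+_ (pick (eqE xe e ∧ eqE te f)) (coeff-ev p e f)
    where
    pick : ∀ b → (if b then c else + 0) ≡ c ℤ.* (if b then + 1 else + 0)
    pick true = sym (ℤₚ.*-identityʳ c)
    pick false = sym (ℤₚ.*-zeroʳ c)

  -- The transpose of `tcoeff`.
  atDegree : Exps → (Exps → Exps → ℤ) → Exps → Exps → ℤ
  atDegree κ ψ xe te = if eqE te κ then ψ xe [] else + 0

  ev-tcoeff : ∀ ψ p κ → ev ψ (tcoeff p κ) ≡ ev (atDegree κ ψ) p
  ev-tcoeff ψ p κ = ev-concatMap ψ (atDegree κ ψ) _ pick p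
    where
    pick : ∀ c xe te → ev ψ (if eqE te κ then (c , xe , []) ∷ [] else []) ≡ c ℤ.* atDegree κ ψ xe te
    pick c xe te with eqE te κ
    ... | true = ℤₚ.+-identityʳ _
    ... | false = sym (ℤₚ.*-zeroʳ c)

  -- The bridge from the truncated ring to the theorem: a coefficient at t^μ sees only monomials
  -- with t-part t^μ, so it is constant on classes.
  χ-Test : ∀ e μ → Test μ
  χ-Test e μ = record { fun = χ e μ ; fcong = χ-cong e μ ; vanish = van }
    where
    van : ∀ a b → ¬ b ⊑ μ → χ e μ a b ≡ + 0
    van a b nl with eqE b μ in h
    ... | false = cong (λ z → if z then + 1 else + 0) (∧-zeroʳ (eqE a e))
    ... | true = ⊥-elim (nl λ k → ≤-reflexive (at (eqE-sound b μ h) k))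

  atDegree-Test : ∀ κ ψ → (∀ {a a′} → a ≐ a′ → ψ a [] ≡ ψ a′ []) → Test κ
  atDegree-Test κ ψ ψ-cong = record
    { fun = atDegree κ ψ
    ; fcong = λ p q → cong₂ (λ u v → if u then v else + 0) (eqE-cong κ q) (ψ-cong p)
    ; vanish = van }
    where
    van : ∀ a b → ¬ b ⊑ κ → atDegree κ ψ a b ≡ + 0
    van a b nl with eqE b κ in h
    ... | false = refl
    ... | true = ⊥-elim (nl λ k → ≤-reflexive (at (eqE-sound b κ h) k))

  -- Coefficients of a `Series` are read at the t-exponent `[]`, so the key polynomials must be
  -- known to contain no t; π preserves this.
  TFree : Poly → Set
  TFree = All (λ m → proj₂ (proj₂ m) ≡ [])

  ev-tfree : ∀ {φ ψ p} → TFree p → (∀ xe → φ xe [] ≡ ψ xe []) → ev φ p ≡ ev ψ p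
  ev-tfree [] h = refl
  ev-tfree {p = (c , xe , .[]) ∷ p} (refl ∷ fr) h = cong₂ (λ u v → c ℤ.* u ℤ.+ v) (h xe) (ev-tfree fr h)

  ∂term-tfree : ∀ i c xe → TFree (∂term i (c , xe , []))
  ∂term-tfree i c xe with getE xe i ≡ᵇ getE xe (suc i)
  ... | true = []
  ... | false = Allₚ.map⁺ (All.universal (λ _ → refl) (upTo ((getE xe i ∸ getE xe (suc i)) + (getE xe (suc i) ∸ getE xe i))))

  ∂-tfree : ∀ i {p} → TFree p → TFree (∂ i p)
  ∂-tfree i [] = []
  ∂-tfree i {(c , xe , .[]) ∷ p} (refl ∷ fr) = Allₚ.++⁺ (∂term-tfree i c xe) (∂-tfree i fr)

  xVar-tfree : ∀ i {p} → TFree p → TFree (xVar i *P p)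
  xVar-tfree i fr = Allₚ.++⁺ (Allₚ.map⁺ (All.map (λ e → e) fr)) []

  πR : List ℕ → Poly → Poly
  πR [] p = p
  πR (j ∷ r) p = π (suc j) (πR r p)

  πR-tfree : ∀ r {p} → TFree p → TFree (πR r p)
  πR-tfree [] fr = fr
  πR-tfree (j ∷ r) fr = ∂-tfree (suc j) (xVar-tfree (suc j) (πR-tfree r fr))

  look-subE : ∀ a b k → look (subE a b) k 0 ≡ look a k 0 ∸ look b k 0
  look-subE [] b k = sym (0∸n≡0 (look b k 0))
  look-subE (x ∷ a) [] k = refl
  look-subE (x ∷ a) (y ∷ b) zero = refl
  look-subE (x ∷ a) (y ∷ b) (suc k) = look-subE a b k

  getE-subE : ∀ a b k → getE (subE a b) k ≡ getE a k ∸ getE b k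
  getE-subE a b zero = refl
  getE-subE a b (suc k) = look-subE a b k

  Pointwise-⊑ : ∀ {ν μ} → Pointwise _≤_ ν μ → ν ⊑ μ
  Pointwise-⊑ ps zero = z≤n
  Pointwise-⊑ [] (suc k) = z≤n
  Pointwise-⊑ (p ∷ ps) (suc zero) = p
  Pointwise-⊑ (p ∷ ps) (suc (suc k)) = Pointwise-⊑ ps (suc k)

  length-subE : ∀ {ν μ} → Pointwise _≤_ ν μ → length (subE μ ν) ≡ length μ
  length-subE [] = refl
  length-subE (p ∷ ps) = cong suc (length-subE ps)

  eqE-subE : ∀ ν ue μ → ν ⊑ μ → eqE ue (subE μ ν) ≡ eqE (addE ν ue) μ
  eqE-subE ν ue μ le = bool-ext
    (λ h → eqE-complete (addE ν ue) μ (pointwise λ k → trans (getE-add ν ue k)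
      (trans (cong (λ z → getE ν k + z) (trans (at (eqE-sound ue (subE μ ν) h) k) (getE-subE μ ν k))) (m+[n∸m]≡n (le k)))))
    (λ h → eqE-complete ue (subE μ ν) (pointwise λ k → sym (trans (getE-subE μ ν k)
      (trans (cong (_∸ getE ν k) (trans (sym (at (eqE-sound (addE ν ue) μ h) k)) (getE-add ν ue k))) (m+n∸m≡n (getE ν k) (getE ue k))))))

  tMonomial : Exps → Poly
  tMonomial ν = (+ 1 , [] , ν) ∷ []

  -- A summand of the Cauchy product equals the coefficient of t^μ in K t^ν D, because K has no t.
  -- As ν is below μ, the truncated subtraction in `subE μ ν` is exact.
  ev-*-tcoeff : ∀ {K} → TFree K → ∀ D e ν μ → ν ⊑ μ →
    ev (χ e []) (K *P tcoeff D (subE μ ν)) ≡ ev (λ xe te → ev (shift xe te (χ e μ)) D) (K *P tMonomial ν)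
  ev-*-tcoeff {K} fr D e ν μ le = trans (ev-*P (χ e []) K (tcoeff D (subE μ ν)))
    (trans (ev-tfree fr inner) (sym (ev-*P _ K (tMonomial ν))))
    where
    inner : ∀ xe → ev (shift xe [] (χ e [])) (tcoeff D (subE μ ν)) ≡
                   + 1 ℤ.* ev (shift (addE xe []) ν (χ e μ)) D ℤ.+ + 0
    inner xe = trans (ev-tcoeff (shift xe [] (χ e [])) D (subE μ ν))
      (trans (ev-cong value D) (sym (trans (ℤₚ.+-identityʳ _) (ℤₚ.*-identityˡ _))))
      where
      pick : ∀ p q → (if q then (if p ∧ true then + 1 else + 0) else + 0) ≡ (if p ∧ q then + 1 else + 0)
      pick true true = refl
      pick true false = refl
      pick false true = refl
      pick false false = refl
      value : ∀ ye ue → atDegree (subE μ ν) (shift xe [] (χ e [])) ye ue ≡ shift (addE xe []) ν (χ e μ) ye ue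
      value ye ue = trans (pick (eqE (addE xe ye) e) (eqE ue (subE μ ν)))
        (cong₂ (λ u v → if u ∧ v then + 1 else + 0) (cong (λ z → eqE (addE z ye) e) (sym (addE-[] xe))) (eqE-subE ν ue μ le))

  ev-concatMap-cong : ∀ φ ψ {f g : Exps → Poly} νs → (∀ ν → ν ∈ νs → ev φ (f ν) ≡ ev ψ (g ν)) →
    ev φ (concatMap f νs) ≡ ev ψ (concatMap g νs)
  ev-concatMap-cong φ ψ [] h = refl
  ev-concatMap-cong φ ψ {f} {g} (ν ∷ νs) h = trans (ev-++ φ (f ν) (concatMap f νs))
    (trans (cong₂ ℤ._+_ (h ν (here refl)) (ev-concatMap-cong φ ψ νs λ x i → h x (there i))) (sym (ev-++ ψ (g ν) (concatMap g νs))))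

  keyTerm : ℕ → List ℕ → Exps → Poly
  keyTerm n r ν = if hasParts n ν then πR r ((+ 1 , ν , []) ∷ []) else []

  keyTerm-tfree : ∀ n r ν → TFree (keyTerm n r ν)
  keyTerm-tfree n r ν with hasParts n ν
  ... | true = πR-tfree r (refl ∷ [])
  ... | false = []

  module Truncated (μ : Exps) where

    open Modulo μ
    open Demazure μ
    open Induction μ
    open Base μ

    ϖ*≡πR : ∀ r p → ϖ* r p ≡ πR r p
    ϖ*≡πR [] p = refl
    ϖ*≡πR (j ∷ r) p = cong (π (suc j)) (ϖ*≡πR r p)

    -- Every s_j fixes t^ν, so the monomial moves inside the operators and turns x^ν into x^ν t^ν.
    keyTerm-diagonal : ∀ n r ν → keyTerm n r ν *P tMonomial ν ≋ ϖ* r (diagonal n ν)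
    keyTerm-diagonal n r ν with hasParts n ν
    ... | false = ≋-sym (ϖ*-zero r)
    ... | true = ≋-trans (*P-cong {q = tMonomial ν} (≡⇒≋ (sym (ϖ*≡πR r x^ν))) ≋-refl)
        (≋-trans (≋-sym (ϖ*-symmetric r x^ν (tMonomial ν) (λ j → term-cong (+ 1) (swapE-[] j) ≐-refl)))
          (ϖ*-cong r (≡⇒≋ (cong (λ z → (+ 1 , z , ν) ∷ []) (addE-[] ν)))))
      where
      x^ν : Poly
      x^ν = (+ 1 , ν , []) ∷ []

    keyTerms-truncation : ∀ n r νs →
      concatMap (λ ν → keyTerm n r ν *P tMonomial ν) νs ≋ ϖ* r (concatMap (diagonal n) νs)
    keyTerms-truncation n r [] = ≋-sym (ϖ*-zero r)
    keyTerms-truncation n r (ν ∷ νs) = ≋-trans (+P-cong (keyTerm-diagonal n r ν) (keyTerms-truncation n r νs))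
      (≋-sym (ϖ*-+ r (diagonal n ν) (concatMap (diagonal n) νs)))

    -- The series is computed along r and P along s. Matsumoto replaces r by s in the operator,
    -- after which the induction runs along s alone.
    ϖ*-independent : ∀ n r s → Asc r → Asc s → (∀ k → inv r k ≡ inv s k) → Below n s →
      ϖ* r (truncation n μ) *P Dfin (permR s) n ≋ PR s
    ϖ*-independent n r s ar as e b = ≋-trans (*P-cong {q = Dfin (permR s) n} (ϖ*-~ (matsumoto r s ar as e) (truncation n μ)) ≋-refl)
      (ϖ*-Dfin (truncation n μ) n (truncation-Dfin n) s as b)

  finite : ∀ n r s → Asc r → Asc s → (∀ k → inv r k ≡ inv s k) → Below n s → ∀ μ e →
    coeff ((keyTerm n r ⋆ polyS (Dfin (permR s) n)) μ) e [] ≡ coeff (polyS (PR s) μ) e []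
  finite n r s ar as same b μ e = begin
    coeff ((keyTerm n r ⋆ polyS D) μ) e []
      ≡⟨ coeff-ev ((keyTerm n r ⋆ polyS D) μ) e [] ⟩
    ev (χ e []) (concatMap (λ ν → keyTerm n r ν *P tcoeff D (subE μ ν)) (below μ))
      ≡⟨ ev-concatMap-cong (χ e []) _ (below μ) (λ ν i →
           ev-*-tcoeff (keyTerm-tfree n r ν) D e ν μ (Pointwise-⊑ (∈-below⁻ μ i))) ⟩
    ev (fun (convolve D t)) (concatMap (λ ν → keyTerm n r ν *P tMonomial ν) (below μ))
      ≡⟨ test (keyTerms-truncation n r (below μ)) (convolve D t) ⟩
    ev (fun (convolve D t)) (ϖ* r (truncation n μ))
      ≡⟨ ev-*P (χ e μ) (ϖ* r (truncation n μ)) D ⟨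
    ev (χ e μ) (ϖ* r (truncation n μ) *P D)
      ≡⟨ test (ϖ*-independent n r s ar as same b) t ⟩
    ev (χ e μ) (PR s)
      ≡⟨ ev-cong value (PR s) ⟨
    ev (atDegree μ (χ e [])) (PR s)
      ≡⟨ ev-tcoeff (χ e []) (PR s) μ ⟨
    ev (χ e []) (polyS (PR s) μ)
      ≡⟨ coeff-ev (polyS (PR s) μ) e [] ⟨
    coeff (polyS (PR s) μ) e [] ∎
    where
    open ≡-Reasoning
    open Modulo μ
    open Demazure μ
    open Truncated μ
    D = Dfin (permR s) n
    t = χ-Test e μ
    value : ∀ xe te → atDegree μ (χ e []) xe te ≡ χ e μ xe te
    value xe te with eqE te μ
    ... | true = refl
    ... | false = cong (λ z → if z then + 1 else + 0) (sym (∧-zeroʳ (eqE xe e)))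

  module HighLayers (κ : Exps) where

    open Modulo κ
    open Demazure κ

    -- T_l contains t_l, which cannot divide t^κ when κ has fewer than l entries.
    high-factor : ∀ α l → length κ < l → factor α l ≋ oneP
    high-factor α (suc l) p = tests λ t → cong (λ z → + 1 ℤ.* fun t [] [] ℤ.+ (- + 1 ℤ.* z ℤ.+ + 0))
      (vanish t (monoOf α) (Texp (suc l)) λ le → <-irrefl refl (≤-trans (≤-reflexive (sym (getE-Texp (suc l) l ≤-refl)))
        (≤-trans (le (suc l)) (≤-reflexive (getE-beyond κ (suc l) p)))))

    high-layer : ∀ w l → length κ < l → prodP (factors w l) ≋ oneP
    high-layer w l p = go (Aset w l)
      where
      go : ∀ αs → prodP (map (λ α → factor α l) αs) ≋ oneP
      go [] = ≋-refl
      go (α ∷ αs) = ≋-trans (*P-cong (high-factor α l p) (go αs)) (*P-identityˡ oneP)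

    Dfin-high : ∀ w d → Dfin w (d + length κ) ≋ Dfin w (length κ)
    Dfin-high w zero = ≋-refl
    Dfin-high w (suc d) = ≋-trans (layers-suc (factors w) (d + length κ))
      (≋-trans (*P-cong (Dfin-high w d) (high-layer w (suc (d + length κ)) (s≤s (m≤n+m (length κ) d))))
        (≋-trans (*P-comm (Dfin w (length κ)) oneP) (*P-identityˡ (Dfin w (length κ)))))

    -- The cut-off in `Dinf` may be replaced by any larger one, so the infinite product reduces to a
    -- finite denominator.
    ev-Dinf : ∀ ψ → (∀ {a a′} → a ≐ a′ → ψ a [] ≡ ψ a′ []) → ∀ w n → length κ ≤ n →
      ev ψ (Dinf w κ) ≡ ev ψ (tcoeff (Dfin w n) κ)
    ev-Dinf ψ ψ-cong w n p = trans (ev-tcoeff ψ (Dfin w (length κ)) κ)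
      (trans (sym (test (Dfin-high w (n ∸ length κ)) (atDegree-Test κ ψ ψ-cong)))
      (trans (cong (λ z → ev (atDegree κ ψ) (Dfin w z)) (m∸n+n≡m p)) (sym (ev-tcoeff ψ (Dfin w n) κ))))

  fullTerm : List ℕ → Exps → Poly
  fullTerm r ν = if isPartition ν then πR r ((+ 1 , ν , []) ∷ []) else []

  fullTerm≡keyTerm : ∀ n r ν → length ν ≤ n → fullTerm r ν ≡ keyTerm n r ν
  fullTerm≡keyTerm n r ν p = cong (λ z → if z then πR r ((+ 1 , ν , []) ∷ []) else [])
    (sym (trans (cong (isPartition ν ∧_) (T-≡ (≤⇒≤ᵇ (≤-trans (nonzeros≤length ν) p)))) (∧-identityʳ (isPartition ν))))

  infinite : ∀ n r s → Asc r → Asc s → (∀ k → inv r k ≡ inv s k) → Below n s → ∀ μ e →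
    coeff ((fullTerm r ⋆ Dinf (permR s)) μ) e [] ≡ coeff (polyS (PR s) μ) e []
  infinite n r s ar as same b μ e = begin
    coeff ((fullTerm r ⋆ Dinf (permR s)) μ) e []
      ≡⟨ coeff-ev ((fullTerm r ⋆ Dinf (permR s)) μ) e [] ⟩
    ev (χ e []) ((fullTerm r ⋆ Dinf (permR s)) μ)
      ≡⟨ ev-concatMap-cong (χ e []) (χ e []) (below μ) term ⟩
    ev (χ e []) ((keyTerm N r ⋆ polyS (Dfin (permR s) N)) μ)
      ≡⟨ coeff-ev ((keyTerm N r ⋆ polyS (Dfin (permR s) N)) μ) e [] ⟨
    coeff ((keyTerm N r ⋆ polyS (Dfin (permR s) N)) μ) e []
      ≡⟨ finite N r s ar as same (Below-mono (m≤m⊔n n (length μ)) b) μ e ⟩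
    coeff (polyS (PR s) μ) e [] ∎
    where
    open ≡-Reasoning
    -- At least n, so that s is a word in S_N; at least the length of μ, so that the bound on the
    -- number of parts holds automatically and the layers beyond N do not contribute.
    N = n ⊔ length μ
    term : ∀ ν → ν ∈ below μ → ev (χ e []) (fullTerm r ν *P Dinf (permR s) (subE μ ν)) ≡
                               ev (χ e []) (keyTerm N r ν *P tcoeff (Dfin (permR s) N) (subE μ ν))
    term ν i = trans (cong (λ z → ev (χ e []) (z *P Dinf (permR s) κ))
          (fullTerm≡keyTerm N r ν (≤-trans (≤-reflexive (Pointwise-length (∈-below⁻ μ i))) (m≤n⊔m n (length μ)))))
      (trans (ev-*P (χ e []) (keyTerm N r ν) (Dinf (permR s) κ))
      (trans (ev-cong (λ xe te → HighLayers.ev-Dinf κ (shift xe te (χ e [])) (λ p → χ-cong e [] (addE-cong {a = xe} ≐-refl p) (≐-refl {addE te []})) (permR s) N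
          (≤-trans (≤-reflexive (length-subE (∈-below⁻ μ i))) (m≤n⊔m n (length μ)))) (keyTerm N r ν))
        (sym (ev-*P (χ e []) (keyTerm N r ν) (tcoeff (Dfin (permR s) N) κ)))))
      where κ = subE μ ν

open Coefficients

open import Data.Nat
open import Data.Nat.Properties
open import Data.Bool using (Bool; true; false; if_then_else_; _∧_)
open import Data.Empty using (⊥-elim)
open import Data.List using (List; []; _∷_; _++_; map; length; concatMap; foldl; take)
open import Data.List.Properties using (length-++; map-cong; ++-identityʳ; foldl-++; concatMap-cong; take-all)
open import Data.List.Membership.Propositional using (_∈_)
open import Data.List.Relation.Unary.Any using (here; there)
open import Data.List.Relation.Unary.All as All using (All; []; _∷_)
open import Data.List.Relation.Binary.Permutation.Propositional.Properties using (↭-length)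
open import Data.Product using (_×_; _,_; proj₁; proj₂; ∃)
open import Data.Sum using (_⊎_; inj₁; inj₂)
open import Function using (_∘_)
open import Relation.Nullary using (¬_; yes; no)
open import Relation.Binary.PropositionalEquality

-- Inversions, and the translation of the hypotheses on reduced words.

inverted : Perm → ℕ → ℕ → Bool
inverted w a b = (a <ᵇ b) ∧ (app w b <ᵇ app w a)

inverted⁻ : ∀ w a b → inverted w a b ≡ true → a < b × app w b < app w a
inverted⁻ w a b e with p , q ← ∧-true {a <ᵇ b} e = <ᵇ⇒< a b (≡-T p) , <ᵇ⇒< (app w b) (app w a) (≡-T q)

inverted⁺ : ∀ w a b → a < b → app w b < app w a → inverted w a b ≡ true
inverted⁺ w a b p q = true-∧ (T-≡ (<⇒<ᵇ p)) (T-≡ (<⇒<ᵇ q))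

inversions : Perm → ℕ → List ℕ
inversions w N = concatMap (λ a → boolFilter (inverted w a) (range1 N)) (range1 N)

boolFilter-++ : ∀ {A : Set} (p : A → Bool) xs ys → boolFilter p (xs ++ ys) ≡ boolFilter p xs ++ boolFilter p ys
boolFilter-++ p [] ys = refl
boolFilter-++ p (x ∷ xs) ys with p x
... | true = cong (x ∷_) (boolFilter-++ p xs ys)
... | false = boolFilter-++ p xs ys

boolFilter-none : ∀ {A : Set} (p : A → Bool) xs → (∀ {x} → x ∈ xs → ¬ p x ≡ true) → boolFilter p xs ≡ []
boolFilter-none p [] h = refl
boolFilter-none p (x ∷ xs) h with p x in e
... | true = ⊥-elim (h (here refl) e)
... | false = boolFilter-none p xs (h ∘ there)

boolFilter-mono : ∀ {A : Set} (p q : A → Bool) → (∀ x → p x ≡ true → q x ≡ true) → ∀ xs →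
  length (boolFilter p xs) ≤ length (boolFilter q xs)
boolFilter-mono p q h [] = z≤n
boolFilter-mono p q h (x ∷ xs) with p x in e | q x in f
... | true | true = s≤s (boolFilter-mono p q h xs)
... | true | false with () ← trans (sym f) (h x e)
... | false | true = m≤n⇒m≤1+n (boolFilter-mono p q h xs)
... | false | false = boolFilter-mono p q h xs

concatMap-mono : ∀ {A : Set} (f g : A → List ℕ) → (∀ x → length (f x) ≤ length (g x)) → ∀ xs →
  length (concatMap f xs) ≤ length (concatMap g xs)
concatMap-mono f g h [] = z≤n
concatMap-mono f g h (x ∷ xs) = subst₂ _≤_ (sym (length-++ (f x))) (sym (length-++ (g x)))
  (+-mono-≤ (h x) (concatMap-mono f g h xs))

-- N+1 is a fixed point exceeding all earlier values. Lists of different lengths, as for w and s_i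
-- w, can therefore be compared over a common range.
inversions-suc : ∀ r N → Below N r → inversions (permR r) (suc N) ≡ inversions (permR r) N
inversions-suc r N b = trans (concatMap-range1-suc row′ N)
  (trans (cong₂ _++_ (concatMap-cong rows (range1 N)) last) (++-identityʳ (inversions (permR r) N)))
  where
  w = permR r
  row row′ : ℕ → List ℕ
  row a = boolFilter (inverted w a) (range1 N)
  row′ a = boolFilter (inverted w a) (range1 (suc N))
  not-inverted : ∀ a → ¬ inverted w a (suc N) ≡ true
  not-inverted a e with p , q ← inverted⁻ w a (suc N) e = <-irrefl refl (begin-strict
    suc N            ≡⟨ fwd-fixes r b (suc N) ≤-refl ⟨
    fwd r (suc N)    ≡⟨ permR-represents r (suc N) ⟨
    app w (suc N)    <⟨ q ⟩
    app w a          ≡⟨ permR-represents r a ⟩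
    fwd r a          ≤⟨ fwd-bound r b a (≤-pred p) ⟩
    N                ≤⟨ n≤1+n N ⟩
    suc N            ∎)
    where open ≤-Reasoning
  rows : ∀ a → row′ a ≡ row a
  rows a = trans (boolFilter-++ (inverted w a) (range1 N) (suc N ∷ []))
    (trans (cong (row a ++_) (boolFilter-none (inverted w a) (suc N ∷ []) λ { (here refl) → not-inverted a })) (++-identityʳ (row a)))
  last : row′ (suc N) ≡ []
  last = boolFilter-none (inverted w (suc N)) (range1 (suc N))
    λ {x} i e → <⇒≱ (proj₁ (inverted⁻ w (suc N) x e)) (proj₂ (∈-range1⁻ (suc N) i))

inversions-beyond : ∀ r N d → Below N r → inversions (permR r) (d + N) ≡ inversions (permR r) N
inversions-beyond r N zero b = refl
inversions-beyond r N (suc d) b = trans (inversions-suc r (d + N) (Below-mono (m≤n+m N d) b)) (inversions-beyond r N d b)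

lengthP-at : ∀ r N → length (permR r) ≤ N → lengthP (permR r) ≡ length (inversions (permR r) N)
lengthP-at r N p = cong length (sym (trans (cong (inversions (permR r)) (sym (m∸n+n≡m p)))
  (inversions-beyond r (length (permR r)) (N ∸ length (permR r)) (Below-length r))))

-- A simple transposition reverses the order of no pair of values except i, i+1.
sw-< : ∀ i x y → sw i y < sw i x → y < x ⊎ (x ≡ i × y ≡ suc i)
sw-< zero zero (suc zero) p = inj₂ (refl , refl)
sw-< zero zero zero p = ⊥-elim (<-irrefl refl p)
sw-< zero zero (suc (suc y)) (s≤s ())
sw-< zero (suc (suc x)) zero p = inj₁ (s≤s z≤n)
sw-< zero (suc (suc x)) (suc zero) p = inj₁ (s≤s (s≤s z≤n))
sw-< zero (suc (suc x)) (suc (suc y)) p = inj₁ p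
sw-< (suc i) (suc x) zero p = inj₁ (s≤s z≤n)
sw-< (suc i) (suc x) (suc y) (s≤s p) with sw-< i x y p
... | inj₁ q = inj₁ (s≤s q)
... | inj₂ (e , f) = inj₂ (cong suc e , cong suc f)

-- The only inversion that s_i can create is the pair of positions of i and i+1, and only if i
-- stands first. Without an ascent every inversion of s_i w is already one of w.
lengthP-descent : ∀ j r → ¬ inv r (suc j) < inv r (2 + j) → lengthP (permR (j ∷ r)) ≤ lengthP (permR r)
lengthP-descent j r desc = subst₂ _≤_ (sym (lengthP-at (j ∷ r) N (≤-reflexive (length-sMul (suc j) (permR r)))))
  (sym (lengthP-at r N (m≤m⊔n (length (permR r)) (2 + j))))
  (concatMap-mono _ _ (λ a → boolFilter-mono _ _ (still a) (range1 N)) (range1 N))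
  where
  N = length (permR r) ⊔ (2 + j)
  still : ∀ a b → inverted (permR (j ∷ r)) a b ≡ true → inverted (permR r) a b ≡ true
  still a b e with a<b , q ← inverted⁻ (permR (j ∷ r)) a b e
    with sw-< (suc j) (fwd r a) (fwd r b) (subst₂ _<_ (permR-represents (j ∷ r) b) (permR-represents (j ∷ r) a) q)
  ... | inj₁ p = inverted⁺ (permR r) a b a<b (subst₂ _<_ (sym (permR-represents r b)) (sym (permR-represents r a)) p)
  ... | inj₂ (ea , eb) = ⊥-elim (desc (subst₂ _<_ (trans (sym (inv-fwd r a)) (cong (inv r) ea)) (trans (sym (inv-fwd r b)) (cong (inv r) eb)) a<b))

-- Back to the convention of the theorem: innermost letter first, letters starting from 1.
wordR : List ℕ → List ℕ
wordR [] = []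
wordR (j ∷ r) = wordR r ++ (suc j ∷ [])

length-wordR : ∀ r → length (wordR r) ≡ length r
length-wordR [] = refl
length-wordR (j ∷ r) = trans (length-++ (wordR r)) (trans (+-comm _ 1) (cong suc (length-wordR r)))

wordR-∷ʳ : ∀ r j → wordR (r ++ j ∷ []) ≡ suc j ∷ wordR r
wordR-∷ʳ [] j = refl
wordR-∷ʳ (k ∷ r) j = cong (_++ suc k ∷ []) (wordR-∷ʳ r j)

wordR-surjective : ∀ is → All (1 ≤_) is → ∃ λ r → is ≡ wordR r
wordR-surjective [] [] = [] , refl
wordR-surjective (suc j ∷ is) (_ ∷ ps) with r , e ← wordR-surjective is ps =
  r ++ j ∷ [] , trans (cong (suc j ∷_) e) (sym (wordR-∷ʳ r j))

wordPerm-wordR : ∀ r → wordPerm (wordR r) ≡ permR r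
wordPerm-wordR [] = refl
wordPerm-wordR (j ∷ r) = trans (foldl-++ _ [] (wordR r) (suc j ∷ [])) (cong (sMul (suc j)) (wordPerm-wordR r))

πword-wordR : ∀ r p → πword (wordR r) p ≡ πR r p
πword-wordR [] p = refl
πword-wordR (j ∷ r) p = trans (foldl-++ _ p (wordR r) (suc j ∷ [])) (cong (π (suc j)) (πword-wordR r p))

Pstep-wordR : ∀ r → foldl Pstep ([] , oneP) (wordR r) ≡ (permR r , PR r)
Pstep-wordR [] = refl
Pstep-wordR (j ∷ r) = trans (foldl-++ Pstep ([] , oneP) (wordR r) (suc j ∷ [])) (cong (λ z → Pstep z (suc j)) (Pstep-wordR r))

take-++ˡ : ∀ {A : Set} k (xs ys : List A) → k ≤ length xs → take k (xs ++ ys) ≡ take k xs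
take-++ˡ zero xs ys p = refl
take-++ˡ (suc k) (x ∷ xs) ys (s≤s p) = cong (x ∷_) (take-++ˡ k xs ys p)

-- Each prefix of a reduced word is one longer than the preceding one, whereas a letter that is not
-- an ascent would not increase the length.
reduced⇒Asc : ∀ r → (∀ k → k ≤ length (wordR r) → lengthP (wordPerm (take k (wordR r))) ≡ k) → Asc r
reduced⇒Asc [] h = _
reduced⇒Asc (j ∷ r) h = asc , reduced⇒Asc r shorter
  where
  shorter : ∀ k → k ≤ length (wordR r) → lengthP (wordPerm (take k (wordR r))) ≡ k
  shorter k p = trans (cong (lengthP ∘ wordPerm) (sym (take-++ˡ k (wordR r) (suc j ∷ []) p)))
    (h k (≤-trans p (≤-trans (m≤m+n _ 1) (≤-reflexive (sym (length-++ (wordR r)))))))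
  lengthP-full : ∀ r → (∀ k → k ≤ length (wordR r) → lengthP (wordPerm (take k (wordR r))) ≡ k) → lengthP (permR r) ≡ length r
  lengthP-full r h = trans (cong lengthP (trans (sym (wordPerm-wordR r)) (cong wordPerm (sym (take-all (length (wordR r)) (wordR r) ≤-refl)))))
    (trans (h (length (wordR r)) ≤-refl) (length-wordR r))
  asc : inv r (suc j) < inv r (2 + j)
  asc with inv r (suc j) <? inv r (2 + j)
  ... | yes p = p
  ... | no ¬p = ⊥-elim (<-irrefl refl (subst₂ _≤_ (lengthP-full (j ∷ r) h) (lengthP-full r shorter) (lengthP-descent j r ¬p)))

-- Suppose the outermost letter has j + 2 > n. Then w fixes j+2, so `inv r (suc j)` is j+2, and the
-- ascent gives j + 2 < p for p = w⁻¹(j+1). But then p > n is fixed by w as well, so p = j+1, a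
-- contradiction. Hence the letter lies in S_n and may be stripped.
fixes⇒Below : ∀ n r → Asc r → (∀ k → n < k → fwd r k ≡ k) → Below n r
fixes⇒Below n [] _ _ = []
fixes⇒Below n (j ∷ r) (asc , as) fix = bound ∷ fixes⇒Below n r as fix′
  where
  bound : 2 + j ≤ n
  bound with 2 + j ≤? n
  ... | yes p = p
  ... | no ¬p = ⊥-elim (<-irrefl (trans (sym p≡) (fix p n<p)) (<⇒≤ 2+j<p))
    where
    p = inv (j ∷ r) (suc j)
    q≡ : inv r (suc j) ≡ 2 + j
    q≡ = trans (cong (inv r) (sym (sw-right (suc j)))) (trans (cong (inv (j ∷ r)) (sym (fix (2 + j) (≰⇒> ¬p)))) (inv-fwd (j ∷ r) (2 + j)))
    2+j<p : 2 + j < p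
    2+j<p = subst₂ _<_ q≡ (cong (inv r) (sym (sw-left (suc j)))) asc
    n<p : n < p
    n<p = <-trans (≰⇒> ¬p) 2+j<p
    p≡ : fwd (j ∷ r) p ≡ suc j
    p≡ = fwd-inv (j ∷ r) (suc j)
  fix′ : ∀ k → n < k → fwd r k ≡ k
  fix′ k p = trans (sym (sw-involutive (suc j) (fwd r k))) (trans (cong (sw (suc j)) (fix k p)) (sw-above (suc j) k (≤-<-trans bound p)))

-- One-line notations of the same permutation may differ in length; A_l(w) depends on the values
-- only.
Dfin-cong : ∀ w v → w ≈P v → ∀ n → Dfin w n ≡ Dfin v n
Dfin-cong w v e n = cong prodP (concatMap-cong (λ l → cong (λ z → map (λ α → factor α l) (boolFilter (λ α → leAll α z) (choose l (range1 (maxL z)))))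
  (cong sortN (map-cong e (range1 l)))) (range1 n))

theorem3p9 : (n : ℕ) → 1 ≤ n → (w : Perm) → InS n w →
    (ρ σ : List ℕ) → ReducedWordOf w ρ → ReducedWordOf w σ →
    ((Kn n ρ ⋆ polyS (Dfin w n)) ≈S polyS (Pword σ)) ×
    ((Kall ρ ⋆ Dinf w) ≈S polyS (Pword σ))
theorem3p9 n _ w w∈Sₙ ρ σ (ρ-pos , ρ-red , ρ-perm) (σ-pos , σ-red , σ-perm)
  with r , refl ← wordR-surjective ρ ρ-pos
  with s , refl ← wordR-surjective σ σ-pos
  = first , second
  where
  r-asc : Asc r
  r-asc = reduced⇒Asc r ρ-red
  s-asc : Asc s
  s-asc = reduced⇒Asc s σ-red
  represents : ∀ t → wordPerm (wordR t) ≈P w → ∀ k → fwd t k ≡ app w k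
  represents t h k = trans (sym (permR-represents t k)) (trans (cong (λ v → app v k) (sym (wordPerm-wordR t))) (h k))
  same : ∀ k → inv r k ≡ inv s k
  same = fwd≗⇒inv≗ r s λ k → trans (represents r ρ-perm k) (sym (represents s σ-perm k))
  -- A rearrangement of 1, ..., n has n entries, so w fixes everything beyond n.
  below-n : Below n s
  below-n = fixes⇒Below n s s-asc λ k p → trans (represents s σ-perm k)
    (app-beyond w k (subst (_< k) (sym (trans (↭-length w∈Sₙ) (length-range1 n))) p))
  permR≈w : permR s ≈P w
  permR≈w k = trans (permR-represents s k) (represents s σ-perm k)
  Pword≡ : Pword (wordR s) ≡ PR s
  Pword≡ = cong proj₂ (Pstep-wordR s)
  first : (Kn n (wordR r) ⋆ polyS (Dfin w n)) ≈S polyS (Pword (wordR s))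
  first μ e = trans (cong (λ p → coeff p e []) (concatMap-cong (λ ν → cong₂ _*P_
      (cong (λ p → if hasParts n ν then p else []) (πword-wordR r _))
      (cong (λ D → tcoeff D (subE μ ν)) (sym (Dfin-cong (permR s) w permR≈w n)))) (below μ)))
    (trans (finite n r s r-asc s-asc same below-n μ e) (cong (λ p → coeff (tcoeff p μ) e []) (sym Pword≡)))
  second : (Kall (wordR r) ⋆ Dinf w) ≈S polyS (Pword (wordR s))
  second μ e = trans (cong (λ p → coeff p e []) (concatMap-cong (λ ν → cong₂ _*P_
      (cong (λ p → if isPartition ν then p else []) (πword-wordR r _))
      (cong (λ D → tcoeff D (subE μ ν)) (sym (Dfin-cong (permR s) w permR≈w (length (subE μ ν)))))) (below μ)))
    (trans (infinite n r s r-asc s-asc same below-n μ e) (cong (λ p → coeff (tcoeff p μ) e []) (sym Pword≡)))
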